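{- For every $\varepsilon > 0$ there exists $k_0$ such that for all integers $k \ge k_0$, \[ r_k(\mathcal{M}) < \left( \frac{10 + \sqrt{19}}{9} + \varepsilon \right) k. \]
   Context: A 3-uniform hypergraph is a set of 3-element subsets (triples) of a vertex set. The messy path $\mathcal{M}$ is the 3-uniform hypergraph $\{abc, bcd, def\}$ on six distinct vertices $a,b,c,d,e,f$. For a 3-uniform hypergraph $\mathcal{H}$, the multicolor Ramsey number $r_k(\mathcal{H})$ is the smallest integer $n$ such that every coloring of $\binom{[n]}{3}$ with $k$ colors contains a monochromatic copy of $\mathcal{H}$. -}

module Defs where

open import Data.Nat as ℕ using (ℕ)
open import Data.Fin using (Fin)
open import Data.Product using (Σ; _×_; ∃-syntax)
open import Data.Sum using (_⊎_)
open import Relation.Binary.PropositionalEquality using (_≡_; _≢_)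
open import Relation.Nullary using (¬_)
open import Data.Integer using (+_)
open import Data.Rational as ℚ using (ℚ; _<_; 0ℚ; _-_; _*_)

-- A k-colouring of the 3-element subsets of [n] = Fin n, represented as a
-- function on ordered triples that is invariant under all permutations of its
-- arguments (the two adjacent transpositions generate S₃).  Its values on
-- triples with repeated entries are irrelevant (they never get used).
record TripleColouring (n k : ℕ) : Set where
  field
    colour  : Fin n → Fin n → Fin n → Fin k
    swap₁₂  : ∀ x y z → colour x y z ≡ colour y x z
    swap₂₃  : ∀ x y z → colour x y z ≡ colour x z y
open TripleColouring public

Distinct6 : {n : ℕ} → Fin n → Fin n → Fin n → Fin n → Fin n → Fin n → Set
Distinct6 a b c d e f =
  a ≢ b × a ≢ c × a ≢ d × a ≢ e × a ≢ f ×
  b ≢ c × b ≢ d × b ≢ e × b ≢ f ×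
  c ≢ d × c ≢ e × c ≢ f ×
  d ≢ e × d ≢ f ×
  e ≢ f

HasMonoMessyPath : {n k : ℕ} → TripleColouring n k → Set
HasMonoMessyPath {n} {k} χ =
  ∃[ i ] ∃[ a ] ∃[ b ] ∃[ c ] ∃[ d ] ∃[ e ] ∃[ f ]
    (Distinct6 {n} a b c d e f
     × colour χ a b c ≡ i × colour χ b c d ≡ i × colour χ d e f ≡ i)

Arrows : ℕ → ℕ → Set
Arrows k n = (χ : TripleColouring n k) → HasMonoMessyPath χ

IsRamseyNumberMessyPath : ℕ → ℕ → Set
IsRamseyNumberMessyPath k r = Arrows k r × (∀ m → m ℕ.< r → ¬ Arrows k m)

ι : ℕ → ℚ
ι m = (+ m) ℚ./ 1

_<√_ : ℚ → ℕ → Set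
x <√ N = (x < 0ℚ) ⊎ ((x * x) < ι N)

-- r < ((10 + √19)/9 + ε) k
--   ⇔ 9r − 10k − 9εk < √19 · k = √(19 k²)   (k ≥ 0).
BelowBound : ℚ → ℕ → ℕ → Set
BelowBound ε k r =
  ((ι (9 ℕ.* r) - ι (10 ℕ.* k)) - ((ι 9 * ε) * ι k)) <√ (19 ℕ.* k ℕ.* k)

{-# OPTIONS --safe #-}
module Submission where

-- Let n = 67N, k = 42N and u = n - k = 25N, where 67/42 < (10 + √19)/9.  Suppose that
-- the triples of an n-set are coloured with k colours and no class contains a messy path.
-- Up to O(n) edges, each class then consists of stars (edges xvw with v, w in the set of
-- leaves of the centre x, these sets being disjoint) and of a linear hypergraph on the
-- vertices that are leaves of no star.  Give the vertices weights s with values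
-- in [0, M] and count each triple xyz with M(s_x s_y + s_y s_z + s_x s_z) - τ s_x s_y s_z.
-- If α_x is the number of leaves of x, a_x their total weight and b that of the vertices
-- that are no leaves, then a colour contributes at most
--   ∑_x (2M s_x a_x α_x + (M - τ s_x) a_x²) + M b²
-- to one third of the count of ordered triples, up to an error O(n M³).  Call a colour
-- huge if it has a star with more than k leaves, and let m be the number of other colours.
--
-- First take τ = 2 and total weight uM, where every colour forces the total weight down
-- by at most M, through caps on the weights of the centres of its large stars.  Then huge
-- colours contribute at most their share M(uM)², and the gains of the others, which are
-- bounded in terms of their largest star, must add up to u³/3 (for M = 1).  Next take
-- τ = 0, M = 1 and the indicator of u + m vertices which contain no centre of a star with
-- more than k leaves.  In a suitable combination of the two counts the contribution of a
-- colour that is not huge becomes, up to a square, independent of the sizes of its stars,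
-- and the result is (m - 29N)²(254N - 4m) + 21mN² + 1336N³ ≤ O(N²), where m ≤ 42N.

open import Defs
open import Data.Nat as ℕ using (ℕ; zero; suc; _≥_)
import Data.Nat.Properties as ℕₚ
import Data.Nat.DivMod as ℕ
open import Data.Fin using (Fin; zero; suc; _≟_; inject≤)
import Data.Fin.Properties as Finₚ
open import Data.Integer as ℤ hiding (suc; _≟_; _≥_; Positive)
import Data.Integer.Properties as ℤₚ
open import Data.Integer.Properties hiding (_≟_)
open import Data.Integer.Tactic.RingSolver using (solve-∀)
open import Data.Rational as ℚ using (ℚ; Positive; 0ℚ)
import Data.Rational.Properties as ℚₚ
import Data.Rational.Unnormalised as ℚᵘ
import Data.Rational.Unnormalised.Properties as ℚᵘₚ
open import Data.List using (List; []; _∷_; length)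
open import Data.List.Membership.Propositional using (_∈_; _∉_)
open import Data.List.Membership.DecPropositional using (_∈?_)
open import Data.List.Relation.Unary.Any using (here; there)
open import Data.Product using (_×_; _,_; proj₁; proj₂; ∃-syntax)
open import Data.Sum using (_⊎_; inj₁; inj₂; [_,_]′)
open import Data.Empty using (⊥; ⊥-elim)
open import Function using (_∘_)
open import Relation.Nullary using (¬_; Dec; yes; no; contradiction)
open import Relation.Nullary.Decidable using (_×-dec_; _⊎-dec_; _→-dec_; ¬?; from-yes; decidable-stable)
open import Relation.Binary.PropositionalEquality using (_≡_; _≢_; refl; sym; trans; cong; cong₂; subst; subst₂; module ≡-Reasoning)
open import Algebra.Properties.Semiring.Sum +-*-semiring using (sum; sum-cong-≗; ∑-distrib-+; ∑-comm; *-distribˡ-sum; *-distribʳ-sum)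

-- Integer inequalities with nonnegative remainders

≤-by : ∀ {a b} d → 0ℤ ≤ d → b ≡ a + d → a ≤ b
≤-by {a} d 0≤d refl = subst (_≤ a + d) (+-identityʳ a) (+-monoʳ-≤ a 0≤d)

-- The polynomial inequalities below are proved by certificates: `≤-by` receives a remainder built
-- from `diff`, `⊗`, `⊕` and `square≥0`, and the ring solver checks the identity.
diff : ∀ {a b} → a ≤ b → 0ℤ ≤ b - a
diff = i≤j⇒0≤j-i

infixr 7 _⊗_
infixr 6 _⊕_

_⊗_ : ∀ {a b} → 0ℤ ≤ a → 0ℤ ≤ b → 0ℤ ≤ a * b
_⊗_ {+ m} {+ n} _ _ = subst (0ℤ ≤_) (pos-* m n) (+≤+ ℕ.z≤n)

_⊕_ : ∀ {a b} → 0ℤ ≤ a → 0ℤ ≤ b → 0ℤ ≤ a + b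
_⊕_ = +-mono-≤

0≤+ : ∀ {n} → 0ℤ ≤ + n
0≤+ = +≤+ ℕ.z≤n

square≥0 : ∀ a → 0ℤ ≤ a * a
square≥0 (+ n)      = 0≤+ {n} ⊗ 0≤+ {n}
square≥0 -[1+ n ] = 0≤+

*-mono-nonneg : ∀ {a b c d} → 0ℤ ≤ a → a ≤ b → 0ℤ ≤ c → c ≤ d → a * c ≤ b * d
*-mono-nonneg {a} {b} {c} {d} 0≤a a≤b 0≤c c≤d =
  ≤-by ((b - a) * d + a * (d - c))
    (diff a≤b ⊗ ≤-trans 0≤c c≤d ⊕ 0≤a ⊗ diff c≤d) (eq a b c d)
  where
  eq : ∀ a b c d → b * d ≡ a * c + ((b - a) * d + a * (d - c))
  eq = solve-∀

*-monoˡ : ∀ {a b} c → 0ℤ ≤ c → a ≤ b → c * a ≤ c * b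
*-monoˡ c 0≤c a≤b = *-monoˡ-≤-nonNeg c {{nonNegative 0≤c}} a≤b

-- Indicators of decidable propositions

𝟙 : ∀ {p} {P : Set p} → Dec P → ℤ
𝟙 (yes _) = 1ℤ
𝟙 (no _)  = 0ℤ

module _ {p} {P : Set p} where

  𝟙-yes : (d : Dec P) → P → 𝟙 d ≡ 1ℤ
  𝟙-yes (yes _) _ = refl
  𝟙-yes (no ¬p) p = contradiction p ¬p

  𝟙-no : (d : Dec P) → ¬ P → 𝟙 d ≡ 0ℤ
  𝟙-no (yes p) ¬p = contradiction p ¬p
  𝟙-no (no _)  _  = refl

  0≤𝟙 : (d : Dec P) → 0ℤ ≤ 𝟙 d
  0≤𝟙 (yes _) = 0≤+
  0≤𝟙 (no _)  = 0≤+

  𝟙≤1 : (d : Dec P) → 𝟙 d ≤ 1ℤ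
  𝟙≤1 (yes _) = ≤-refl
  𝟙≤1 (no _)  = 0≤+

  𝟙≤ : ∀ {a} (d : Dec P) → 0ℤ ≤ a → (P → 1ℤ ≤ a) → 𝟙 d ≤ a
  𝟙≤ (yes p) _ h = h p
  𝟙≤ (no _)  h _ = h

𝟙-mono : ∀ {p q} {P : Set p} {Q : Set q} (d : Dec P) (e : Dec Q) → (P → Q) → 𝟙 d ≤ 𝟙 e
𝟙-mono d e f = 𝟙≤ d (0≤𝟙 e) λ p → ≤-reflexive (sym (𝟙-yes e (f p)))

𝟙-⇔ : ∀ {p q} {P : Set p} {Q : Set q} (d : Dec P) (e : Dec Q) → (P → Q) → (Q → P) → 𝟙 d ≡ 𝟙 e
𝟙-⇔ d e f g = ≤-antisym (𝟙-mono d e f) (𝟙-mono e d g)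

-- Finite sums, counting and triple sums

private variable
  n k : ℕ

∑-mono : {f g : Fin n → ℤ} → (∀ i → f i ≤ g i) → sum f ≤ sum g
∑-mono {zero}  _ = ≤-refl
∑-mono {suc n} h = +-mono-≤ (h zero) (∑-mono (h ∘ suc))

∑-nonneg : {f : Fin n → ℤ} → (∀ i → 0ℤ ≤ f i) → 0ℤ ≤ sum f
∑-nonneg {zero}  _ = ≤-refl
∑-nonneg {suc n} h = h zero ⊕ ∑-nonneg (h ∘ suc)

∑-zero : {f : Fin n → ℤ} → (∀ i → f i ≡ 0ℤ) → sum f ≡ 0ℤ
∑-zero {zero}  _ = refl
∑-zero {suc n} h = cong₂ _+_ (h zero) (∑-zero (h ∘ suc))

∑-const : ∀ n a → sum {n} (λ _ → a) ≡ + n * a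
∑-const zero    a = sym (*-zeroˡ a)
∑-const (suc n) a = trans (cong (_+_ a) (∑-const n a)) (eq a (+ n))
  where
  eq : ∀ a m → a + m * a ≡ (1ℤ + m) * a
  eq = solve-∀

∑-+ : (f g : Fin n → ℤ) → sum (λ i → f i + g i) ≡ sum f + sum g
∑-+ = ∑-distrib-+

∑-*ˡ : (a : ℤ) (f : Fin n → ℤ) → sum (λ i → a * f i) ≡ a * sum f
∑-*ˡ a f = sym (*-distribˡ-sum a f)

∑-*ʳ : (a : ℤ) (f : Fin n → ℤ) → sum (λ i → f i * a) ≡ sum f * a
∑-*ʳ a f = sym (*-distribʳ-sum a f)

∑-cong : {f g : Fin n → ℤ} → (∀ i → f i ≡ g i) → sum f ≡ sum g
∑-cong h = sum-cong-≗ h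

∑-const≤ : {f : Fin n → ℤ} (a : ℤ) → (∀ i → f i ≤ a) → sum f ≤ + n * a
∑-const≤ {n} a h = ≤-trans (∑-mono h) (≤-reflexive (∑-const n a))

term≤∑ : {f : Fin n → ℤ} → (∀ i → 0ℤ ≤ f i) → ∀ i → f i ≤ sum f
term≤∑ h zero    = ≤-by _ (∑-nonneg (h ∘ suc)) refl
term≤∑ {f = f} h (suc i) = ≤-trans (term≤∑ (h ∘ suc) i)
  (≤-by _ (h zero) (+-comm (f zero) (sum (f ∘ suc))))

∑-pick : (x : Fin n) (f : Fin n → ℤ) → sum (λ y → 𝟙 (x ≟ y) * f y) ≡ f x
∑-pick {suc n} zero    f = trans
  (cong₂ _+_ (*-identityˡ (f zero)) (∑-zero λ i → *-zeroˡ (f (suc i)))) (+-identityʳ (f zero))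
∑-pick {suc n} (suc x) f = trans
  (cong₂ _+_ (*-zeroˡ (f zero))
    (trans (∑-cong λ y → cong (_* f (suc y)) (𝟙-⇔ (suc x ≟ suc y) (x ≟ y) Finₚ.suc-injective (cong suc)))
      (∑-pick x (f ∘ suc))))
  (+-identityˡ (f (suc x)))

∑-𝟙 : (x : Fin n) → sum (λ y → 𝟙 (x ≟ y)) ≡ 1ℤ
∑-𝟙 x = trans (∑-cong λ y → sym (*-identityʳ (𝟙 (x ≟ y)))) (∑-pick x (λ _ → 1ℤ))

∑-product : {f g : Fin n → ℤ} → (∀ i → 0ℤ ≤ f i) → (∀ i → 0ℤ ≤ g i) →
            sum (λ i → f i * g i) ≤ sum f * sum g
∑-product {f = f} {g} hf hg = ≤-trans
  (∑-mono λ i → *-monoˡ (f i) (hf i) (term≤∑ hg i))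
  (≤-reflexive (∑-*ʳ (sum g) f))

_off_ : (Fin n → ℤ) → Fin n → Fin n → ℤ
(f off z) i = (1ℤ - 𝟙 (z ≟ i)) * f i

∑-off : (f : Fin n → ℤ) (z : Fin n) → sum f ≡ f z + sum (f off z)
∑-off f z = trans (∑-cong λ i → eq (𝟙 (z ≟ i)) (f i))
  (trans (∑-+ (λ i → 𝟙 (z ≟ i) * f i) (f off z)) (cong (_+ sum (f off z)) (∑-pick z f)))
  where
  eq : ∀ d x → x ≡ d * x + (1ℤ - d) * x
  eq = solve-∀

off-nonneg : {f : Fin n → ℤ} (z : Fin n) → (∀ i → 0ℤ ≤ f i) → ∀ i → 0ℤ ≤ (f off z) i
off-nonneg {f = f} z h i = diff (𝟙≤1 (z ≟ i)) ⊗ h i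

occ : List (Fin n) → Fin n → ℤ
occ []      p = 0ℤ
occ (a ∷ l) p = 𝟙 (a ≟ p) + occ l p

occ-nonneg : (l : List (Fin n)) → ∀ p → 0ℤ ≤ occ l p
occ-nonneg []      p = ≤-refl
occ-nonneg (a ∷ l) p = 0≤𝟙 (a ≟ p) ⊕ occ-nonneg l p

occ-∈ : {l : List (Fin n)} {p : Fin n} → p ∈ l → 1ℤ ≤ occ l p
occ-∈ {l = a ∷ l} {p} (here p≡a) = ≤-trans (≤-reflexive (sym (𝟙-yes (a ≟ p) (sym p≡a))))
  (≤-by _ (occ-nonneg l p) refl)
occ-∈ {l = a ∷ l} {p} (there p∈l) = ≤-trans (occ-∈ p∈l)
  (≤-by _ (0≤𝟙 (a ≟ p)) (+-comm (𝟙 (a ≟ p)) (occ l p)))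

∑-occ : (l : List (Fin n)) → sum (occ l) ≡ + length l
∑-occ {n} []      = ∑-zero {n} λ _ → refl
∑-occ (a ∷ l) = trans (∑-+ (λ p → 𝟙 (a ≟ p)) (occ l)) (cong₂ _+_ (∑-𝟙 a) (∑-occ l))

count≤length : ∀ {p} {P : Fin n → Set p} (P? : ∀ i → Dec (P i)) (l : List (Fin n)) →
               (∀ i → P i → i ∈ l) → sum (λ i → 𝟙 (P? i)) ≤ + length l
count≤length P? l h = ≤-trans
  (∑-mono λ i → 𝟙≤ (P? i) (occ-nonneg l i) (λ p → occ-∈ (h i p)))
  (≤-reflexive (∑-occ l))

-- Pigeonhole: otherwise `l` contains all indices with `P`. It supplies a vertex that avoids a few
-- given ones.
find-∉ : ∀ {p} {P : Fin n → Set p} (P? : ∀ i → Dec (P i)) (l : List (Fin n)) →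
         + length l < sum (λ i → 𝟙 (P? i)) → ∃[ i ] (P i × i ∉ l)
find-∉ P? l l<c with Finₚ.any? (λ i → P? i ×-dec ¬? (_∈?_ _≟_ i l))
... | yes found = found
... | no none   = ⊥-elim (<⇒≱ l<c (count≤length P? l in-list))
  where
  in-list : ∀ i → _ → i ∈ l
  in-list i p with _∈?_ _≟_ i l
  ... | yes i∈l = i∈l
  ... | no i∉l  = ⊥-elim (none (i , p , i∉l))

∑³ : (Fin n → Fin n → Fin n → ℤ) → ℤ
∑³ f = sum λ x → sum λ y → sum λ z → f x y z

∑³-cong : {f g : Fin n → Fin n → Fin n → ℤ} → (∀ x y z → f x y z ≡ g x y z) → ∑³ f ≡ ∑³ g
∑³-cong h = ∑-cong λ x → ∑-cong λ y → ∑-cong λ z → h x y z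

∑³-mono : {f g : Fin n → Fin n → Fin n → ℤ} → (∀ x y z → f x y z ≤ g x y z) → ∑³ f ≤ ∑³ g
∑³-mono h = ∑-mono λ x → ∑-mono λ y → ∑-mono λ z → h x y z

∑³-+ : (f g : Fin n → Fin n → Fin n → ℤ) → ∑³ (λ x y z → f x y z + g x y z) ≡ ∑³ f + ∑³ g
∑³-+ f g = trans (∑-cong λ x → trans (∑-cong λ y → ∑-+ (f x y) (g x y))
                   (∑-+ (λ y → sum (f x y)) (λ y → sum (g x y))))
                 (∑-+ (λ x → sum λ y → sum (f x y)) (λ x → sum λ y → sum (g x y)))

∑³-*ˡ : (a : ℤ) (f : Fin n → Fin n → Fin n → ℤ) → ∑³ (λ x y z → a * f x y z) ≡ a * ∑³ f
∑³-*ˡ a f = trans (∑-cong λ x → trans (∑-cong λ y → ∑-*ˡ a (f x y)) (∑-*ˡ a (λ y → sum (f x y))))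
                  (∑-*ˡ a (λ x → sum λ y → sum (f x y)))

∑³-swap : (f : Fin n → Fin n → Fin n → ℤ) → ∑³ f ≡ ∑³ (λ x y z → f y x z)
∑³-swap f = ∑-comm (λ x y → sum (f x y))

∑³-rotate : (f : Fin n → Fin n → Fin n → ℤ) → ∑³ f ≡ ∑³ (λ x y z → f y z x)
∑³-rotate f = trans (∑-cong λ x → ∑-comm (f x)) (∑-comm (λ x z → sum λ y → f x y z))

∑∑-* : (f g : Fin n → ℤ) → (sum λ y → sum λ z → f y * g z) ≡ sum f * sum g
∑∑-* f g = trans (∑-cong λ y → ∑-*ˡ (f y) g) (∑-*ʳ (sum g) f)

-- The structure of hypergraphs without a messy path

record Hypergraph (n : ℕ) : Set₁ where
  field
    E        : Fin n → Fin n → Fin n → Set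
    E?       : ∀ x y z → Dec (E x y z)
    flip₁₂   : ∀ {x y z} → E x y z → E y x z
    flip₂₃   : ∀ {x y z} → E x y z → E x z y
    distinct : ∀ {x y z} → E x y z → x ≢ y

  edge : Fin n → Fin n → Fin n → ℤ
  edge x y z = 𝟙 (E? x y z)

  codeg : Fin n → Fin n → ℤ
  codeg u v = sum λ p → edge u v p

  deg : Fin n → ℤ
  deg v = sum λ p → codeg v p

  rotate : ∀ {x y z} → E x y z → E y z x
  rotate e = flip₂₃ (flip₁₂ e)

  rotate′ : ∀ {x y z} → E x y z → E z x y
  rotate′ e = flip₁₂ (flip₂₃ e)

  -- Vertices of a common edge are distinct anyway, so only `a ≢ d` and the position of `e` and `f`
  -- relative to `a`, `b`, `c` have to be stated.
  MessyFree : Set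
  MessyFree = ∀ {a b c d e f} → E a b c → E b c d → E d e f → a ≢ d →
              e ∉ a ∷ b ∷ c ∷ [] → f ∉ a ∷ b ∷ c ∷ [] → ⊥

  -- deg counts ordered pairs.  If all edges at x meet a given triple of vertices,
  -- then deg x ≥ 25 > 2 · (4 + 4 + 4) makes one of the three codegrees at x exceed 4.
  Rich : Set
  Rich = ∀ {x y z} → E x y z → + 25 ≤ deg x

  -- The degree condition excludes isolated vertices, for which the second condition holds with
  -- every `x`.
  Leaf : Fin n → Fin n → Set
  Leaf v x = + 25 ≤ deg v × (∀ p q → E v p q → x ≡ p ⊎ x ≡ q)

  leaf? : ∀ v x → Dec (Leaf v x)
  leaf? v x = (+ 25 ≤? deg v) ×-dec
    Finₚ.all? λ p → Finₚ.all? λ q → E? v p q →-dec (x ≟ p ⊎-dec x ≟ q)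

  codegs : Fin n → List (Fin n) → ℤ
  codegs v []      = 0ℤ
  codegs v (t ∷ l) = codeg v t + codegs v l

  -- Each edge at `v` is counted by the codegree of `v` with a member of `l`. The factor 2 is there
  -- because that member may be either entry of the ordered pair counted by `deg`.
  deg≤codegs : ∀ v l → (∀ p q → E v p q → p ∈ l ⊎ q ∈ l) → deg v ≤ + 2 * codegs v l
  deg≤codegs v l h = ≤-trans (∑-mono λ p → ∑-mono λ q → bound p q) (≤-reflexive total)
    where
    via : List (Fin n) → Fin n → Fin n → ℤ
    via []      p q = 0ℤ
    via (t ∷ l) p q = 𝟙 (t ≟ p) * edge v t q + via l p q

    via-nonneg : ∀ l p q → 0ℤ ≤ via l p q
    via-nonneg []      p q = ≤-refl
    via-nonneg (t ∷ l) p q = 0≤𝟙 (t ≟ p) ⊗ 0≤𝟙 (E? v t q) ⊕ via-nonneg l p q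

    via-∈ : ∀ {l p q} → p ∈ l → E v p q → 1ℤ ≤ via l p q
    via-∈ {t ∷ l} {p} {q} (here refl) e = ≤-trans
      (≤-reflexive (sym (cong₂ _*_ (𝟙-yes (t ≟ t) refl) (𝟙-yes (E? v t q) e))))
      (≤-by _ (via-nonneg l p q) refl)
    via-∈ {t ∷ l} {p} {q} (there p∈l) e = ≤-trans (via-∈ p∈l e)
      (≤-by _ (0≤𝟙 (t ≟ p) ⊗ 0≤𝟙 (E? v t q)) (+-comm (𝟙 (t ≟ p) * edge v t q) (via l p q)))

    ∑-via : ∀ l → (sum λ p → sum λ q → via l p q) ≡ codegs v l
    ∑-via []      = ∑-zero {n} λ p → ∑-zero {n} λ q → refl
    ∑-via (t ∷ l) = trans
      (∑-cong λ p → trans (∑-+ (λ q → 𝟙 (t ≟ p) * edge v t q) (via l p))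
                          (cong (λ a → a + sum (via l p)) (∑-*ˡ (𝟙 (t ≟ p)) (edge v t))))
      (trans (∑-+ (λ p → 𝟙 (t ≟ p) * codeg v t) (λ p → sum (via l p)))
             (cong₂ _+_ (∑-pick t (λ _ → codeg v t)) (∑-via l)))

    bound : ∀ p q → edge v p q ≤ via l p q + via l q p
    bound p q = 𝟙≤ (E? v p q) (via-nonneg l p q ⊕ via-nonneg l q p) λ e →
      [ (λ p∈l → ≤-trans (via-∈ p∈l e) (≤-by _ (via-nonneg l q p) refl))
      , (λ q∈l → ≤-trans (via-∈ q∈l (flip₂₃ e))
                   (≤-by _ (via-nonneg l p q) (+-comm (via l p q) (via l q p)))) ]′ (h p q e)

    double : ∀ a → a + a ≡ + 2 * a
    double = solve-∀

    total : (sum λ p → sum λ q → via l p q + via l q p) ≡ + 2 * codegs v l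
    total = trans (∑-cong λ p → ∑-+ (λ q → via l p q) (λ q → via l q p))
      (trans (∑-+ (λ p → sum λ q → via l p q) (λ p → sum λ q → via l q p))
      (trans (cong₂ _+_ (∑-via l) (trans (∑-comm (λ p q → via l q p)) (∑-via l)))
             (double (codegs v l))))

-- Decomposition into stars and a linear part

module Structure {n : ℕ} (H : Hypergraph n) (free : Hypergraph.MessyFree H) (rich : Hypergraph.Rich H) where

  open Hypergraph H

  private
    infix 4 _∈ˡ_
    _∈ˡ_ : ∀ (p : Fin n) l → Dec (p ∈ l)
    _∈ˡ_ = _∈?_ _≟_

  -- The edges `w x y` and `x y z` are completed to a messy path by any edge at `z` that avoids `w`,
  -- `x` and `y`.
  meets-path : ∀ {x y z w} → E x y z → E x y w → w ≢ z → ∀ p q → E z p q →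
               p ∈ w ∷ x ∷ y ∷ [] ⊎ q ∈ w ∷ x ∷ y ∷ []
  meets-path {x} {y} {z} {w} exyz exyw w≢z p q e with p ∈ˡ (w ∷ x ∷ y ∷ []) | q ∈ˡ (w ∷ x ∷ y ∷ [])
  ... | yes p∈ | _      = inj₁ p∈
  ... | no _   | yes q∈ = inj₂ q∈
  ... | no p∉  | no q∉  = ⊥-elim (free (rotate′ exyw) exyz e w≢z p∉ q∉)

  -- Among more than three vertices completing `u v` to an edge, one, `a`, differs from `z`, `p` and
  -- `q`. Then `meets-path` with `a` as `w` leaves only `u` and `v` as meeting points.
  meets-spine : ∀ {u v z} → + 3 < codeg u v → E u v z → ∀ p q → E z p q →
                p ∈ u ∷ v ∷ [] ⊎ q ∈ u ∷ v ∷ []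
  meets-spine {u} {v} {z} big euvz p q e with find-∉ (E? u v) (z ∷ p ∷ q ∷ []) big
  ... | a , euva , a∉ with meets-path euvz euva (λ a≡z → a∉ (here a≡z)) p q e
  ... | inj₁ (here p≡a)  = ⊥-elim (a∉ (there (here (sym p≡a))))
  ... | inj₁ (there p∈)  = inj₁ p∈
  ... | inj₂ (here q≡a)  = ⊥-elim (a∉ (there (there (here (sym q≡a)))))
  ... | inj₂ (there q∈)  = inj₂ q∈

  codeg≤length : ∀ {u v} l → (∀ p → E u v p → p ∈ l) → codeg u v ≤ + length l
  codeg≤length {u} {v} = count≤length (E? u v)

  private
    too-small : ∀ {d} m → m ℕ.< 25 → + 25 ≤ d → d ≤ + m → ⊥
    too-small m m<25 lo hi = <⇒≱ (+<+ m<25) (≤-trans lo hi)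

  codeg-page≤3 : ∀ {x y z w p} → E x y z → E x y w → w ≢ z → p ∉ w ∷ x ∷ y ∷ [] → codeg p z ≤ + 3
  codeg-page≤3 {x} {y} {z} {w} {p} exyz exyw w≢z p∉ = codeg≤length (w ∷ x ∷ y ∷ []) λ f e →
    [ (λ p∈ → ⊥-elim (p∉ p∈)) , (λ f∈ → f∈) ]′ (meets-path exyz exyw w≢z p f (flip₁₂ e))

  private
    twice-six : ∀ {a b} → a ≤ + 3 → b ≤ + 3 → + 2 * (a + (b + 0ℤ)) ≤ + 12
    twice-six a≤3 b≤3 = *-monoˡ (+ 2) 0≤+ (+-mono-≤ a≤3 (+-mono-≤ b≤3 (≤-refl {0ℤ})))

    12<25 : 12 ℕ.< 25
    12<25 = from-yes (12 ℕ.<? 25)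

  -- Otherwise an edge `z w p` exists with `p` outside `w`, `x`, `y`. Every edge at `p` meets `z` or
  -- `w`, and both codegrees at `p` are at most 3 by `codeg-page≤3`. So `p` has degree at most 12,
  -- which contradicts `Rich`.
  codeg-opposite≤4 : ∀ {x y z w} → E x y z → E x y w → w ≢ z → codeg z w ≤ + 4
  codeg-opposite≤4 {x} {y} {z} {w} exyz exyw w≢z with codeg z w ≤? + 4
  ... | yes small = small
  ... | no ¬small = ⊥-elim (absurd (find-∉ (E? z w) (w ∷ x ∷ y ∷ []) (<-trans 3<4 (≰⇒> ¬small))))
    where
    3<4 : + 3 < + 4
    3<4 = +<+ (from-yes (3 ℕ.<? 4))

    absurd : ∃[ p ] (E z w p × p ∉ w ∷ x ∷ y ∷ []) → ⊥
    absurd (p , ezwp , p∉) = too-small 12 12<25 (rich (rotate′ ezwp)) (≤-trans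
      (deg≤codegs p (z ∷ w ∷ []) (meets-spine (<-trans 3<4 (≰⇒> ¬small)) ezwp))
      (twice-six (codeg-page≤3 exyz exyw w≢z p∉)
                 (codeg-page≤3 exyw exyz (w≢z ∘ sym) λ
                   { (here p≡z)         → distinct (rotate′ ezwp) p≡z
                   ; (there p∈)         → p∉ (there p∈) })))

  -- Suppose an edge `z e f` misses `x`, and choose an edge `z x p` with `p` outside `w`, `y`, `e`,
  -- `f`. Edges at `p` meet `z` or `x`, and `codeg p z` is at most 3, so richness forces `codeg p x`
  -- above 3. Then the pair `p x` is a spine as well, and the edges at `z` meet `p` or `x`, a
  -- contradiction. Edges at `y` meet `z` or `x`, and those through `z` contain `x` by the first
  -- claim.
  leaves-of-spine : ∀ {x y z w} → E x y z → E x y w → w ≢ z → + 4 < codeg z x → Leaf z x × Leaf y x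
  leaves-of-spine {x} {y} {z} {w} exyz exyw w≢z big =
    (rich (rotate′ exyz) , leaf-z) , (rich (flip₁₂ exyz) , leaf-y)
    where
    big₃ : + 3 < codeg z x
    big₃ = <-trans (+<+ (from-yes (3 ℕ.<? 4))) big

    leaf-z : ∀ e f → E z e f → x ≡ e ⊎ x ≡ f
    leaf-z e f ezef with x ≟ e | x ≟ f
    ... | yes x≡e | _       = inj₁ x≡e
    ... | no _    | yes x≡f = inj₂ x≡f
    ... | no x≢e  | no x≢f  = ⊥-elim (absurd (find-∉ (E? z x) (w ∷ y ∷ e ∷ f ∷ []) big))
      where
      absurd : ∃[ p ] (E z x p × p ∉ w ∷ y ∷ e ∷ f ∷ []) → ⊥
      absurd (p , ezxp , p∉) with codeg p x ≤? + 3
      ... | yes small = too-small 12 12<25 (rich (rotate′ ezxp)) (≤-trans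
        (deg≤codegs p (z ∷ x ∷ []) (meets-spine big₃ ezxp))
        (twice-six (codeg-page≤3 exyz exyw w≢z λ
                      { (here p≡w)                 → p∉ (here p≡w)
                      ; (there (here p≡x))         → distinct (rotate ezxp) (sym p≡x)
                      ; (there (there (here p≡y))) → p∉ (there (here p≡y)) })
                   small))
      ... | no ¬small with meets-spine (≰⇒> ¬small) (flip₂₃ (rotate′ ezxp)) e f ezef
      ... | inj₁ (here e≡p)         = p∉ (there (there (here (sym e≡p))))
      ... | inj₁ (there (here e≡x)) = x≢e (sym e≡x)
      ... | inj₂ (here f≡p)         = p∉ (there (there (there (here (sym f≡p)))))
      ... | inj₂ (there (here f≡x)) = x≢f (sym f≡x)

    x≢y : x ≢ y
    x≢y = distinct exyz

    leaf-y : ∀ e f → E y e f → x ≡ e ⊎ x ≡ f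
    leaf-y e f eyef with meets-spine big₃ (rotate′ exyz) e f eyef
    ... | inj₁ (there (here e≡x)) = inj₁ (sym e≡x)
    ... | inj₂ (there (here f≡x)) = inj₂ (sym f≡x)
    ... | inj₁ (here refl)        = inj₂ ([ (λ x≡y → ⊥-elim (x≢y x≡y)) , (λ p → p) ]′ (leaf-z y f (flip₁₂ eyef)))
    ... | inj₂ (here refl)        = inj₁ ([ (λ x≡y → ⊥-elim (x≢y x≡y)) , (λ p → p) ]′ (leaf-z y e (rotate′ eyef)))

  -- All edges at `z` meet `w`, `x` or `y`. If all three codegrees were at most 4, the degree of `z`
  -- would be at most 24. Since `codeg z w` is small, `z x` or `z y` is a spine for
  -- `leaves-of-spine`.
  star-of-pair : ∀ {x y z w} → E x y z → E x y w → w ≢ z →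
                 (Leaf y x × Leaf z x) ⊎ (Leaf x y × Leaf z y)
  star-of-pair {x} {y} {z} {w} exyz exyw w≢z with codeg z x ≤? + 4 | codeg z y ≤? + 4
  ... | no big | _ = inj₁ (let (lz , ly) = leaves-of-spine exyz exyw w≢z (≰⇒> big) in ly , lz)
  ... | yes _ | no big = inj₂ (let (lz , lx) = leaves-of-spine (flip₁₂ exyz) (flip₁₂ exyw) w≢z (≰⇒> big) in lx , lz)
  ... | yes zx≤4 | yes zy≤4 = ⊥-elim (too-small 24 (from-yes (24 ℕ.<? 25)) (rich (rotate′ exyz)) (≤-trans
    (deg≤codegs z (w ∷ x ∷ y ∷ []) (meets-path exyz exyw w≢z))
    (*-monoˡ (+ 2) 0≤+ (+-mono-≤ (codeg-opposite≤4 exyz exyw w≢z) (+-mono-≤ zx≤4 (+-mono-≤ zy≤4 (≤-refl {0ℤ})))))))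

  leaf-big : ∀ {v x} → Leaf v x → 1ℤ < codeg v x
  leaf-big {v} {x} (rich-v , through) with codeg v x ≤? 1ℤ
  ... | no big   = ≰⇒> big
  ... | yes ≤1   = ⊥-elim (too-small 2 (from-yes (2 ℕ.<? 25)) rich-v (≤-trans
    (deg≤codegs v (x ∷ []) λ p q e → [ (λ x≡p → inj₁ (here (sym x≡p))) , (λ x≡q → inj₂ (here (sym x≡q))) ]′ (through p q e))
    (*-monoˡ (+ 2) 0≤+ (+-mono-≤ ≤1 (≤-refl {0ℤ})))))

  -- With two centres, every edge through `v` and `x` would have `y` as its third vertex, contrary
  -- to `leaf-big`.
  leaf-unique : ∀ {v x y} → Leaf v x → Leaf v y → x ≡ y
  leaf-unique {v} {x} {y} lx ly with x ≟ y
  ... | yes x≡y = x≡y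
  ... | no x≢y  = ⊥-elim (<⇒≱ (leaf-big lx) (codeg≤length (y ∷ []) λ q e →
    [ (λ y≡x → ⊥-elim (x≢y (sym y≡x))) , (λ y≡q → here (sym y≡q)) ]′ (proj₂ ly x q e)))

  NonLeaf : Fin n → Set
  NonLeaf v = ¬ (∃[ x ] Leaf v x)

  nonLeaf? : ∀ v → Dec (NonLeaf v)
  nonLeaf? v = ¬? (Finₚ.any? (leaf? v))

  Linear : Fin n → Fin n → Fin n → Set
  Linear x y z = E x y z × (NonLeaf x × NonLeaf y × NonLeaf z) ×
    (∀ w → E x y w → w ≡ z) × (∀ w → E y z w → w ≡ x) × (∀ w → E x z w → w ≡ y)

  linear? : ∀ x y z → Dec (Linear x y z)
  linear? x y z = E? x y z ×-dec (nonLeaf? x ×-dec nonLeaf? y ×-dec nonLeaf? z) ×-dec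
    (Finₚ.all? λ w → E? x y w →-dec (w ≟ z)) ×-dec
    (Finₚ.all? λ w → E? y z w →-dec (w ≟ x)) ×-dec
    (Finₚ.all? λ w → E? x z w →-dec (w ≟ y))

  private
    other-page : ∀ x y z → (∃[ w ] (E x y w × w ≢ z)) ⊎ (∀ w → E x y w → w ≡ z)
    other-page x y z with Finₚ.any? (λ w → E? x y w ×-dec ¬? (w ≟ z))
    ... | yes found = inj₁ found
    ... | no none   = inj₂ only
      where
      only : ∀ w → E x y w → w ≡ z
      only w e with w ≟ z
      ... | yes w≡z = w≡z
      ... | no w≢z  = ⊥-elim (none (w , e , w≢z))

    nonLeaf : ∀ {x y z} → E x y z → (∀ w → E x y w → w ≡ z) → (∀ w → E x z w → w ≡ y) → NonLeaf x
    nonLeaf {x} {y} {z} exyz only-z only-y (t , leaf) = <⇒≱ (leaf-big leaf)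
      ([ (λ { refl → codeg≤length (z ∷ []) λ w e → here (only-z w e) })
       , (λ { refl → codeg≤length (y ∷ []) λ w e → here (only-y w e) }) ]′ (proj₂ leaf y z exyz))

  data Shape (x y z : Fin n) : Set where
    star₁  : Leaf y x → Leaf z x → Shape x y z
    star₂  : Leaf x y → Leaf z y → Shape x y z
    star₃  : Leaf x z → Leaf y z → Shape x y z
    linear : Linear x y z → Shape x y z

  -- A pair that lies in a second edge gives a star by `star-of-pair`. If there is none, the
  -- codegrees inside the edge are 1. The centre of a leaf lies in all its edges, so `leaf-big`
  -- shows that no vertex of this edge is a leaf.
  shape : ∀ {x y z} → E x y z → Shape x y z
  shape {x} {y} {z} exyz with other-page x y z
  ... | inj₁ (w , e , w≢z) =
    [ (λ (ly , lz) → star₁ ly lz) , (λ (lx , lz) → star₂ lx lz) ]′ (star-of-pair exyz e w≢z)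
  ... | inj₂ only-z with other-page y z x
  ... | inj₁ (w , e , w≢x) =
    [ (λ (lz , lx) → star₂ lx lz) , (λ (ly , lx) → star₃ lx ly) ]′ (star-of-pair (rotate exyz) e w≢x)
  ... | inj₂ only-x with other-page x z y
  ... | inj₁ (w , e , w≢y) =
    [ (λ (lz , ly) → star₁ ly lz) , (λ (lx , ly) → star₃ lx ly) ]′ (star-of-pair (flip₂₃ exyz) e w≢y)
  ... | inj₂ only-y = linear (exyz
    , ( nonLeaf exyz only-z only-y
      , nonLeaf (rotate exyz) only-x (λ w e → only-z w (flip₁₂ e))
      , nonLeaf (rotate′ exyz) (λ w e → only-y w (flip₁₂ e)) (λ w e → only-x w (flip₁₂ e)) )
    , only-z , only-x , only-y)

  leafOf : Fin n → Fin n → ℤ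
  leafOf v x = 𝟙 (leaf? v x)

  unattached : Fin n → ℤ
  unattached v = 𝟙 (nonLeaf? v)

  partition : ∀ v → sum (leafOf v) + unattached v ≡ 1ℤ
  partition v with Finₚ.any? (leaf? v)
  ... | yes (x , l) = trans (+-identityʳ (sum (leafOf v)))
    (trans (∑-cong λ y → 𝟙-⇔ (leaf? v y) (x ≟ y) (leaf-unique l) (λ { refl → l })) (∑-𝟙 x))
  ... | no none = cong (_+ 1ℤ) (∑-zero λ x → 𝟙-no (leaf? v x) λ l → none (x , l))

  linear₁ : Fin n → Fin n → Fin n → ℤ
  linear₁ x y z = 𝟙 (linear? x y z)

  star : Fin n → Fin n → Fin n → ℤ
  star x y z = leafOf y x * leafOf z x

  star-nonneg : ∀ x y z → 0ℤ ≤ star x y z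
  star-nonneg x y z = 0≤𝟙 (leaf? y x) ⊗ 0≤𝟙 (leaf? z x)

  edge≤ : ∀ x y z → edge x y z ≤ star x y z + star y x z + star z x y + linear₁ x y z
  edge≤ x y z = 𝟙≤ (E? x y z) (((s₁ ⊕ s₂) ⊕ s₃) ⊕ l) λ e → bound (shape e)
    where
    s₁ : 0ℤ ≤ star x y z
    s₁ = star-nonneg x y z
    s₂ : 0ℤ ≤ star y x z
    s₂ = star-nonneg y x z
    s₃ : 0ℤ ≤ star z x y
    s₃ = star-nonneg z x y
    l : 0ℤ ≤ linear₁ x y z
    l = 0≤𝟙 (linear? x y z)
    is-1 : ∀ {v w x} → Leaf v x → Leaf w x → leafOf v x * leafOf w x ≡ 1ℤ
    is-1 {v} {w} {x} lv lw = cong₂ _*_ (𝟙-yes (leaf? v x) lv) (𝟙-yes (leaf? w x) lw)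
    c₁ : ∀ a b c d → a + b + c + d ≡ a + (b + (c + d))
    c₁ = solve-∀
    c₂ : ∀ a b c d → a + b + c + d ≡ b + (a + (c + d))
    c₂ = solve-∀
    c₃ : ∀ a b c d → a + b + c + d ≡ c + (a + (b + d))
    c₃ = solve-∀
    c₄ : ∀ a b c d → a + b + c + d ≡ d + (a + (b + c))
    c₄ = solve-∀
    bound : Shape x y z → 1ℤ ≤ star x y z + star y x z + star z x y + linear₁ x y z
    bound (star₁ ly lz) = ≤-trans (≤-reflexive (sym (is-1 ly lz))) (≤-by _ (s₂ ⊕ s₃ ⊕ l) (c₁ (star x y z) (star y x z) (star z x y) (linear₁ x y z)))
    bound (star₂ lx lz) = ≤-trans (≤-reflexive (sym (is-1 lx lz))) (≤-by _ (s₁ ⊕ s₃ ⊕ l) (c₂ (star x y z) (star y x z) (star z x y) (linear₁ x y z)))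
    bound (star₃ lx ly) = ≤-trans (≤-reflexive (sym (is-1 lx ly))) (≤-by _ (s₁ ⊕ s₂ ⊕ l) (c₃ (star x y z) (star y x z) (star z x y) (linear₁ x y z)))
    bound (linear lin)  = ≤-trans (≤-reflexive (sym (𝟙-yes (linear? x y z) lin))) (≤-by _ (s₁ ⊕ s₂ ⊕ s₃) (c₄ (star x y z) (star y x z) (star z x y) (linear₁ x y z)))

  private
    -- A pair has at most one completion to a linear edge, and none unless both vertices are leaves
    -- of no star.
    ∑-linear≤ : ∀ {p} {P : Fin n → Set p} (P? : ∀ i → Dec (P i)) u v →
                (∀ i → P i → NonLeaf u × NonLeaf v) → (∀ i j → P i → P j → j ≡ i) →
                sum (λ i → 𝟙 (P? i)) ≤ unattached u * unattached v
    ∑-linear≤ P? u v nl unique with Finₚ.any? P?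
    ... | yes (i , p) = ≤-trans (count≤length P? (i ∷ []) λ j q → here (unique i j p q))
      (≤-reflexive (sym (cong₂ _*_ (𝟙-yes (nonLeaf? u) (proj₁ (nl i p))) (𝟙-yes (nonLeaf? v) (proj₂ (nl i p))))))
    ... | no none = ≤-trans (≤-reflexive (∑-zero λ i → 𝟙-no (P? i) λ p → none (i , p)))
      (0≤𝟙 (nonLeaf? u) ⊗ 0≤𝟙 (nonLeaf? v))

  ∑-linear₃ : ∀ x y → sum (λ z → linear₁ x y z) ≤ unattached x * unattached y
  ∑-linear₃ x y = ∑-linear≤ (λ z → linear? x y z) x y
    (λ _ (_ , (nx , ny , _) , _) → nx , ny) (λ _ w (_ , _ , only , _) (e , _) → only w e)

  ∑-linear₁ : ∀ y z → sum (λ x → linear₁ x y z) ≤ unattached y * unattached z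
  ∑-linear₁ y z = ∑-linear≤ (λ x → linear? x y z) y z
    (λ _ (_ , (_ , ny , nz) , _) → ny , nz) (λ _ w (_ , _ , _ , only , _) (e , _) → only w (rotate e))

  ∑-linear₂ : ∀ x z → sum (λ y → linear₁ x y z) ≤ unattached x * unattached z
  ∑-linear₂ x z = ∑-linear≤ (λ y → linear? x y z) x z
    (λ _ (_ , (nx , _ , nz) , _) → nx , nz) (λ _ w (_ , _ , _ , _ , only) (e , _) → only w (flip₂₃ e))

-- Removing vertices of small degree

total : Hypergraph n → ℤ
total H = ∑³ (Hypergraph.edge H)

module Deletion {n} (H : Hypergraph n) (v : Fin n) where

  open Hypergraph H

  delete : Hypergraph n
  delete = record
    { E        = λ x y z → E x y z × (v ≢ x × v ≢ y × v ≢ z)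
    ; E?       = λ x y z → E? x y z ×-dec (¬? (v ≟ x) ×-dec ¬? (v ≟ y) ×-dec ¬? (v ≟ z))
    ; flip₁₂   = λ (e , vx , vy , vz) → flip₁₂ e , vy , vx , vz
    ; flip₂₃   = λ (e , vx , vy , vz) → flip₂₃ e , vx , vz , vy
    ; distinct = λ (e , _) → distinct e
    }

  open Hypergraph delete using () renaming (edge to edge′; deg to deg′; E? to E′?)

  edge-delete : ∀ x y z → edge x y z ≤
    edge′ x y z + (𝟙 (v ≟ x) * edge v y z + (𝟙 (v ≟ y) * edge v x z + 𝟙 (v ≟ z) * edge v x y))
  edge-delete x y z = 𝟙≤ (E? x y z) (p₀ ⊕ p₁ ⊕ p₂ ⊕ p₃) bound
    where
    p₀ : 0ℤ ≤ edge′ x y z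
    p₀ = 0≤𝟙 (E′? x y z)
    p₁ : 0ℤ ≤ 𝟙 (v ≟ x) * edge v y z
    p₁ = 0≤𝟙 (v ≟ x) ⊗ 0≤𝟙 (E? v y z)
    p₂ : 0ℤ ≤ 𝟙 (v ≟ y) * edge v x z
    p₂ = 0≤𝟙 (v ≟ y) ⊗ 0≤𝟙 (E? v x z)
    p₃ : 0ℤ ≤ 𝟙 (v ≟ z) * edge v x y
    p₃ = 0≤𝟙 (v ≟ z) ⊗ 0≤𝟙 (E? v x y)
    r₁ : ∀ a b c d → a + (b + (c + d)) ≡ b + (a + (c + d))
    r₁ = solve-∀
    r₂ : ∀ a b c d → a + (b + (c + d)) ≡ c + (a + (b + d))
    r₂ = solve-∀
    r₃ : ∀ a b c d → a + (b + (c + d)) ≡ d + (a + (b + c))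
    r₃ = solve-∀
    picked : ∀ {p r s} → v ≡ p → E v r s → 𝟙 (v ≟ p) * edge v r s ≡ 1ℤ
    picked {p} {r} {s} v≡p e = cong₂ _*_ (𝟙-yes (v ≟ p) v≡p) (𝟙-yes (E? v r s) e)
    bound : E x y z → 1ℤ ≤
      edge′ x y z + (𝟙 (v ≟ x) * edge v y z + (𝟙 (v ≟ y) * edge v x z + 𝟙 (v ≟ z) * edge v x y))
    bound e = cases (v ≟ x) (v ≟ y) (v ≟ z)
      where
      cases : Dec (v ≡ x) → Dec (v ≡ y) → Dec (v ≡ z) → _
      cases (yes vx) _ _ = ≤-trans
        (≤-reflexive (sym (picked vx (subst (λ t → E t y z) (sym vx) e))))
        (≤-by _ (p₀ ⊕ p₂ ⊕ p₃) (r₁ (edge′ x y z) (𝟙 (v ≟ x) * edge v y z) (𝟙 (v ≟ y) * edge v x z) (𝟙 (v ≟ z) * edge v x y)))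
      cases (no _) (yes vy) _ = ≤-trans
        (≤-reflexive (sym (picked vy (subst (λ t → E t x z) (sym vy) (flip₁₂ e)))))
        (≤-by _ (p₀ ⊕ p₁ ⊕ p₃) (r₂ (edge′ x y z) (𝟙 (v ≟ x) * edge v y z) (𝟙 (v ≟ y) * edge v x z) (𝟙 (v ≟ z) * edge v x y)))
      cases (no _) (no _) (yes vz) = ≤-trans
        (≤-reflexive (sym (picked vz (subst (λ t → E t x y) (sym vz) (rotate′ e)))))
        (≤-by _ (p₀ ⊕ p₁ ⊕ p₂) (r₃ (edge′ x y z) (𝟙 (v ≟ x) * edge v y z) (𝟙 (v ≟ y) * edge v x z) (𝟙 (v ≟ z) * edge v x y)))
      cases (no vx) (no vy) (no vz) = ≤-trans
        (≤-reflexive (sym (𝟙-yes (E′? x y z) (e , vx , vy , vz))))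
        (≤-by _ (p₁ ⊕ p₂ ⊕ p₃) refl)

  -- The vertex `v` can take each of three positions in an ordered triple, and `deg v` counts the
  -- ordered pairs for the other two.
  total-delete : total H ≤ total delete + + 3 * deg v
  total-delete = ≤-trans (∑³-mono edge-delete) (≤-reflexive (begin
    ∑³ (λ x y z → edge′ x y z + (A x y z + (B x y z + C x y z)))
      ≡⟨ ∑³-+ edge′ (λ x y z → A x y z + (B x y z + C x y z)) ⟩
    total delete + ∑³ (λ x y z → A x y z + (B x y z + C x y z))
      ≡⟨ cong (λ t → total delete + t) (trans (∑³-+ A (λ x y z → B x y z + C x y z)) (cong (λ t → ∑³ A + t) (∑³-+ B C))) ⟩
    total delete + (∑³ A + (∑³ B + ∑³ C))
      ≡⟨ cong (λ t → total delete + t) (trans (cong₂ _+_ ∑A (cong₂ _+_ ∑B ∑C)) (triple (deg v))) ⟩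
    total delete + + 3 * deg v ∎))
    where
    open ≡-Reasoning
    A B C : Fin n → Fin n → Fin n → ℤ
    A x y z = 𝟙 (v ≟ x) * edge v y z
    B x y z = 𝟙 (v ≟ y) * edge v x z
    C x y z = 𝟙 (v ≟ z) * edge v x y
    triple : ∀ a → a + (a + a) ≡ + 3 * a
    triple = solve-∀
    ∑A : ∑³ A ≡ deg v
    ∑A = trans (∑-cong λ x → trans (∑-cong λ y → ∑-*ˡ (𝟙 (v ≟ x)) (edge v y)) (∑-*ˡ (𝟙 (v ≟ x)) (codeg v)))
               (∑-pick v (λ _ → deg v))
    ∑B : ∑³ B ≡ deg v
    ∑B = ∑-cong λ x → trans (∑-cong λ y → ∑-*ˡ (𝟙 (v ≟ y)) (edge v x)) (∑-pick v (λ _ → codeg v x))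
    ∑C : ∑³ C ≡ deg v
    ∑C = ∑-cong λ x → ∑-cong λ y → ∑-pick v (λ _ → edge v x y)

  deg-delete : ∀ w → deg′ w ≤ deg w
  deg-delete w = ∑-mono λ p → ∑-mono λ q → 𝟙-mono (E′? w p q) (E? w p q) proj₁

  deg-deleted : deg′ v ≡ 0ℤ
  deg-deleted = ∑-zero λ p → ∑-zero λ q → 𝟙-no (E′? v p q) λ (_ , v≢v , _) → v≢v refl

-- Induction on a bound for the number of non-isolated vertices. Deleting a vertex of degree between
-- 1 and 24 loses at most 3 · 24 = 72 ordered triples and isolates it, so the bound drops by one.
-- When no such vertex is left, the hypergraph is rich.
prune : ∀ m (H : Hypergraph n) → sum (λ v → 𝟙 (1ℤ ≤? Hypergraph.deg H v)) ≤ + m →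
  ∃[ H′ ] ((∀ {x y z} → Hypergraph.E H′ x y z → Hypergraph.E H x y z) ×
           Hypergraph.Rich H′ × total H ≤ total H′ + + 72 * + m)
prune m H count with Finₚ.any? (λ v → (1ℤ ≤? Hypergraph.deg H v) ×-dec (Hypergraph.deg H v ≤? + 24))
... | no none = H , (λ e → e) , rich , ≤-by _ (0≤+ {72} ⊗ 0≤+ {m}) refl
  where
  open Hypergraph H
  rich : Rich
  rich {x} {y} {z} e with deg x ≤? + 24
  ... | yes ≤24 = ⊥-elim (none (x , deg≥1 , ≤24))
    where
    deg≥1 : 1ℤ ≤ deg x
    deg≥1 = ≤-trans (≤-reflexive (sym (𝟙-yes (E? x y z) e)))
      (≤-trans (term≤∑ (λ q → 0≤𝟙 (E? x y q)) z)
               (term≤∑ (λ p → ∑-nonneg λ q → 0≤𝟙 (E? x p q)) y))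
  ... | no ¬≤24 = i<j⇒suc[i]≤j (≰⇒> ¬≤24)
prune {n} m H count | yes (v , deg≥1 , ≤24) = step m count
  where
  open Hypergraph H
  open Deletion H v
  fewer : sum (λ w → 𝟙 (1ℤ ≤? Hypergraph.deg delete w)) + 1ℤ ≤ sum (λ w → 𝟙 (1ℤ ≤? deg w))
  fewer = ≤-trans (≤-reflexive (trans (cong (λ t → sum (λ w → 𝟙 (1ℤ ≤? Hypergraph.deg delete w)) + t) (sym (∑-𝟙 v)))
                                 (sym (∑-+ (λ w → 𝟙 (1ℤ ≤? Hypergraph.deg delete w)) (λ w → 𝟙 (v ≟ w))))))
                  (∑-mono termwise)
    where
    termwise : ∀ w → 𝟙 (1ℤ ≤? Hypergraph.deg delete w) + 𝟙 (v ≟ w) ≤ 𝟙 (1ℤ ≤? deg w)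
    termwise w = by-cases (v ≟ w)
      where
      by-cases : (d : Dec (v ≡ w)) → 𝟙 (1ℤ ≤? Hypergraph.deg delete w) + 𝟙 d ≤ 𝟙 (1ℤ ≤? deg w)
      by-cases (no _) = ≤-trans (≤-reflexive (+-identityʳ (𝟙 (1ℤ ≤? Hypergraph.deg delete w))))
        (𝟙-mono (1ℤ ≤? Hypergraph.deg delete w) (1ℤ ≤? deg w) (λ le → ≤-trans le (deg-delete w)))
      by-cases (yes refl) = ≤-reflexive (trans
        (cong (_+ 1ℤ) (𝟙-no (1ℤ ≤? Hypergraph.deg delete v) λ le → <⇒≱ (+<+ (ℕ.s≤s ℕ.z≤n)) (≤-trans le (≤-reflexive deg-deleted))))
        (sym (𝟙-yes (1ℤ ≤? deg v) deg≥1)))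

  step : ∀ m → sum (λ w → 𝟙 (1ℤ ≤? deg w)) ≤ + m →
    ∃[ H′ ] ((∀ {x y z} → Hypergraph.E H′ x y z → E x y z) × Hypergraph.Rich H′ × total H ≤ total H′ + + 72 * + m)
  step zero    le = ⊥-elim (<⇒≱ (+<+ (ℕ.s≤s ℕ.z≤n))
    (≤-trans (≤-trans (≤-by _ (∑-nonneg λ w → 0≤𝟙 (1ℤ ≤? Hypergraph.deg delete w))
                         (+-comm (sum (λ w → 𝟙 (1ℤ ≤? Hypergraph.deg delete w))) 1ℤ)) fewer) le))
  step (suc m) le with prune m delete (pred-≤ (≤-trans fewer le))
    where
    pred-≤ : ∀ {a} → a + 1ℤ ≤ + suc m → a ≤ + m
    pred-≤ {a} h = ≤-by _ (diff h) (eq a (+ m))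
      where
      eq : ∀ a m → m ≡ a + ((1ℤ + m) - (a + 1ℤ))
      eq = solve-∀
  ... | H′ , sub , rich , bound = H′ , (λ e → proj₁ (sub e)) , rich , ≤-trans total-delete
    (≤-by _ (diff bound ⊕ diff (*-monoˡ (+ 3) 0≤+ ≤24)) (eq (total delete) (total H′) (+ m) (deg v)))
    where
    eq : ∀ t t′ m d → t′ + + 72 * (1ℤ + m) ≡ t + + 3 * d + ((t′ + + 72 * m - t) + (+ 72 - + 3 * d))
    eq = solve-∀

-- Weighted counts of the edges of a colour class

weight : ℤ → ℤ → (Fin n → ℤ) → Fin n → Fin n → Fin n → ℤ
weight M τ s x y z = M * (s x * s y + s y * s z + s x * s z) - τ * (s x * s y * s z)

-- leafOf v x = 1 if v is a leaf of the star with centre x, unattached v = 1 if v is a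
-- leaf of no star, and both are 0 otherwise.
record Profile (n : ℕ) : Set where
  field
    leafOf          : Fin n → Fin n → ℤ
    unattached      : Fin n → ℤ
    leafOf≥0        : ∀ v x → 0ℤ ≤ leafOf v x
    unattached≥0    : ∀ v → 0ℤ ≤ unattached v
    partition       : ∀ v → sum (leafOf v) + unattached v ≡ 1ℤ

  size : Fin n → ℤ
  size x = sum λ v → leafOf v x

  inside : (Fin n → ℤ) → Fin n → ℤ
  inside s x = sum λ v → leafOf v x * s v

  rest : (Fin n → ℤ) → ℤ
  rest s = sum λ v → unattached v * s v

  starTerm : ℤ → ℤ → (Fin n → ℤ) → Fin n → ℤ
  starTerm M τ s x = + 2 * M * s x * inside s x * size x + (M - τ * s x) * (inside s x * inside s x)

  value : ℤ → ℤ → (Fin n → ℤ) → ℤ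
  value M τ s = sum (starTerm M τ s) + M * (rest s * rest s)

record Weights (M τ : ℤ) (s : Fin n → ℤ) : Set where
  field
    s≥0 : ∀ v → 0ℤ ≤ s v
    s≤M : ∀ v → s v ≤ M
    M≥0 : 0ℤ ≤ M
    τ≥0 : 0ℤ ≤ τ
    τ≤2 : τ ≤ + 2

  -- Each of the three products with the factor `M` dominates the product of the three weights,
  -- which leaves 3 - τ copies of the latter.
  weight≥0 : ∀ x y z → 0ℤ ≤ weight M τ s x y z
  weight≥0 x y z = ≤-trans
    (diff (s≤M z) ⊗ s≥0 x ⊗ s≥0 y ⊕ diff (s≤M x) ⊗ s≥0 y ⊗ s≥0 z ⊕ diff (s≤M y) ⊗ s≥0 x ⊗ s≥0 z
      ⊕ (diff τ≤2 ⊕ 0≤+ {1}) ⊗ s≥0 x ⊗ s≥0 y ⊗ s≥0 z)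
    (≤-reflexive (eq M τ (s x) (s y) (s z)))
    where
    eq : ∀ M τ x y z → (M - z) * (x * y) + ((M - x) * (y * z) + ((M - y) * (x * z) +
           (+ 2 - τ + + 1) * (x * (y * z)))) ≡ M * (x * y + y * z + x * z) - τ * (x * y * z)
    eq = solve-∀

  weight≤ : ∀ x y z → weight M τ s x y z ≤ + 3 * (M * M * M)
  weight≤ x y z = ≤-by _
    (M≥0 ⊗ (diff (*-mono-nonneg (s≥0 x) (s≤M x) (s≥0 y) (s≤M y)) ⊕ diff (*-mono-nonneg (s≥0 y) (s≤M y) (s≥0 z) (s≤M z))
      ⊕ diff (*-mono-nonneg (s≥0 x) (s≤M x) (s≥0 z) (s≤M z))) ⊕ τ≥0 ⊗ s≥0 x ⊗ s≥0 y ⊗ s≥0 z)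
    (eq M τ (s x) (s y) (s z))
    where
    eq : ∀ M τ x y z → + 3 * (M * M * M) ≡ (M * (x * y + y * z + x * z) - τ * (x * y * z)) +
      (M * (M * M - x * y + (M * M - y * z + (M * M - x * z))) + τ * (x * (y * z)))
    eq = solve-∀

module RichProfile (H : Hypergraph n) (free : Hypergraph.MessyFree H) (rich : Hypergraph.Rich H) where

  private
    module S = Structure H free rich

  open Hypergraph H
  open S using (nonLeaf?; linear?; linear₁; star; edge≤; ∑-linear₁; ∑-linear₂; ∑-linear₃)

  richProfile : Profile n
  richProfile = record
    { leafOf       = S.leafOf
    ; unattached   = S.unattached
    ; leafOf≥0     = λ v x → 0≤𝟙 (leaf? v x)
    ; unattached≥0 = λ v → 0≤𝟙 (nonLeaf? v)
    ; partition    = S.partition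
    }

  open Profile richProfile using (size; inside; rest; starTerm; value)

  -- The centre of a star edge can stand in three positions, which contribute equally because
  -- `weight` is symmetric. For linear edges the τ-term is dropped; each remaining product of two
  -- weights is summed over pairs with at most one completion, which gives at most the square of
  -- `rest s`.
  rich-bound : ∀ {M τ s} → Weights M τ s →
    ∑³ (λ x y z → weight M τ s x y z * edge x y z) ≤ + 3 * value M τ s
  rich-bound {M} {τ} {s} W = begin
    ∑³ (λ x y z → w x y z * edge x y z)
      ≤⟨ ∑³-mono (λ x y z → pointwise x y z) ⟩
    ∑³ (λ x y z → (w x y z * star x y z + w x y z * star y x z) + (w x y z * star z x y + M * L x y z))
      ≡⟨ trans (∑³-+ (λ x y z → W₁ x y z + W₂ x y z) (λ x y z → W₃ x y z + M * L x y z))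
               (cong₂ _+_ (∑³-+ W₁ W₂) (∑³-+ W₃ (λ x y z → M * L x y z))) ⟩
    (T + ∑³ (λ x y z → w x y z * star y x z)) + (∑³ (λ x y z → w x y z * star z x y) + ∑³ (λ x y z → M * L x y z))
      ≡⟨ cong₂ (λ a b → (T + a) + (b + ∑³ (λ x y z → M * L x y z))) second third ⟩
    (T + T) + (T + ∑³ (λ x y z → M * L x y z))
      ≡⟨ cong₂ (λ a b → (a + a) + (a + b)) T≡ (∑³-*ˡ M L) ⟩
    (sum (starTerm M τ s) + sum (starTerm M τ s)) + (sum (starTerm M τ s) + M * ∑³ L)
      ≤⟨ +-monoʳ-≤ (sum (starTerm M τ s) + sum (starTerm M τ s)) (+-monoʳ-≤ (sum (starTerm M τ s)) (*-monoˡ M M≥0 L≤)) ⟩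
    (sum (starTerm M τ s) + sum (starTerm M τ s)) + (sum (starTerm M τ s) + M * (+ 3 * (rest s * rest s)))
      ≡⟨ collect (sum (starTerm M τ s)) M (rest s) ⟩
    + 3 * value M τ s ∎
    where
    open ≤-Reasoning
    open Weights W
    w L W₁ W₂ W₃ : Fin n → Fin n → Fin n → ℤ
    w = weight M τ s
    W₁ x y z = w x y z * star x y z
    W₂ x y z = w x y z * star y x z
    W₃ x y z = w x y z * star z x y
    L x y z = (s x * s y + s y * s z + s x * s z) * linear₁ x y z

    T : ℤ
    T = ∑³ λ x y z → w x y z * star x y z

    collect : ∀ t M r → (t + t) + (t + M * (+ 3 * (r * r))) ≡ + 3 * (t + M * (r * r))
    collect = solve-∀

    pointwise : ∀ x y z → w x y z * edge x y z ≤
      (w x y z * star x y z + w x y z * star y x z) + (w x y z * star z x y + M * L x y z)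
    pointwise x y z = ≤-trans (*-monoˡ (w x y z) (weight≥0 x y z) (edge≤ x y z))
      (≤-by _ (τ≥0 ⊗ s≥0 x ⊗ s≥0 y ⊗ s≥0 z ⊗ 0≤𝟙 (linear? x y z))
        (eq M τ (s x) (s y) (s z) (star x y z) (star y x z) (star z x y) (linear₁ x y z)))
      where
      eq : ∀ M τ x y z a b c l →
        ((M * (x * y + y * z + x * z) - τ * (x * y * z)) * a + (M * (x * y + y * z + x * z) - τ * (x * y * z)) * b) +
        ((M * (x * y + y * z + x * z) - τ * (x * y * z)) * c + M * ((x * y + y * z + x * z) * l)) ≡
        (M * (x * y + y * z + x * z) - τ * (x * y * z)) * (a + b + c + l) + τ * (x * (y * (z * l)))
      eq = solve-∀

    second : ∑³ (λ x y z → w x y z * star y x z) ≡ T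
    second = trans (∑³-swap W₂) (∑³-cong λ x y z → cong (_* star x y z) (eq M τ (s x) (s y) (s z)))
      where
      eq : ∀ M τ x y z → M * (y * x + x * z + y * z) - τ * (y * x * z) ≡ M * (x * y + y * z + x * z) - τ * (x * y * z)
      eq = solve-∀

    third : ∑³ (λ x y z → w x y z * star z x y) ≡ T
    third = trans (∑³-rotate W₃) (∑³-cong λ x y z → cong (_* star x y z) (eq M τ (s x) (s y) (s z)))
      where
      eq : ∀ M τ x y z → M * (y * z + z * x + y * x) - τ * (y * z * x) ≡ M * (x * y + y * z + x * z) - τ * (x * y * z)
      eq = solve-∀

    T≡ : T ≡ sum (starTerm M τ s)
    T≡ = ∑-cong λ x → trans
      (∑-cong λ y → ∑-cong λ z → expand M τ (s x) (s y) (s z) (S.leafOf y x) (S.leafOf z x))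
      (trans (∑∑-+ (λ y z → (M * s x * (S.leafOf y x * s y)) * S.leafOf z x)
                     (λ y z → (M * s x * S.leafOf y x) * (S.leafOf z x * s z) + ((M - τ * s x) * (S.leafOf y x * s y)) * (S.leafOf z x * s z)))
        (trans (cong₂ _+_ (trans (∑∑-* (λ y → M * s x * (S.leafOf y x * s y)) (λ z → S.leafOf z x))
                             (cong (_* size x) (∑-*ˡ (M * s x) (λ y → S.leafOf y x * s y))))
                 (trans (∑∑-+ (λ y z → (M * s x * S.leafOf y x) * (S.leafOf z x * s z))
                              (λ y z → ((M - τ * s x) * (S.leafOf y x * s y)) * (S.leafOf z x * s z)))
                   (cong₂ _+_ (trans (∑∑-* (λ y → M * s x * S.leafOf y x) (λ z → S.leafOf z x * s z))
                                (cong (_* inside s x) (∑-*ˡ (M * s x) (λ y → S.leafOf y x))))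
                              (trans (∑∑-* (λ y → (M - τ * s x) * (S.leafOf y x * s y)) (λ z → S.leafOf z x * s z))
                                (cong (_* inside s x) (∑-*ˡ (M - τ * s x) (λ y → S.leafOf y x * s y)))))))
          (gather M τ (s x) (inside s x) (size x))))
      where
      ∑∑-+ : (f g : Fin n → Fin n → ℤ) → (sum λ y → sum λ z → f y z + g y z) ≡
             (sum λ y → sum λ z → f y z) + (sum λ y → sum λ z → g y z)
      ∑∑-+ f g = trans (∑-cong λ y → ∑-+ (f y) (g y)) (∑-+ (λ y → sum (f y)) (λ y → sum (g y)))
      expand : ∀ M τ x y z l m → (M * (x * y + y * z + x * z) - τ * (x * y * z)) * (l * m) ≡
        (M * x * (l * y)) * m + ((M * x * l) * (m * z) + ((M - τ * x) * (l * y)) * (m * z))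
      expand = solve-∀
      gather : ∀ M τ x a α → M * x * a * α + (M * x * α * a + (M - τ * x) * a * a) ≡
        + 2 * M * x * a * α + (M - τ * x) * (a * a)
      gather = solve-∀

    u : Fin n → ℤ
    u v = S.unattached v

    pairs : (sum λ x → sum λ y → s x * s y * (u x * u y)) ≡ rest s * rest s
    pairs = trans (∑-cong λ x → ∑-cong λ y → eq (s x) (s y) (u x) (u y)) (∑∑-* (λ x → u x * s x) (λ y → u y * s y))
      where
      eq : ∀ x y u v → x * y * (u * v) ≡ (u * x) * (v * y)
      eq = solve-∀

    pair-bound : (l : Fin n → Fin n → Fin n → ℤ) → (∀ x y → sum (l x y) ≤ u x * u y) →
      ∑³ (λ x y z → s x * s y * l x y z) ≤ rest s * rest s
    pair-bound l h = ≤-trans (∑-mono λ x → ∑-mono λ y → ≤-trans (≤-reflexive (∑-*ˡ (s x * s y) (l x y)))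
      (*-monoˡ (s x * s y) (s≥0 x ⊗ s≥0 y) (h x y))) (≤-reflexive pairs)

    L≤ : ∑³ L ≤ + 3 * (rest s * rest s)
    L≤ = begin
      ∑³ L
        ≡⟨ ∑³-cong (λ x y z → eq (s x) (s y) (s z) (linear₁ x y z)) ⟩
      ∑³ (λ x y z → s x * s y * linear₁ x y z + (s y * s z * linear₁ x y z + s x * s z * linear₁ x y z))
        ≡⟨ trans (∑³-+ L₃ (λ x y z → L₁ x y z + L₂ x y z)) (cong (λ t → ∑³ L₃ + t) (∑³-+ L₁ L₂)) ⟩
      ∑³ (λ x y z → s x * s y * linear₁ x y z) +
        (∑³ (λ x y z → s y * s z * linear₁ x y z) + ∑³ (λ x y z → s x * s z * linear₁ x y z))
        ≤⟨ +-mono-≤ (pair-bound linear₁ ∑-linear₃) (+-mono-≤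
             (≤-trans (≤-reflexive (trans (sym (∑³-rotate (λ y z x → s y * s z * linear₁ x y z))) refl))
               (pair-bound (λ y z x → linear₁ x y z) ∑-linear₁))
             (≤-trans (≤-reflexive (∑-cong λ x → ∑-comm (λ y z → s x * s z * linear₁ x y z)))
               (pair-bound (λ x z y → linear₁ x y z) ∑-linear₂))) ⟩
      rest s * rest s + (rest s * rest s + rest s * rest s)
        ≡⟨ triple (rest s * rest s) ⟩
      + 3 * (rest s * rest s) ∎
      where
      L₁ L₂ L₃ : Fin n → Fin n → Fin n → ℤ
      L₁ x y z = s y * s z * linear₁ x y z
      L₂ x y z = s x * s z * linear₁ x y z
      L₃ x y z = s x * s y * linear₁ x y z
      eq : ∀ x y z l → (x * y + y * z + x * z) * l ≡ x * y * l + (y * z * l + x * z * l)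
      eq = solve-∀
      triple : ∀ a → a + (a + a) ≡ + 3 * a
      triple = solve-∀

-- Pruning loses at most 72n ordered triples, each of weight at most 3M³; this is the error 216nM³.
messyFree-bound : (H : Hypergraph n) → Hypergraph.MessyFree H →
  ∃[ P ] (∀ {M τ s} → Weights M τ s →
    ∑³ (λ x y z → weight M τ s x y z * Hypergraph.edge H x y z) ≤
    + 3 * Profile.value P M τ s + + 216 * + n * (M * M * M))
messyFree-bound {n} H free = P , bound
  where
  pruned = prune n H (≤-trans (∑-const≤ 1ℤ λ v → 𝟙≤1 (1ℤ ≤? Hypergraph.deg H v)) (≤-reflexive (*-identityʳ (+ n))))
  H′ = proj₁ pruned
  sub = proj₁ (proj₂ pruned)
  open Hypergraph H using (edge; E?)
  open Hypergraph H′ using () renaming (edge to edge′; E? to E′?)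

  free′ : Hypergraph.MessyFree H′
  free′ e₁ e₂ e₃ = free (sub e₁) (sub e₂) (sub e₃)

  P : Profile n
  P = RichProfile.richProfile H′ free′ (proj₁ (proj₂ (proj₂ pruned)))

  bound : ∀ {M τ s} → Weights M τ s → ∑³ (λ x y z → weight M τ s x y z * edge x y z) ≤
    + 3 * Profile.value P M τ s + + 216 * + n * (M * M * M)
  bound {M} {τ} {s} W = begin
    ∑³ (λ x y z → w x y z * edge x y z)
      ≤⟨ ∑³-mono pointwise ⟩
    ∑³ (λ x y z → w x y z * edge′ x y z + K * (edge x y z - edge′ x y z))
      ≡⟨ trans (∑³-+ (λ x y z → w x y z * edge′ x y z) (λ x y z → K * (edge x y z - edge′ x y z)))
           (cong (λ t → ∑³ (λ x y z → w x y z * edge′ x y z) + t) (∑³-*ˡ K (λ x y z → edge x y z - edge′ x y z))) ⟩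
    ∑³ (λ x y z → w x y z * edge′ x y z) + K * ∑³ (λ x y z → edge x y z - edge′ x y z)
      ≤⟨ +-mono-≤ (RichProfile.rich-bound H′ free′ (proj₁ (proj₂ (proj₂ pruned))) W) (*-monoˡ K K≥0 lost) ⟩
    + 3 * Profile.value P M τ s + K * (+ 72 * + n)
      ≡⟨ cong (λ t → + 3 * Profile.value P M τ s + t) (eq (M * M * M) (+ n)) ⟩
    + 3 * Profile.value P M τ s + + 216 * + n * (M * M * M) ∎
    where
    open ≤-Reasoning
    open Weights W
    w : Fin n → Fin n → Fin n → ℤ
    w = weight M τ s
    K : ℤ
    K = + 3 * (M * M * M)
    K≥0 : 0ℤ ≤ K
    K≥0 = 0≤+ {3} ⊗ (M≥0 ⊗ M≥0) ⊗ M≥0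
    eq : ∀ m n → + 3 * m * (+ 72 * n) ≡ + 216 * n * m
    eq = solve-∀
    pointwise : ∀ x y z → w x y z * edge x y z ≤ w x y z * edge′ x y z + K * (edge x y z - edge′ x y z)
    pointwise x y z = ≤-by _ (diff (weight≤ x y z) ⊗ diff (𝟙-mono (E′? x y z) (E? x y z) sub))
      (expand (w x y z) K (edge x y z) (edge′ x y z))
      where
      expand : ∀ w K e f → w * f + K * (e - f) ≡ w * e + (K - w) * (e - f)
      expand = solve-∀
    lost : ∑³ (λ x y z → edge x y z - edge′ x y z) ≤ + 72 * + n
    lost = ≤-by _ (diff (proj₂ (proj₂ (proj₂ pruned)))) (trans (expand (total H) (total H′) (+ 72 * + n))
      (cong (_+ ((total H′ + + 72 * + n) - total H)) (sym difference)))
      where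
      expand : ∀ t t′ m → m ≡ (t - t′) + ((t′ + m) - t)
      expand = solve-∀
      negate : ∀ a → - a ≡ -1ℤ * a
      negate = solve-∀
      difference : ∑³ (λ x y z → edge x y z - edge′ x y z) ≡ total H - total H′
      difference = trans (∑³-+ edge (λ x y z → - edge′ x y z)) (cong (λ t → total H + t)
        (trans (∑³-cong λ x y z → negate (edge′ x y z)) (trans (∑³-*ˡ -1ℤ edge′) (sym (negate (total H′))))))

-- Sums with one or two exceptional indices

∑-mono-except₁ : {f g : Fin n → ℤ} (z : Fin n) → (∀ i → z ≢ i → f i ≤ g i) →
                 sum f ≤ sum g + (f z - g z)
∑-mono-except₁ {n} {f} {g} z h = ≤-trans (∑-mono termwise) (≤-reflexive
  (trans (∑-+ g (λ i → 𝟙 (z ≟ i) * (f i - g i))) (cong (λ t → sum g + t) (∑-pick z (λ i → f i - g i)))))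
  where
  termwise : ∀ i → f i ≤ g i + 𝟙 (z ≟ i) * (f i - g i)
  termwise i with z ≟ i
  ... | yes _  = ≤-reflexive (eq (f i) (g i))
    where
    eq : ∀ f g → f ≡ g + 1ℤ * (f - g)
    eq = solve-∀
  ... | no z≢i = ≤-trans (h i z≢i) (≤-reflexive (eq (f i) (g i)))
    where
    eq : ∀ f g → g ≡ g + 0ℤ * (f - g)
    eq = solve-∀

∑-mono-except₂ : {f g : Fin n → ℤ} {y z : Fin n} → y ≢ z → (∀ i → y ≢ i → z ≢ i → f i ≤ g i) →
                 sum f ≤ sum g + (f y - g y) + (f z - g z)
∑-mono-except₂ {n} {f} {g} {y} {z} y≢z h = ≤-trans (∑-mono termwise) (≤-reflexive
  (trans (∑-+ (λ i → g i + 𝟙 (y ≟ i) * (f i - g i)) (λ i → 𝟙 (z ≟ i) * (f i - g i)))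
    (cong₂ _+_ (trans (∑-+ g (λ i → 𝟙 (y ≟ i) * (f i - g i)))
                      (cong (λ t → sum g + t) (∑-pick y (λ i → f i - g i))))
               (∑-pick z (λ i → f i - g i)))))
  where
  termwise : ∀ i → f i ≤ g i + 𝟙 (y ≟ i) * (f i - g i) + 𝟙 (z ≟ i) * (f i - g i)
  termwise i with y ≟ i | z ≟ i
  ... | yes refl | yes refl = ⊥-elim (y≢z refl)
  ... | yes _  | no _  = ≤-reflexive (eq (f i) (g i))
    where
    eq : ∀ f g → f ≡ g + 1ℤ * (f - g) + 0ℤ * (f - g)
    eq = solve-∀
  ... | no _ | yes _  = ≤-reflexive (eq (f i) (g i))
    where
    eq : ∀ f g → f ≡ g + 0ℤ * (f - g) + 1ℤ * (f - g)
    eq = solve-∀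
  ... | no y≢i | no z≢i = ≤-trans (h i y≢i z≢i) (≤-reflexive (eq (f i) (g i)))
    where
    eq : ∀ f g → g ≡ g + 0ℤ * (f - g) + 0ℤ * (f - g)
    eq = solve-∀

off-* : (f g : Fin n → ℤ) (z i : Fin n) → ((λ j → f j * g j) off z) i ≡ (f off z) i * (g off z) i
off-* f g z i with z ≟ i
... | yes _ = eq (f i) (g i)
  where
  eq : ∀ x y → (1ℤ - 1ℤ) * (x * y) ≡ (1ℤ - 1ℤ) * x * ((1ℤ - 1ℤ) * y)
  eq = solve-∀
... | no _ = eq (f i) (g i)
  where
  eq : ∀ x y → (1ℤ - 0ℤ) * (x * y) ≡ (1ℤ - 0ℤ) * x * ((1ℤ - 0ℤ) * y)
  eq = solve-∀

-- A dominant star at `z` is kept apart, and the crude `∑-product` is applied to the other stars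
-- only.
∑-product-off : {f g : Fin n → ℤ} (z : Fin n) → (∀ i → 0ℤ ≤ f i) → (∀ i → 0ℤ ≤ g i) →
                sum (λ i → f i * g i) ≤ f z * g z + (sum f - f z) * (sum g - g z)
∑-product-off {f = f} {g} z hf hg = begin
  sum (λ i → f i * g i)
    ≡⟨ ∑-off (λ i → f i * g i) z ⟩
  f z * g z + sum ((λ i → f i * g i) off z)
    ≡⟨ cong (λ t → f z * g z + t) (∑-cong (off-* f g z)) ⟩
  f z * g z + sum (λ i → (f off z) i * (g off z) i)
    ≤⟨ +-monoʳ-≤ (f z * g z) (∑-product (off-nonneg z hf) (off-nonneg z hg)) ⟩
  f z * g z + sum (f off z) * sum (g off z)
    ≡⟨ cong₂ (λ a b → f z * g z + a * b) (remove f) (remove g) ⟩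
  f z * g z + (sum f - f z) * (sum g - g z) ∎
  where
  open ≤-Reasoning
  remove : ∀ f → sum (f off z) ≡ sum f - f z
  remove f = trans (eq (f z) (sum (f off z))) (cong (_- f z) (sym (∑-off f z)))
    where
    eq : ∀ x y → y ≡ (x + y) - x
    eq = solve-∀

-- Bounds on the contribution of a single colour

module Facts (P : Profile n) {M τ : ℤ} {s : Fin n → ℤ} (W : Weights M τ s) where
  open Profile P
  open Weights W

  a : Fin n → ℤ
  a = inside s

  b β : ℤ
  b = rest s
  β = sum unattached

  size≥0 : ∀ x → 0ℤ ≤ size x
  size≥0 x = ∑-nonneg λ v → leafOf≥0 v x

  a≥0 : ∀ x → 0ℤ ≤ a x
  a≥0 x = ∑-nonneg λ v → leafOf≥0 v x ⊗ s≥0 v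

  a≤size : ∀ x → a x ≤ M * size x
  a≤size x = ≤-trans (∑-mono λ v → *-monoˡ (leafOf v x) (leafOf≥0 v x) (s≤M v))
    (≤-reflexive (trans (∑-*ʳ M (λ v → leafOf v x)) (*-comm (size x) M)))

  b≥0 : 0ℤ ≤ b
  b≥0 = ∑-nonneg λ v → unattached≥0 v ⊗ s≥0 v

  β≥0 : 0ℤ ≤ β
  β≥0 = ∑-nonneg unattached≥0

  b≤β : b ≤ M * β
  b≤β = ≤-trans (∑-mono λ v → *-monoˡ (unattached v) (unattached≥0 v) (s≤M v))
    (≤-reflexive (trans (∑-*ʳ M unattached) (*-comm β M)))

  sizes : sum size + β ≡ + n
  sizes = begin
    sum size + β                               ≡⟨ cong (_+ β) (∑-comm (λ x v → leafOf v x)) ⟩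
    sum (λ v → sum (leafOf v)) + β             ≡⟨ sym (∑-+ (λ v → sum (leafOf v)) unattached) ⟩
    sum (λ v → sum (leafOf v) + unattached v)  ≡⟨ ∑-cong partition ⟩
    sum {n} (λ _ → 1ℤ)                         ≡⟨ trans (∑-const n 1ℤ) (*-identityʳ (+ n)) ⟩
    + n ∎
    where open ≡-Reasoning

  masses : sum a + b ≡ sum s
  masses = begin
    sum a + b
      ≡⟨ cong (_+ b) (∑-comm (λ x v → leafOf v x * s v)) ⟩
    sum (λ v → sum (λ x → leafOf v x * s v)) + b
      ≡⟨ cong (_+ b) (∑-cong λ v → ∑-*ʳ (s v) (leafOf v)) ⟩
    sum (λ v → sum (leafOf v) * s v) + b
      ≡⟨ sym (∑-+ (λ v → sum (leafOf v) * s v) (λ v → unattached v * s v)) ⟩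
    sum (λ v → sum (leafOf v) * s v + unattached v * s v)
      ≡⟨ ∑-cong (λ v → trans (sym (*-distribʳ-+ (s v) (sum (leafOf v)) (unattached v)))
                         (trans (cong (_* s v) (partition v)) (*-identityˡ (s v)))) ⟩
    sum s ∎
    where open ≡-Reasoning

  b≤σ : b ≤ sum s
  b≤σ = ≤-by (sum a) (∑-nonneg a≥0) (trans (sym masses) (+-comm (sum a) b))

  A : ℤ
  A = sum a

  A≥0 : 0ℤ ≤ A
  A≥0 = ∑-nonneg a≥0

  squares : ℤ
  squares = sum λ x → a x * a x

  sum-size≤ : sum size ≤ + n
  sum-size≤ = ≤-by β β≥0 (sym sizes)

-- Here `s` takes only the values 0 and 1, so it is the indicator of a vertex set, and `weight`
-- counts the pairs of a triple inside this set.
module Pairs (P : Profile n) {s : Fin n → ℤ} (W : Weights 1ℤ 0ℤ s) where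
  open Profile P
  open Weights W
  open Facts P W

  private
    h ν : ℤ
    h = sum s
    ν = + n

    a≤ : ∀ x → a x ≤ size x
    a≤ x = ≤-trans (a≤size x) (≤-reflexive (*-identityˡ (size x)))

  module _ (light : ∀ x → + 2 * size x ≤ + n) (h≤ν : sum s ≤ + n) where

    private
      split : value 1ℤ 0ℤ s ≤ ν * A + squares + b * b
      split = begin
        sum (starTerm 1ℤ 0ℤ s) + 1ℤ * (b * b)
          ≤⟨ +-monoˡ-≤ (1ℤ * (b * b)) (∑-mono λ x → ≤-by _
               (a≥0 x ⊗ diff (light x) ⊕ 0≤+ {2} ⊗ a≥0 x ⊗ size≥0 x ⊗ diff (s≤M x))
               (term ν (s x) (a x) (size x))) ⟩
        sum (λ x → ν * a x + a x * a x) + 1ℤ * (b * b)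
          ≡⟨ cong₂ _+_ (trans (∑-+ (λ x → ν * a x) (λ x → a x * a x)) (cong (_+ squares) (∑-*ˡ ν a)))
                       (*-identityˡ (b * b)) ⟩
        ν * A + squares + b * b ∎
        where
        open ≤-Reasoning
        term : ∀ ν s a α → ν * a + a * a ≡
          (+ 2 * 1ℤ * s * a * α + (1ℤ - 0ℤ * s) * (a * a)) + (a * (ν - + 2 * α) + + 2 * (a * (α * (1ℤ - s))))
        term = solve-∀

    -- After `split` it remains to bound νA + ∑a² + b² by h² + ν²/2. If some `a x` is at least h -
    -- ν/2, it lies between h - ν/2 and ν/2, and convexity bounds the squares. If `b` is at least h
    -- - ν/2, then A ≤ ν/2. Otherwise each square is at most h - ν/2 times its base, and h ≤ ν
    -- finishes.
    light-pairs : + 2 * value 1ℤ 0ℤ s ≤ + 2 * (sum s * sum s) + + n * + n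
    light-pairs = ≤-trans (*-monoˡ (+ 2) 0≤+ split) (subst (λ t → + 2 * (ν * A + squares + b * b) ≤ + 2 * (t * t) + ν * ν) masses
      (cases (Finₚ.any? (λ x → (+ 2 * (A + b) - ν) ≤? + 2 * a x)) ((+ 2 * (A + b) - ν) ≤? + 2 * b)))
      where
      ν≥0 : 0ℤ ≤ ν
      ν≥0 = 0≤+

      A+b≤ν : A + b ≤ ν
      A+b≤ν = ≤-trans (≤-reflexive masses) h≤ν

      cases : Dec (∃[ x ] (+ 2 * (A + b) - ν ≤ + 2 * a x)) → Dec (+ 2 * (A + b) - ν ≤ + 2 * b) →
              + 2 * (ν * A + squares + b * b) ≤ + 2 * ((A + b) * (A + b)) + ν * ν
      cases (yes (x , large)) _ = ≤-trans
        (*-monoˡ (+ 2) 0≤+ (+-monoˡ-≤ (b * b) (+-monoʳ-≤ (ν * A) (∑-product-off x a≥0 a≥0))))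
        (≤-by _ (diff (≤-trans (*-monoˡ (+ 2) 0≤+ (a≤ x)) (light x)) ⊗ diff large
                 ⊕ 0≤+ {4} ⊗ diff (term≤∑ a≥0 x) ⊗ b≥0 ⊕ 0≤+ {2} ⊗ ν≥0 ⊗ b≥0)
               (eq ν A b (a x)))
        where
        eq : ∀ ν A b p → + 2 * ((A + b) * (A + b)) + ν * ν ≡ + 2 * (ν * A + (p * p + (A - p) * (A - p)) + b * b) +
          ((ν - + 2 * p) * (+ 2 * p - (+ 2 * (A + b) - ν)) + (+ 4 * ((A - p) * b) + + 2 * (ν * b)))
        eq = solve-∀
      cases (no _) (yes large) = ≤-trans
        (*-monoˡ (+ 2) 0≤+ (+-monoˡ-≤ (b * b) (+-monoʳ-≤ (ν * A) (∑-product a≥0 a≥0))))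
        (≤-by _ (ν≥0 ⊗ diff large ⊕ 0≤+ {4} ⊗ A≥0 ⊗ b≥0) (eq ν A b))
        where
        eq : ∀ ν A b → + 2 * ((A + b) * (A + b)) + ν * ν ≡ + 2 * (ν * A + A * A + b * b) +
          (ν * (+ 2 * b - (+ 2 * (A + b) - ν)) + + 4 * (A * b))
        eq = solve-∀
      cases (no small) (no small-b) = ≤-by _
        (diff small-squares ⊕ b≥0 ⊗ diff (<⇒≤ (≰⇒> small-b)) ⊕ ν≥0 ⊗ diff A+b≤ν ⊕ 0≤+ {2} ⊗ ν≥0 ⊗ b≥0)
        (eq ν A b squares)
        where
        small-squares : + 2 * squares ≤ (+ 2 * (A + b) - ν) * A
        small-squares = ≤-trans (≤-reflexive (sym (∑-*ˡ (+ 2) (λ x → a x * a x)))) (≤-trans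
          (∑-mono λ x → ≤-trans (≤-reflexive (assoc (a x)))
            (*-monoˡ (a x) (a≥0 x) (<⇒≤ (≰⇒> λ large → small (x , large)))))
          (≤-reflexive (trans (∑-*ʳ (+ 2 * (A + b) - ν) a) (*-comm A (+ 2 * (A + b) - ν)))))
          where
          assoc : ∀ a → + 2 * (a * a) ≡ a * (+ 2 * a)
          assoc = solve-∀
        eq : ∀ ν A b Q → + 2 * ((A + b) * (A + b)) + ν * ν ≡ + 2 * (ν * A + Q + b * b) +
          ((+ 2 * (A + b) - ν) * A - + 2 * Q + (b * ((+ 2 * (A + b) - ν) - + 2 * b) + (ν * (ν - (A + b)) + + 2 * (ν * b))))
        eq = solve-∀

  module _ (z : Fin n) where

    private
      α p γ : ℤ
      α = size z
      p = A - a z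
      γ = ν - α

      p≥0 : 0ℤ ≤ p
      p≥0 = diff (term≤∑ a≥0 z)

      p≤ : p ≤ sum size - α
      p≤ = ≤-by _ (diff (∑-mono-except₁ {f = a} {g = size} z (λ i _ → a≤ i))) (eq A (a z) (sum size) α)
        where
        eq : ∀ A a S α → S - α ≡ (A - a) + ((S + (a - α)) - A)
        eq = solve-∀

      others≤γ : sum size - α ≤ γ
      others≤γ = +-monoˡ-≤ (- α) sum-size≤

      p≤γ : p ≤ γ
      p≤γ = ≤-trans p≤ others≤γ

      others≥0 : 0ℤ ≤ sum size - α
      others≥0 = diff (term≤∑ size≥0 z)

      masses′ : h ≡ a z + p + b
      masses′ = trans (sym masses) (cong (_+ b) (eq A (a z)))
        where
        eq : ∀ A a → A ≡ a + (A - a)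
        eq = solve-∀

    -- The bound equals that of `split` when all leaves of `z` have weight 1 and `b` vanishes. The
    -- certificate proves `α` times the inequality, so `α` has to be positive.
    heavy-pairs : 0ℤ < size z → + n ≤ + 2 * size z → sum s ≤ + n → value 1ℤ 0ℤ s ≤
                  sum s * sum s + + 2 * (size z * size z) - + 2 * ((sum s - size z) * (+ 2 * size z - + n))
    heavy-pairs 0<α ν≤2α h≤ν = ≤-trans split (subst
      (λ t → + 2 * (a z * α + p * γ) + (a z * a z + p * p) + b * b ≤ t * t + + 2 * (α * α) - + 2 * ((t - α) * (+ 2 * α - ν)))
      (sym masses′)
      (*-cancelˡ-≤-pos (+ 2 * (a z * α + p * γ) + (a z * a z + p * p) + b * b) _ α {{positive 0<α}}
        (≤-by _ (0≤+ {2} ⊗ (a≥0 z ⊗ γ≥0 ⊗ b≥0 ⊕ diff (a≤ z) ⊗ (diff ν≤2α ⊗ (diff p+b≤ν ⊕ size≥0 z) ⊕ γ≥0 ⊗ diff p≤γ))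
                 ⊕ 0≤+ {2} ⊗ size≥0 z ⊗ p≥0 ⊗ b≥0)
          (eq α (a z) p b ν))))
      where
      γ≥0 : 0ℤ ≤ γ
      γ≥0 = ≤-trans others≥0 others≤γ

      p+b≤ν : p + b ≤ ν
      p+b≤ν = ≤-trans (≤-by _ (a≥0 z) (trans masses′ (comm (a z) p b))) h≤ν
        where
        comm : ∀ a p b → a + p + b ≡ p + b + a
        comm = solve-∀

      eq : ∀ α a p b ν → α * ((a + p + b) * (a + p + b) + + 2 * (α * α) - + 2 * (((a + p + b) - α) * (+ 2 * α - ν))) ≡
        α * (+ 2 * (a * α + p * (ν - α)) + (a * a + p * p) + b * b) +
        (+ 2 * (a * ((ν - α) * b) + (α - a) * ((+ 2 * α - ν) * (ν - (p + b) + α) + (ν - α) * ((ν - α) - p))) +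
         + 2 * (α * (p * b)))
      eq = solve-∀

      split : value 1ℤ 0ℤ s ≤ + 2 * (a z * α + p * γ) + (a z * a z + p * p) + b * b
      split = begin
        sum (starTerm 1ℤ 0ℤ s) + 1ℤ * (b * b)
          ≤⟨ +-monoˡ-≤ (1ℤ * (b * b)) (∑-mono λ x → ≤-by _ (0≤+ {2} ⊗ a≥0 x ⊗ size≥0 x ⊗ diff (s≤M x))
               (term (s x) (a x) (size x))) ⟩
        sum (λ x → + 2 * (a x * size x) + a x * a x) + 1ℤ * (b * b)
          ≡⟨ cong₂ _+_ (trans (∑-+ (λ x → + 2 * (a x * size x)) (λ x → a x * a x))
                         (cong (_+ squares) (∑-*ˡ (+ 2) (λ x → a x * size x)))) (*-identityˡ (b * b)) ⟩
        + 2 * sum (λ x → a x * size x) + squares + b * b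
          ≤⟨ +-monoˡ-≤ (b * b) (+-mono-≤
               (*-monoˡ (+ 2) 0≤+ (≤-trans (∑-product-off z a≥0 size≥0) (+-monoʳ-≤ (a z * α) (*-monoˡ p p≥0 others≤γ))))
               (∑-product-off z a≥0 a≥0)) ⟩
        + 2 * (a z * α + p * γ) + (a z * a z + p * p) + b * b ∎
        where
        open ≤-Reasoning
        term : ∀ s a α → + 2 * (a * α) + a * a ≡
          (+ 2 * 1ℤ * s * a * α + (1ℤ - 0ℤ * s) * (a * a)) + + 2 * (a * (α * (1ℤ - s)))
        term = solve-∀

    -- With weight 0 at the centre, the star at `z` contributes only the square of `a z`. It remains
    -- to bound 2pγ by 2p(a + b) + 2ab + 25N². Since p ≤ γ ≤ 25N and a + b ≥ 99N/2 - p, the worst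
    -- case is p = γ = 25N, where 2pγ exceeds 2p(a + b) by at most 25N².
    removed-pairs : ∀ {N} → 0ℤ ≤ N → s z ≡ 0ℤ → + n - size z ≤ + 25 * N → + 99 * N ≤ + 2 * sum s →
                    value 1ℤ 0ℤ s ≤ sum s * sum s + + 25 * (N * N)
    removed-pairs {N} N≥0 sz≡0 γ≤ h≥ = ≤-trans split (subst
      (λ t → + 2 * (p * γ) + (a z * a z + p * p) + b * b ≤ t * t + + 25 * (N * N)) (sym masses′)
      (≤-by _ (N≥0 ⊗ diff (≤-trans p≤γ γ≤)
               ⊕ p≥0 ⊗ (diff (≤-trans h≥ (≤-reflexive (cong (λ t → + 2 * t) masses′)))
                         ⊕ 0≤+ {2} ⊗ (diff γ≤ ⊕ diff (≤-trans p≤γ γ≤)))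
               ⊕ 0≤+ {2} ⊗ a≥0 z ⊗ b≥0)
        (eq γ (a z) p b N)))
      where
      eq : ∀ γ a p b N → (a + p + b) * (a + p + b) + + 25 * (N * N) ≡
        (+ 2 * (p * γ) + (a * a + p * p) + b * b) +
        (N * (+ 25 * N - p) + (p * (+ 2 * (a + p + b) - + 99 * N + + 2 * (+ 25 * N - γ + (+ 25 * N - p))) + + 2 * (a * b)))
      eq = solve-∀

      kept : Fin n → ℤ
      kept x = s x * a x

      kept≥0 : ∀ x → 0ℤ ≤ kept x
      kept≥0 x = s≥0 x ⊗ a≥0 x

      kept-z : kept z ≡ 0ℤ
      kept-z = trans (cong (_* a z) sz≡0) (*-zeroˡ (a z))

      kept≤p : sum kept ≤ p
      kept≤p = ≤-trans (∑-mono-except₁ {f = kept} {g = a} z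
          (λ i _ → ≤-by _ (diff (s≤M i) ⊗ a≥0 i) (eq′ (s i) (a i))))
        (≤-reflexive (trans (cong (λ t → A + (t - a z)) kept-z) (cong (λ t → A + t) (+-identityˡ (- a z)))))
        where
        eq′ : ∀ s a → a ≡ s * a + (1ℤ - s) * a
        eq′ = solve-∀

      kept-size : sum (λ x → kept x * size x) ≤ p * γ
      kept-size = ≤-trans (∑-product-off z kept≥0 size≥0) (≤-trans
        (≤-reflexive (trans (cong (λ t → t * α + (sum kept - t) * (sum size - α)) kept-z)
                            (simplify α (sum kept) (sum size))))
        (*-mono-nonneg (∑-nonneg kept≥0) kept≤p others≥0 others≤γ))
        where
        simplify : ∀ α k S → 0ℤ * α + (k - 0ℤ) * (S - α) ≡ k * (S - α)
        simplify = solve-∀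

      split : value 1ℤ 0ℤ s ≤ + 2 * (p * γ) + (a z * a z + p * p) + b * b
      split = begin
        sum (starTerm 1ℤ 0ℤ s) + 1ℤ * (b * b)
          ≡⟨ cong₂ _+_ (trans (∑-cong λ x → term (s x) (a x) (size x))
               (trans (∑-+ (λ x → + 2 * (kept x * size x)) (λ x → a x * a x))
                 (cong (_+ squares) (∑-*ˡ (+ 2) (λ x → kept x * size x))))) (*-identityˡ (b * b)) ⟩
        + 2 * sum (λ x → kept x * size x) + squares + b * b
          ≤⟨ +-monoˡ-≤ (b * b) (+-mono-≤ (*-monoˡ (+ 2) 0≤+ kept-size) (∑-product-off z a≥0 a≥0)) ⟩
        + 2 * (p * γ) + (a z * a z + p * p) + b * b ∎
        where
        open ≤-Reasoning
        term : ∀ s a α → + 2 * 1ℤ * s * a * α + (1ℤ - 0ℤ * s) * (a * a) ≡ + 2 * (s * a * α) + a * a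
        term = solve-∀

module LightTriples (P : Profile n) {M : ℤ} {s : Fin n → ℤ} (M≡ : M ≡ + 34 * + n) (W : Weights M (+ 2) s) where
  open Profile P
  open Weights W
  open Facts P W

  private
    ν U : ℤ
    ν = + n
    U = sum s

  -- With M = 34n the factor 17n²M is nM²/2, and the cap is M(1 - α/n) for a star with α leaves. As
  -- a ≤ Mα, the star term increases with `s x`. At the cap it falls short of nM²a/2 by 17Ma(n -
  -- 2α)² + 34(n - 2α)a².
  light-triples : (∀ x → + 2 * size x ≤ + n) → (∀ x → s x ≤ + 34 * (+ n - size x)) → sum s ≤ + 17 * (+ n * + n) →
                  value M (+ 2) s ≤ + 17 * (+ n * + n) * M * sum s
  light-triples light cap U≤ = begin
    sum (starTerm M (+ 2) s) + M * (b * b)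
      ≤⟨ +-mono-≤ (∑-mono termwise) (≤-by _ (M≥0 ⊗ b≥0 ⊗ diff (≤-trans b≤σ U≤)) (rest-eq ν M b)) ⟩
    sum (λ x → K * a x) + K * b
      ≡⟨ cong (_+ K * b) (∑-*ˡ K a) ⟩
    K * A + K * b
      ≡⟨ sym (*-distribˡ-+ K A b) ⟩
    K * (A + b)
      ≡⟨ cong (K *_) masses ⟩
    K * U ∎
    where
    open ≤-Reasoning
    K : ℤ
    K = + 17 * (ν * ν) * M
    rest-eq : ∀ ν M b → + 17 * (ν * ν) * M * b ≡ M * (b * b) + M * (b * (+ 17 * (ν * ν) - b))
    rest-eq = solve-∀
    termwise : ∀ x → starTerm M (+ 2) s x ≤ K * a x
    termwise x = ≤-by _
      (a≥0 x ⊗ (0≤+ {17} ⊗ M≥0 ⊗ square≥0 (ν - + 2 * size x) ⊕ 0≤+ {34} ⊗ diff (light x) ⊗ a≥0 x)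
        ⊕ 0≤+ {2} ⊗ a≥0 x ⊗ diff (a≤size x) ⊗ diff (cap x))
      (eq ν M (s x) (a x) (size x) M≡)
      where
      eq : ∀ ν M s a α → M ≡ + 34 * ν → + 17 * (ν * ν) * M * a ≡
        (+ 2 * M * s * a * α + (M - + 2 * s) * (a * a)) +
        (a * (+ 17 * (M * ((ν - + 2 * α) * (ν - + 2 * α))) + + 34 * ((ν - + 2 * α) * a)) +
         + 2 * (a * ((M * α - a) * (+ 34 * (ν - α) - s))))
      eq ν .(+ 34 * ν) s a α refl = ring ν s a α
        where
        ring : ∀ ν s a α → + 17 * (ν * ν) * (+ 34 * ν) * a ≡
          (+ 2 * (+ 34 * ν) * s * a * α + (+ 34 * ν - + 2 * s) * (a * a)) +
          (a * (+ 17 * (+ 34 * ν * ((ν - + 2 * α) * (ν - + 2 * α))) + + 34 * ((ν - + 2 * α) * a)) +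
           + 2 * (a * ((+ 34 * ν * α - a) * (+ 34 * (ν - α) - s))))
        ring = solve-∀

module HeavyTriples (P : Profile n) {M : ℤ} {s : Fin n → ℤ} (W : Weights M (+ 2) s) where
  open Profile P
  open Weights W
  open Facts P W

  private
    ν U : ℤ
    ν = + n
    U = sum s

  -- The target `K` = MU + G is a price per unit of weight. The three conditions on `G` make it
  -- sufficient at `y`, at `z` and at all other centres, up to quadratic terms at `y` and `z` that
  -- have opposite signs and are compared in `balance`.
  heavy-triples : ∀ {y z s₁ s₂ G} → y ≢ z →
    s y ≤ s₁ → s z ≤ s₂ → s₁ + s₂ ≡ M → + 2 * s₁ ≤ M → 0ℤ ≤ s₁ → 0ℤ ≤ G →
    + 2 * s₁ * (M * size y - sum s) ≤ G → + 2 * s₂ * (M * (+ n - size y) - sum s) ≤ G →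
    M * (M * (+ n - size y) - sum s) ≤ G → (∀ x → y ≢ x → z ≢ x → + 2 * size x ≤ + n - size y) →
    value M (+ 2) s ≤ (M * sum s + G) * sum s
  heavy-triples {y} {z} {s₁} {s₂} {G} y≢z sy sz refl 2s₁≤M s₁≥0 G≥0 gain₁ gain₂ gain₃ others = begin
    sum (starTerm M (+ 2) s) + M * (b * b)
      ≤⟨ +-mono-≤ (∑-mono-except₂ {f = starTerm M (+ 2) s} {g = λ x → K * a x} y≢z other) rest≤ ⟩
    sum (λ x → K * a x) + (starTerm M (+ 2) s y - K * a y) + (starTerm M (+ 2) s z - K * a z) + K * b
      ≤⟨ +-monoˡ-≤ (K * b) (+-mono-≤ (+-mono-≤ (≤-reflexive (∑-*ˡ K a)) first) second) ⟩
    K * A + (- (e * (a y * (U - a y)))) + (e * (a z * (U - a z)) - + 2 * s₂ * (M * (w * a z))) + K * b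
      ≤⟨ balance ⟩
    K * U ∎
    where
    open ≤-Reasoning
    K e w q : ℤ
    K = M * U + G
    e = M - + 2 * s₁
    w = ν - size y - size z
    q = U - a y - a z

    e≥0 : 0ℤ ≤ e
    e≥0 = diff 2s₁≤M

    rest≤ : M * (b * b) ≤ K * b
    rest≤ = ≤-by _ (M≥0 ⊗ b≥0 ⊗ diff b≤σ ⊕ G≥0 ⊗ b≥0) (eq M U G b)
      where
      eq : ∀ M U G b → (M * U + G) * b ≡ M * (b * b) + (M * (b * (U - b)) + G * b)
      eq = solve-∀

    other : ∀ x → y ≢ x → z ≢ x → starTerm M (+ 2) s x ≤ K * a x
    other x y≢x z≢x = ≤-by _
      (a≥0 x ⊗ diff gain₃ ⊕ M≥0 ⊗ M≥0 ⊗ a≥0 x ⊗ diff (others x y≢x z≢x) ⊕ M≥0 ⊗ a≥0 x ⊗ a≥0 x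
        ⊕ 0≤+ {2} ⊗ a≥0 x ⊗ diff (a≤size x) ⊗ diff (s≤M x))
      (eq M U G (s x) (a x) (size x) (ν - size y))
      where
      eq : ∀ M U G s a α γ → (M * U + G) * a ≡
        (+ 2 * M * s * a * α + (M - + 2 * s) * (a * a)) +
        (a * (G - M * (M * γ - U)) + (M * (M * (a * (γ - + 2 * α))) + (M * (a * a) + + 2 * (a * ((M * α - a) * (M - s))))))
      eq = solve-∀

    first : starTerm M (+ 2) s y - K * a y ≤ - (e * (a y * (U - a y)))
    first = ≤-by _ (a≥0 y ⊗ diff gain₁ ⊕ 0≤+ {2} ⊗ a≥0 y ⊗ diff (a≤size y) ⊗ diff sy)
      (eq M U G (s y) s₁ (a y) (size y))
      where
      eq : ∀ M U G s s₁ a α → - ((M - + 2 * s₁) * (a * (U - a))) ≡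
        (+ 2 * M * s * a * α + (M - + 2 * s) * (a * a)) - (M * U + G) * a +
        (a * (G - + 2 * s₁ * (M * α - U)) + + 2 * (a * ((M * α - a) * (s₁ - s))))
      eq = solve-∀

    second : starTerm M (+ 2) s z - K * a z ≤ e * (a z * (U - a z)) - + 2 * s₂ * (M * (w * a z))
    second = ≤-by _ (a≥0 z ⊗ diff gain₂ ⊕ 0≤+ {2} ⊗ a≥0 z ⊗ diff (a≤size z) ⊗ diff sz)
      (eq U G (s z) s₁ s₂ (a z) ν (size y) (size z))
      where
      eq : ∀ U G s s₁ s₂ a ν α α₂ → (s₁ + s₂ - + 2 * s₁) * (a * (U - a)) - + 2 * s₂ * ((s₁ + s₂) * ((ν - α - α₂) * a)) ≡
        (+ 2 * (s₁ + s₂) * s * a * α₂ + (s₁ + s₂ - + 2 * s) * (a * a)) - ((s₁ + s₂) * U + G) * a +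
        (a * (G - + 2 * s₂ * ((s₁ + s₂) * (ν - α) - U)) + + 2 * (a * (((s₁ + s₂) * α₂ - a) * (s₂ - s))))
      eq = solve-∀

    q≥0 : 0ℤ ≤ q
    q≥0 = ≤-trans (b≥0 ⊕ diff (∑-mono-except₂ {f = zero-except} {g = a} y≢z nonneg)) (≤-reflexive collect)
      where
      zero-except : Fin n → ℤ
      zero-except _ = 0ℤ
      nonneg : ∀ i → y ≢ i → z ≢ i → 0ℤ ≤ a i
      nonneg i _ _ = a≥0 i
      collect : b + (A + (0ℤ - a y) + (0ℤ - a z) - sum zero-except) ≡ q
      collect = trans (cong (λ t → b + (A + (0ℤ - a y) + (0ℤ - a z) - t)) (∑-zero {n} λ _ → refl))
        (trans (eq A b (a y) (a z)) (cong (λ t → t - a y - a z) masses))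
        where
        eq : ∀ A b y z → b + (A + (0ℤ - y) + (0ℤ - z) - 0ℤ) ≡ A + b - y - z
        eq = solve-∀

    q≤Mw : q ≤ M * w
    q≤Mw = begin
      U - a y - a z
        ≡⟨ cong (λ t → t - a y - a z) (sym masses) ⟩
      A + b - a y - a z
        ≤⟨ +-monoˡ-≤ (- a z) (+-monoˡ-≤ (- a y) (+-mono-≤
             (∑-mono-except₂ {f = a} {g = λ x → M * size x} y≢z (λ i _ _ → a≤size i)) b≤β)) ⟩
      (sum (λ x → M * size x) + (a y - M * size y) + (a z - M * size z)) + M * β - a y - a z
        ≡⟨ cong (λ t → (t + (a y - M * size y) + (a z - M * size z)) + M * β - a y - a z) (∑-*ˡ M size) ⟩
      (M * sum size + (a y - M * size y) + (a z - M * size z)) + M * β - a y - a z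
        ≡⟨ eq M (sum size) β (a y) (a z) (size y) (size z) ⟩
      M * (sum size + β - size y - size z)
        ≡⟨ cong (λ t → M * (t - size y - size z)) sizes ⟩
      M * w ∎
      where
      eq : ∀ M S β y z α α₂ → (M * S + (y - M * α) + (z - M * α₂)) + M * β - y - z ≡ M * (S + β - α - α₂)
      eq = solve-∀

    -- With q = U - a_y - a_z, the difference a_z(U - a_z) - a_y(U - a_y) is q(a_z - a_y). Since q ≤
    -- Mw and e ≤ 2s₂ = M + e, the negative term of `second` absorbs `e` times its positive part.
    balance : K * A + (- (e * (a y * (U - a y)))) + (e * (a z * (U - a z)) - + 2 * s₂ * (M * (w * a z))) + K * b ≤ K * U
    balance = ≤-by _ (e≥0 ⊗ q≥0 ⊗ a≥0 y ⊕ a≥0 z ⊗ (e≥0 ⊗ diff q≤Mw ⊕ M≥0 ⊗ ≤-trans q≥0 q≤Mw))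
      (trans (cong (K *_) (sym masses)) (trans (eq s₁ s₂ K A b U (a y) (a z) (M * w))
        (cong (λ t → K * A + (- (e * (a y * (U - a y)))) + (e * (a z * (U - a z)) - t) + K * b +
          (e * (q * a y) + a z * (e * (M * w - q) + M * (M * w)))) (assoc s₂ M w (a z)))))
      where
      assoc : ∀ s m w a → + 2 * s * ((m * w) * a) ≡ + 2 * s * (m * (w * a))
      assoc = solve-∀
      eq : ∀ s₁ s₂ K A b U y z v → K * (A + b) ≡
        K * A + (- ((s₁ + s₂ - + 2 * s₁) * (y * (U - y)))) + ((s₁ + s₂ - + 2 * s₁) * (z * (U - z)) - + 2 * s₂ * (v * z)) + K * b +
        ((s₁ + s₂ - + 2 * s₁) * ((U - y - z) * y) + z * ((s₁ + s₂ - + 2 * s₁) * (v - (U - y - z)) + (s₁ + s₂) * v))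
      eq = solve-∀

-- Caps on the weights and the kinds of colours

-- Greedy choice: the values of `f` are kept from the first index on until the total `T` is used up.
trim : ∀ {n} (f : Fin n → ℤ) T → (∀ i → 0ℤ ≤ f i) → 0ℤ ≤ T → T ≤ sum f →
       ∃[ g ] ((∀ i → 0ℤ ≤ g i) × (∀ i → g i ≤ f i) × sum g ≡ T)
trim {zero}  f T _ 0≤T T≤ = f , (λ ()) , (λ ()) , ≤-antisym 0≤T T≤
trim {suc n} f T f≥0 0≤T T≤ with T ≤? f zero
... | yes T≤f₀ = g , g≥0 , g≤f , trans (cong (λ t → T + t) (∑-zero {n} λ _ → refl)) (+-identityʳ T)
  where
  g : Fin (suc n) → ℤ
  g zero    = T
  g (suc _) = 0ℤ
  g≥0 : ∀ i → 0ℤ ≤ g i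
  g≥0 zero    = 0≤T
  g≥0 (suc _) = ≤-refl
  g≤f : ∀ i → g i ≤ f i
  g≤f zero    = T≤f₀
  g≤f (suc i) = f≥0 (suc i)
... | no T≰f₀ with trim (λ i → f (suc i)) (T - f zero) (λ i → f≥0 (suc i)) (diff (<⇒≤ (≰⇒> T≰f₀)))
                       (≤-by _ (diff T≤) (eq T (f zero) (sum (λ i → f (suc i)))))
  where
  eq : ∀ T x S → S ≡ (T - x) + ((x + S) - T)
  eq = solve-∀
... | g′ , g′≥0 , g′≤f , ∑g′ = g , g≥0 , g≤f , trans (cong (λ t → f zero + t) ∑g′) (eq T (f zero))
  where
  g : Fin (suc n) → ℤ
  g zero    = f zero
  g (suc i) = g′ i
  g≥0 : ∀ i → 0ℤ ≤ g i
  g≥0 zero    = f≥0 zero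
  g≥0 (suc i) = g′≥0 i
  g≤f : ∀ i → g i ≤ f i
  g≤f zero    = ≤-refl
  g≤f (suc i) = g′≤f i
  eq : ∀ T x → x + (T - x) ≡ T
  eq = solve-∀

-- All removals at a vertex are subtracted together, and negative results are raised to 0. The
-- remaining room is at least `T` and is trimmed to exactly `T`; every single cap still holds
-- because each removal is at most `M`.
capped-weights : ∀ {M T} (r : Fin k → Fin n → ℤ) (R : Fin k → ℤ) → 0ℤ ≤ M → 0ℤ ≤ T →
  (∀ c v → 0ℤ ≤ r c v) → (∀ c v → r c v ≤ M) → (∀ c → sum (r c) ≤ R c) → T + sum R ≤ + n * M →
  ∃[ s ] ((∀ v → 0ℤ ≤ s v) × (∀ v → s v ≤ M) × (∀ c v → s v ≤ M - r c v) × sum s ≡ T)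
capped-weights {k} {n} {M} {T} r R M≥0 T≥0 r≥0 r≤M ∑r≤ T≤ =
  let (s , s≥0 , s≤ , ∑s) = trim room T (λ v → i≤i⊔j 0ℤ (free v)) T≥0 T≤room
  in s , s≥0 , (λ v → ≤-trans (s≤ v) (⊔-lub M≥0 (≤-by _ (∑-nonneg λ c → r≥0 c v) (eq M (sum λ c → r c v)))))
       , (λ c v → ≤-trans (s≤ v) (⊔-lub (diff (r≤M c v))
           (+-monoʳ-≤ M (neg-mono-≤ (term≤∑ (λ c → r≥0 c v) c)))))
       , ∑s
  where
  free room : Fin n → ℤ
  free v = M - sum (λ c → r c v)
  room v = 0ℤ ⊔ free v
  eq : ∀ M S → M ≡ (M - S) + S
  eq = solve-∀
  negate : ∀ a → - a ≡ -1ℤ * a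
  negate = solve-∀
  T≤room : T ≤ sum room
  T≤room = begin
    T
      ≤⟨ ≤-by _ (diff T≤ ⊕ diff (∑-mono ∑r≤)) (rearrange T (+ n * M) (sum R) (sum λ c → sum (r c))) ⟩
    + n * M - sum (λ c → sum (r c))
      ≡⟨ cong₂ _-_ (sym (∑-const n M)) (∑-comm r) ⟩
    sum {n} (λ _ → M) - sum (λ v → sum (λ c → r c v))
      ≡⟨ cong (λ t → sum {n} (λ _ → M) + t) (trans (negate _) (trans (sym (∑-*ˡ -1ℤ (λ v → sum (λ c → r c v))))
           (∑-cong λ v → sym (negate (sum λ c → r c v))))) ⟩
    sum {n} (λ _ → M) + sum (λ v → - sum (λ c → r c v))
      ≡⟨ sym (∑-+ (λ _ → M) (λ v → - sum (λ c → r c v))) ⟩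
    sum free
      ≤⟨ ∑-mono (λ v → i≤j⊔i 0ℤ (free v)) ⟩
    sum room ∎
    where
    open ≤-Reasoning
    rearrange : ∀ T m R r → m - r ≡ T + ((m - (T + R)) + (R - r))
    rearrange = solve-∀

three-sizes : (P : Profile n) → ∀ {x y z} → y ≢ z → y ≢ x → z ≢ x →
              Profile.size P x + Profile.size P y + Profile.size P z ≤ + n
three-sizes {n} P {x} {y} {z} y≢z y≢x z≢x = ≤-by _
  (diff (∑-mono-except₂ {f = λ i → 𝟙 (x ≟ i) * size i} {g = size} y≢z λ i _ _ →
     ≤-trans (*-monoʳ-≤-nonNeg (size i) {{nonNegative (size≥0 i)}} (𝟙≤1 (x ≟ i))) (≤-reflexive (*-identityˡ (size i))))
   ⊕ β≥0)
  (trans (sym sizes) (trans (eq (size x) (size y) (size z) (sum size) β)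
    (cong (λ t → size x + size y + size z + (t + β))
      (cong₂ _-_ (cong₂ (λ a b → sum size + (a - size y) + (b - size z)) (sym (vanish y y≢x)) (sym (vanish z z≢x)))
                 (sym (∑-pick x size))))))
  where
  open Profile P
  size≥0 : ∀ x → 0ℤ ≤ size x
  size≥0 x = ∑-nonneg λ v → leafOf≥0 v x
  β : ℤ
  β = sum unattached
  β≥0 : 0ℤ ≤ β
  β≥0 = ∑-nonneg unattached≥0
  sizes : sum size + β ≡ + n
  sizes = Facts.sizes P {1ℤ} {0ℤ} {λ _ → 0ℤ} (record
    { s≥0 = λ _ → ≤-refl ; s≤M = λ _ → 0≤+ ; M≥0 = 0≤+ ; τ≥0 = ≤-refl ; τ≤2 = 0≤+ })
  vanish : ∀ i → i ≢ x → 𝟙 (x ≟ i) * size i ≡ 0ℤ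
  vanish i i≢x = trans (cong (_* size i) (𝟙-no (x ≟ i) (λ x≡i → i≢x (sym x≡i)))) (*-zeroˡ (size i))
  eq : ∀ x y z S β → S + β ≡ x + y + z + ((S + (0ℤ - y) + (0ℤ - z) - x) + β)
  eq = solve-∀

-- A colour with a star of at least n/2 leaves (centre y) is heavy or huge.  The vertex z
-- is the centre of a second star such that all others have at most (n - size y)/2 leaves.
module _ (P : Profile n) (N : ℤ) where

  open Profile P

  Dominant : Fin n → Fin n → Set
  Dominant y z = y ≢ z × + n ≤ + 2 * size y × (∀ x → y ≢ x → z ≢ x → + 2 * size x ≤ + n - size y)

  data Kind : Set where
    light : (∀ x → + 2 * size x ≤ + n) → Kind
    heavy : ∀ y z → Dominant y z → size y ≤ + 42 * N → Kind
    huge  : ∀ y z → Dominant y z → + 42 * N ≤ size y → Kind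

  kind : (∀ (y : Fin n) → ∃[ z ] y ≢ z) → Kind
  kind another with Finₚ.any? (λ x → ¬? (+ 2 * size x ≤? + n))
  ... | no none = light small
    where
    small : ∀ x → + 2 * size x ≤ + n
    small x with + 2 * size x ≤? + n
    ... | yes ≤n = ≤n
    ... | no ≰n  = ⊥-elim (none (x , ≰n))
  ... | yes (y , y-big) = decide (proj₁ runner-up) (proj₂ runner-up)
    where
    y-half : + n ≤ + 2 * size y
    y-half = <⇒≤ (≰⇒> y-big)

    runner-up : ∃[ z ] Dominant y z
    runner-up with Finₚ.any? (λ z → ¬? (y ≟ z) ×-dec ¬? (+ 2 * size z ≤? + n - size y))
    ... | yes (z , y≢z , z-big) = z , y≢z , y-half , others
      where
      others : ∀ x → y ≢ x → z ≢ x → + 2 * size x ≤ + n - size y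
      others x y≢x z≢x = ≤-by _
        (0≤+ {2} ⊗ diff (three-sizes P y≢z y≢x z≢x) ⊕ diff (<⇒≤ (≰⇒> z-big))) (eq (size x) (size y) (size z) (+ n))
        where
        eq : ∀ x y z n → n - y ≡ + 2 * x + (+ 2 * (n - (x + y + z)) + (+ 2 * z - (n - y)))
        eq = solve-∀
    -- No second star is large, so any vertex other than `y` can serve as `z`.
    ... | no none = proj₁ (another y) , proj₂ (another y) , y-half , others
      where
      others : ∀ x → y ≢ x → proj₁ (another y) ≢ x → + 2 * size x ≤ + n - size y
      others x y≢x _ with + 2 * size x ≤? + n - size y
      ... | yes small = small
      ... | no large  = ⊥-elim (none (x , y≢x , large))

    decide : ∀ z → Dominant y z → Kind
    decide z dom with size y ≤? + 42 * N
    ... | yes ≤42 = heavy y z dom ≤42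
    ... | no ≰42  = huge y z dom (<⇒≤ (≰⇒> ≰42))

-- Caps, gains and bounds for each kind of colour

module KindBounds (P : Profile n) (N M : ℤ) (1≤N : 1ℤ ≤ N) (n≡ : + n ≡ + 67 * N) (M≡ : M ≡ + 34 * + n) where

  open Profile P

  private
    N≥0 : 0ℤ ≤ N
    N≥0 = ≤-trans 0≤+ 1≤N

    M≥0 : 0ℤ ≤ M
    M≥0 = ≤-trans (0≤+ {34} ⊗ 0≤+ {n}) (≤-reflexive (sym M≡))

    size≥0 : ∀ x → 0ℤ ≤ size x
    size≥0 x = ∑-nonneg λ v → leafOf≥0 v x

    sum-size≤n : sum size ≤ + n
    sum-size≤n = Facts.sum-size≤ P {1ℤ} {0ℤ} {λ _ → 0ℤ} (record
      { s≥0 = λ _ → ≤-refl ; s≤M = λ _ → 0≤+ ; M≥0 = 0≤+ ; τ≥0 = ≤-refl ; τ≤2 = 0≤+ })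

    excess : Fin n → ℤ
    excess y = + 134 * (size y - + 25 * N)

    deficit : Fin n → ℤ
    deficit y = + 134 * (+ 42 * N - size y)

    excess+deficit : ∀ y → deficit y + excess y ≡ M
    excess+deficit y = trans (eq (size y) N) (sym (trans M≡ (cong (+ 34 *_) n≡)))
      where
      eq : ∀ α N → + 134 * (+ 42 * N - α) + + 134 * (α - + 25 * N) ≡ + 34 * (+ 67 * N)
      eq = solve-∀

    excess≥0 : ∀ {y z} → Dominant P N y z → 0ℤ ≤ excess y
    excess≥0 {y} (_ , half , _) = ≤-trans (0≤+ {67} ⊗ (diff half ⊕ 0≤+ {17} ⊗ N≥0))
      (≤-reflexive (eq (+ n) (size y) N n≡))
      where
      eq : ∀ ν α N → ν ≡ + 67 * N → + 67 * (+ 2 * α - ν + + 17 * N) ≡ + 134 * (α - + 25 * N)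
      eq .(+ 67 * N) α N refl = ring α N
        where
        ring : ∀ α N → + 67 * (+ 2 * α - + 67 * N + + 17 * N) ≡ + 134 * (α - + 25 * N)
        ring = solve-∀

    deficit≥0 : ∀ {y} → size y ≤ + 42 * N → 0ℤ ≤ deficit y
    deficit≥0 ≤42 = 0≤+ {134} ⊗ diff ≤42

  -- The indicator of the colours that are not huge; its sum over the colours is the number m.
  kept : Kind P N → ℤ
  kept (light _)       = 1ℤ
  kept (heavy _ _ _ _) = 1ℤ
  kept (huge _ _ _ _)  = 0ℤ

  -- The allowed surplus of a colour over its share MU², in units of 67MU. The value for light
  -- colours is (17N)², which is also the maximum of the heavy one, attained at 67N/2 leaves.
  gain : Kind P N → ℤ
  gain (light _)       = + 289 * N * N
  gain (heavy y _ _ _) = + 4 * ((size y - + 25 * N) * (+ 42 * N - size y))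
  gain (huge _ _ _ _)  = 0ℤ

  kept≥0 : ∀ K → 0ℤ ≤ kept K
  kept≥0 (light _)       = 0≤+
  kept≥0 (heavy _ _ _ _) = 0≤+
  kept≥0 (huge _ _ _ _)  = 0≤+

  kept≤1 : ∀ K → kept K ≤ 1ℤ
  kept≤1 (light _)       = ≤-refl
  kept≤1 (heavy _ _ _ _) = ≤-refl
  kept≤1 (huge _ _ _ _)  = 0≤+

  gain≤ : ∀ K → gain K ≤ + 289 * N * N * kept K
  gain≤ (light _)       = ≤-reflexive (sym (*-identityʳ (+ 289 * N * N)))
  gain≤ (heavy y _ _ _) = ≤-by _ (square≥0 (+ 2 * size y - + 67 * N)) (eq (size y) N)
    where
    eq : ∀ α N → + 289 * N * N * 1ℤ ≡ + 4 * ((α - + 25 * N) * (+ 42 * N - α)) +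
      (+ 2 * α - + 67 * N) * (+ 2 * α - + 67 * N)
    eq = solve-∀
  gain≤ (huge _ _ _ _)  = ≤-reflexive (sym (*-zeroʳ (+ 289 * N * N)))

  -- For a heavy colour the two caps are chosen such that deficit y · (size y - u) and
  -- excess y · (n - size y - u) agree, where u = 25N; they sum to M = 34n = 2278N.
  tripleRemoval : Kind P N → Fin n → ℤ
  tripleRemoval (light _)       v = + 34 * size v
  tripleRemoval (heavy y z _ _) v = 𝟙 (y ≟ v) * excess y + 𝟙 (z ≟ v) * deficit y
  tripleRemoval (huge y _ _ _)  v = 𝟙 (y ≟ v) * M

  tripleRemoval≥0 : ∀ K v → 0ℤ ≤ tripleRemoval K v
  tripleRemoval≥0 (light _)           v = 0≤+ {34} ⊗ size≥0 v
  tripleRemoval≥0 (heavy y z dom ≤42) v = 0≤𝟙 (y ≟ v) ⊗ excess≥0 dom ⊕ 0≤𝟙 (z ≟ v) ⊗ deficit≥0 ≤42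
  tripleRemoval≥0 (huge y _ _ _)      v = 0≤𝟙 (y ≟ v) ⊗ M≥0

  ∑-tripleRemoval≤ : ∀ K → sum (tripleRemoval K) ≤ M
  ∑-tripleRemoval≤ (light _) = ≤-trans (≤-reflexive (∑-*ˡ (+ 34) size))
    (≤-trans (*-monoˡ (+ 34) 0≤+ sum-size≤n) (≤-reflexive (sym M≡)))
  ∑-tripleRemoval≤ (heavy y z _ _) = ≤-reflexive (trans
    (∑-+ (λ v → 𝟙 (y ≟ v) * excess y) (λ v → 𝟙 (z ≟ v) * deficit y))
    (trans (cong₂ _+_ (∑-pick y (λ _ → excess y)) (∑-pick z (λ _ → deficit y)))
      (trans (+-comm (excess y) (deficit y)) (excess+deficit y))))
  ∑-tripleRemoval≤ (huge y _ _ _) = ≤-reflexive (∑-pick y (λ _ → M))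

  tripleRemoval≤ : ∀ K v → tripleRemoval K v ≤ M
  tripleRemoval≤ K v = ≤-trans (term≤∑ (tripleRemoval≥0 K) v) (∑-tripleRemoval≤ K)

  pairRemoval : Kind P N → Fin n → ℤ
  pairRemoval (light _)       v = 0ℤ
  pairRemoval (heavy _ _ _ _) v = 0ℤ
  pairRemoval (huge y _ _ _)  v = 𝟙 (y ≟ v)

  pairRemoval≥0 : ∀ K v → 0ℤ ≤ pairRemoval K v
  pairRemoval≥0 (light _)       v = ≤-refl
  pairRemoval≥0 (heavy _ _ _ _) v = ≤-refl
  pairRemoval≥0 (huge y _ _ _)  v = 0≤𝟙 (y ≟ v)

  pairRemoval≤ : ∀ K v → pairRemoval K v ≤ 1ℤ
  pairRemoval≤ (light _)       v = 0≤+
  pairRemoval≤ (heavy _ _ _ _) v = 0≤+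
  pairRemoval≤ (huge y _ _ _)  v = 𝟙≤1 (y ≟ v)

  ∑-pairRemoval≤ : ∀ K → sum (pairRemoval K) ≤ 1ℤ - kept K
  ∑-pairRemoval≤ (light _)       = ≤-reflexive (∑-zero {n} λ _ → refl)
  ∑-pairRemoval≤ (heavy _ _ _ _) = ≤-reflexive (∑-zero {n} λ _ → refl)
  ∑-pairRemoval≤ (huge y _ _ _)  = ≤-reflexive (∑-𝟙 y)

  -- For light colours 17n²MU equals MU² + 67MU · 289N², because U = 25NM. For heavy ones the caps
  -- make the conditions at `y` and `z` tight, and the one elsewhere has slack since n/2 ≤ `size y`
  -- ≤ 42N. For huge ones `y` has weight 0, and n - `size y` ≤ 25N = U/M permits a zero gain.
  triple-bound : ∀ K {s} → Weights M (+ 2) s → (∀ v → s v ≤ M - tripleRemoval K v) → sum s ≡ + 25 * N * M →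
                 value M (+ 2) s ≤ M * (sum s * sum s) + + 67 * M * sum s * gain K
  triple-bound (light small) {s} W cap ∑s = ≤-trans
    (LightTriples.light-triples P M≡ W small
       (λ x → ≤-trans (cap x) (≤-reflexive (trans (cong (_- + 34 * size x) M≡) (factor (+ n) (size x))))) U≤)
    (≤-reflexive (trans (cong (+ 17 * (+ n * + n) * M *_) ∑s) (trans (eq (+ n) M N n≡ M≡)
      (cong (λ U → M * (U * U) + + 67 * M * U * (+ 289 * N * N)) (sym ∑s)))))
    where
    factor : ∀ ν α → + 34 * ν - + 34 * α ≡ + 34 * (ν - α)
    factor = solve-∀
    eq : ∀ ν M N → ν ≡ + 67 * N → M ≡ + 34 * ν → + 17 * (ν * ν) * M * (+ 25 * N * M) ≡
      M * (+ 25 * N * M * (+ 25 * N * M)) + + 67 * M * (+ 25 * N * M) * (+ 289 * N * N)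
    eq .(+ 67 * N) .(+ 34 * (+ 67 * N)) N refl refl = ring N
      where
      ring : ∀ N → + 17 * (+ 67 * N * (+ 67 * N)) * (+ 34 * (+ 67 * N)) * (+ 25 * N * (+ 34 * (+ 67 * N))) ≡
        + 34 * (+ 67 * N) * (+ 25 * N * (+ 34 * (+ 67 * N)) * (+ 25 * N * (+ 34 * (+ 67 * N)))) +
        + 67 * (+ 34 * (+ 67 * N)) * (+ 25 * N * (+ 34 * (+ 67 * N))) * (+ 289 * N * N)
      ring = solve-∀
    U≤ : sum s ≤ + 17 * (+ n * + n)
    U≤ = ≤-trans (≤-reflexive ∑s) (≤-by _ ((0≤+ {19363} ⊗ N≥0) ⊗ N≥0) (eq′ (+ n) M N n≡ M≡))
      where
      eq′ : ∀ ν M N → ν ≡ + 67 * N → M ≡ + 34 * ν → + 17 * (ν * ν) ≡ + 25 * N * M + + 19363 * N * N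
      eq′ .(+ 67 * N) .(+ 34 * (+ 67 * N)) N refl refl = ring N
        where
        ring : ∀ N → + 17 * (+ 67 * N * (+ 67 * N)) ≡ + 25 * N * (+ 34 * (+ 67 * N)) + + 19363 * N * N
        ring = solve-∀
  triple-bound (heavy y z dom@(y≢z , half , others) ≤42) {s} W cap ∑s = ≤-trans
    (HeavyTriples.heavy-triples P W {y} {z} {deficit y} {excess y} {G} y≢z cap-y cap-z (excess+deficit y)
      (≤-by _ (0≤+ {134} ⊗ diff half) (balanced (+ n) M N (size y) n≡ M≡))
      (deficit≥0 ≤42)
      (≤-trans (0≤+ {2} ⊗ M≥0 ⊗ excess≥0 dom ⊗ diff ≤42) (≤-reflexive (positivity M (size y) N)))
      (≤-reflexive (trans (cong (λ U → + 2 * deficit y * (M * size y - U)) ∑s) (at-y M (size y) N)))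
      (≤-reflexive (trans (cong (λ U → + 2 * excess y * (M * (+ n - size y) - U)) ∑s) (at-z (+ n) M (size y) N n≡)))
      (≤-by _ (M≥0 ⊗ diff ≤42 ⊗ 0≤+ {134} ⊗ diff half)
        (trans (elsewhere (+ n) M (size y) N n≡ M≡) (cong (λ U → M * (M * (+ n - size y) - U) +
           M * ((+ 42 * N - size y) * (+ 134 * (+ 2 * size y - + n)))) (sym ∑s))))
      others)
    (≤-reflexive (expand M (sum s) (gain′ (size y) N)))
    where
    gain′ : ℤ → ℤ → ℤ
    gain′ α N = + 4 * ((α - + 25 * N) * (+ 42 * N - α))
    G : ℤ
    G = + 67 * M * gain′ (size y) N
    cap-y : s y ≤ deficit y
    cap-y = ≤-trans (cap y) (≤-reflexive (trans
      (cong₂ (λ d e → M - (d * excess y + e * deficit y)) (𝟙-yes (y ≟ y) refl) (𝟙-no (z ≟ y) (λ z≡y → y≢z (sym z≡y))))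
      (trans (cong (λ m → m - (1ℤ * excess y + 0ℤ * deficit y)) (sym (excess+deficit y))) (eq (excess y) (deficit y)))))
      where
      eq : ∀ e d → d + e - (1ℤ * e + 0ℤ * d) ≡ d
      eq = solve-∀
    cap-z : s z ≤ excess y
    cap-z = ≤-trans (cap z) (≤-reflexive (trans
      (cong₂ (λ d e → M - (d * excess y + e * deficit y)) (𝟙-no (y ≟ z) y≢z) (𝟙-yes (z ≟ z) refl))
      (trans (cong (λ m → m - (0ℤ * excess y + 1ℤ * deficit y)) (sym (excess+deficit y))) (eq (excess y) (deficit y)))))
      where
      eq : ∀ e d → d + e - (0ℤ * e + 1ℤ * d) ≡ e
      eq = solve-∀
    balanced : ∀ ν M N α → ν ≡ + 67 * N → M ≡ + 34 * ν →
      M ≡ + 2 * (+ 134 * (+ 42 * N - α)) + + 134 * (+ 2 * α - ν)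
    balanced .(+ 67 * N) .(+ 34 * (+ 67 * N)) N α refl refl = ring N α
      where
      ring : ∀ N α → + 34 * (+ 67 * N) ≡ + 2 * (+ 134 * (+ 42 * N - α)) + + 134 * (+ 2 * α - + 67 * N)
      ring = solve-∀
    positivity : ∀ M α N → + 2 * (M * (+ 134 * (α - + 25 * N) * (+ 42 * N - α))) ≡
      + 67 * M * (+ 4 * ((α - + 25 * N) * (+ 42 * N - α)))
    positivity = solve-∀
    at-y : ∀ M α N → + 2 * (+ 134 * (+ 42 * N - α)) * (M * α - + 25 * N * M) ≡
      + 67 * M * (+ 4 * ((α - + 25 * N) * (+ 42 * N - α)))
    at-y = solve-∀
    at-z : ∀ ν M α N → ν ≡ + 67 * N → + 2 * (+ 134 * (α - + 25 * N)) * (M * (ν - α) - + 25 * N * M) ≡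
      + 67 * M * (+ 4 * ((α - + 25 * N) * (+ 42 * N - α)))
    at-z .(+ 67 * N) M α N refl = ring M α N
      where
      ring : ∀ M α N → + 2 * (+ 134 * (α - + 25 * N)) * (M * (+ 67 * N - α) - + 25 * N * M) ≡
        + 67 * M * (+ 4 * ((α - + 25 * N) * (+ 42 * N - α)))
      ring = solve-∀
    elsewhere : ∀ ν M α N → ν ≡ + 67 * N → M ≡ + 34 * ν →
      + 67 * M * (+ 4 * ((α - + 25 * N) * (+ 42 * N - α))) ≡
      M * (M * (ν - α) - + 25 * N * M) + M * ((+ 42 * N - α) * (+ 134 * (+ 2 * α - ν)))
    elsewhere .(+ 67 * N) .(+ 34 * (+ 67 * N)) α N refl refl = ring α N
      where
      ring : ∀ α N → + 67 * (+ 34 * (+ 67 * N)) * (+ 4 * ((α - + 25 * N) * (+ 42 * N - α))) ≡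
        + 34 * (+ 67 * N) * (+ 34 * (+ 67 * N) * (+ 67 * N - α) - + 25 * N * (+ 34 * (+ 67 * N))) +
        + 34 * (+ 67 * N) * ((+ 42 * N - α) * (+ 134 * (+ 2 * α - + 67 * N)))
      ring = solve-∀
    expand : ∀ M U g → (M * U + + 67 * M * g) * U ≡ M * (U * U) + + 67 * M * U * g
    expand = solve-∀
  triple-bound (huge y z (y≢z , half , others) ≥42) {s} W cap ∑s = ≤-trans
    (HeavyTriples.heavy-triples P W {y} {z} {0ℤ} {M} {0ℤ} y≢z cap-y (Weights.s≤M W z) (+-identityˡ M)
      M≥0 ≤-refl ≤-refl (≤-reflexive (*-zeroˡ (M * size y - sum s)))
      (≤-by _ (0≤+ {2} ⊗ M≥0 ⊗ M≥0 ⊗ diff ≥42)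
        (trans (at-z (+ n) M (size y) N n≡) (cong (λ U → + 2 * M * (M * (+ n - size y) - U) +
          + 2 * (M * (M * (size y - + 42 * N)))) (sym ∑s))))
      (≤-by _ (M≥0 ⊗ M≥0 ⊗ diff ≥42)
        (trans (elsewhere (+ n) M (size y) N n≡) (cong (λ U → M * (M * (+ n - size y) - U) +
          M * (M * (size y - + 42 * N))) (sym ∑s))))
      others)
    (≤-reflexive (expand M (sum s)))
    where
    cap-y : s y ≤ 0ℤ
    cap-y = ≤-trans (cap y) (≤-reflexive (trans (cong (λ d → M - d * M) (𝟙-yes (y ≟ y) refl)) (eq M)))
      where
      eq : ∀ M → M - 1ℤ * M ≡ 0ℤ
      eq = solve-∀
    at-z : ∀ ν M α N → ν ≡ + 67 * N → 0ℤ ≡ + 2 * M * (M * (ν - α) - + 25 * N * M) + + 2 * (M * (M * (α - + 42 * N)))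
    at-z .(+ 67 * N) M α N refl = ring M α N
      where
      ring : ∀ M α N → 0ℤ ≡ + 2 * M * (M * (+ 67 * N - α) - + 25 * N * M) + + 2 * (M * (M * (α - + 42 * N)))
      ring = solve-∀
    elsewhere : ∀ ν M α N → ν ≡ + 67 * N → 0ℤ ≡ M * (M * (ν - α) - + 25 * N * M) + M * (M * (α - + 42 * N))
    elsewhere .(+ 67 * N) M α N refl = ring M α N
      where
      ring : ∀ M α N → 0ℤ ≡ M * (M * (+ 67 * N - α) - + 25 * N * M) + M * (M * (α - + 42 * N))
      ring = solve-∀
    expand : ∀ M U → (M * U + 0ℤ) * U ≡ M * (U * U) + + 67 * M * U * 0ℤ
    expand = solve-∀

  -- The factors 6 and 18 turn the dependence on α = `size y` of a heavy colour into minus the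
  -- square of 6α - 201N - 2(n - h). The constant 18669 is 3 · 67² + 18 · 17², as the light case
  -- requires, and 150 is six times the 25 of `removed-pairs`.
  pair-bound : ∀ K {s} → Weights 1ℤ 0ℤ s → (∀ v → s v ≤ 1ℤ - pairRemoval K v) →
    sum s ≤ + n → + 99 * N ≤ + 2 * sum s →
    + 6 * value 1ℤ 0ℤ s + + 18 * gain K ≤ + 6 * (sum s * sum s) +
      (kept K * (+ 18669 * N * N + + 4 * ((+ n - sum s) * (+ n - sum s))) + (1ℤ - kept K) * (+ 150 * N * N))
  pair-bound (light small) {s} W _ h≤n _ = ≤-by _
    (0≤+ {3} ⊗ diff (Pairs.light-pairs P W small h≤n) ⊕ 0≤+ {4} ⊗ square≥0 (+ n - sum s))
    (eq (+ n) N (value 1ℤ 0ℤ s) (sum s) n≡)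
    where
    eq : ∀ ν N v h → ν ≡ + 67 * N →
      + 6 * (h * h) + (1ℤ * (+ 18669 * N * N + + 4 * ((ν - h) * (ν - h))) + (1ℤ - 1ℤ) * (+ 150 * N * N)) ≡
      + 6 * v + + 18 * (+ 289 * N * N) + (+ 3 * (+ 2 * (h * h) + ν * ν - + 2 * v) + + 4 * ((ν - h) * (ν - h)))
    eq .(+ 67 * N) N v h refl = ring N v h
      where
      ring : ∀ N v h →
        + 6 * (h * h) + (1ℤ * (+ 18669 * N * N + + 4 * ((+ 67 * N - h) * (+ 67 * N - h))) + (1ℤ - 1ℤ) * (+ 150 * N * N)) ≡
        + 6 * v + + 18 * (+ 289 * N * N) + (+ 3 * (+ 2 * (h * h) + + 67 * N * (+ 67 * N) - + 2 * v) +
          + 4 * ((+ 67 * N - h) * (+ 67 * N - h)))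
      ring = solve-∀
  pair-bound (heavy y z (_ , half , _) _) {s} W _ h≤n _ = ≤-by _
    (0≤+ {6} ⊗ diff (Pairs.heavy-pairs P W y 0<size half h≤n)
      ⊕ square≥0 (+ 6 * size y - + 201 * N - + 2 * (+ n - sum s)))
    (eq (+ n) N (value 1ℤ 0ℤ s) (sum s) (size y) n≡)
    where
    0<size : 0ℤ < size y
    0<size with size y ≤? 0ℤ
    ... | no ≰0  = ≰⇒> ≰0
    ... | yes ≤0 = ⊥-elim (<⇒≱ (+<+ (from-yes (0 ℕ.<? 67))) (≤-trans (*-monoˡ (+ 67) 0≤+ 1≤N)
      (≤-trans (≤-reflexive (sym n≡)) (≤-trans half (*-monoˡ (+ 2) 0≤+ ≤0)))))
    eq : ∀ ν N v h α → ν ≡ + 67 * N →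
      + 6 * (h * h) + (1ℤ * (+ 18669 * N * N + + 4 * ((ν - h) * (ν - h))) + (1ℤ - 1ℤ) * (+ 150 * N * N)) ≡
      + 6 * v + + 18 * (+ 4 * ((α - + 25 * N) * (+ 42 * N - α))) +
      (+ 6 * (h * h + + 2 * (α * α) - + 2 * ((h - α) * (+ 2 * α - ν)) - v) +
       (+ 6 * α - + 201 * N - + 2 * (ν - h)) * (+ 6 * α - + 201 * N - + 2 * (ν - h)))
    eq .(+ 67 * N) N v h α refl = ring N v h α
      where
      ring : ∀ N v h α →
        + 6 * (h * h) + (1ℤ * (+ 18669 * N * N + + 4 * ((+ 67 * N - h) * (+ 67 * N - h))) + (1ℤ - 1ℤ) * (+ 150 * N * N)) ≡
        + 6 * v + + 18 * (+ 4 * ((α - + 25 * N) * (+ 42 * N - α))) +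
        (+ 6 * (h * h + + 2 * (α * α) - + 2 * ((h - α) * (+ 2 * α - + 67 * N)) - v) +
         (+ 6 * α - + 201 * N - + 2 * (+ 67 * N - h)) * (+ 6 * α - + 201 * N - + 2 * (+ 67 * N - h)))
      ring = solve-∀
  pair-bound (huge y z _ ≥42) {s} W cap _ h≥ = ≤-by _
    (0≤+ {6} ⊗ diff (Pairs.removed-pairs P W y N≥0 removed small h≥) ⊕ ≤-reflexive (sym (vanish
      ((+ 18669 * N * N + + 4 * ((+ n - sum s) * (+ n - sum s))) - + 150 * N * N) refl refl)))
    (eq (value 1ℤ 0ℤ s) (sum s) N 0ℤ (+ 18669 * N * N + + 4 * ((+ n - sum s) * (+ n - sum s))) 0ℤ)
    where
    removed : s y ≡ 0ℤ
    removed = ≤-antisym (≤-trans (cap y) (≤-reflexive (cong (λ d → 1ℤ - d) (𝟙-yes (y ≟ y) refl)))) (Weights.s≥0 W y)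
    small : + n - size y ≤ + 25 * N
    small = ≤-trans (+-monoʳ-≤ (+ n) (neg-mono-≤ ≥42)) (≤-reflexive (trans (cong (_- + 42 * N) n≡) (eq′ N)))
      where
      eq′ : ∀ N → + 67 * N - + 42 * N ≡ + 25 * N
      eq′ = solve-∀
    vanish : ∀ {g κ} X → κ ≡ 0ℤ → g ≡ 0ℤ → κ * X - + 18 * g ≡ 0ℤ
    vanish X refl refl = refl
    eq : ∀ v h N κ X g → + 6 * (h * h) + (κ * X + (1ℤ - κ) * (+ 150 * N * N)) ≡
      + 6 * v + + 18 * g + (+ 6 * (h * h + + 25 * (N * N) - v) + (κ * (X - + 150 * N * N) - + 18 * g))
    eq = solve-∀

-- Counting over all colours

∑-∑³ : (f : Fin k → Fin n → Fin n → Fin n → ℤ) →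
       sum (λ c → ∑³ (f c)) ≡ ∑³ (λ x y z → sum λ c → f c x y z)
∑-∑³ f = trans (∑-comm (λ c x → sum λ y → sum λ z → f c x y z)) (∑-cong λ x →
  trans (∑-comm (λ c y → sum λ z → f c x y z)) (∑-cong λ y → ∑-comm (λ c z → f c x y z)))

∑³-product : (f g h : Fin n → ℤ) → ∑³ (λ x y z → f x * (g y * h z)) ≡ sum f * (sum g * sum h)
∑³-product f g h = trans
  (∑-cong λ x → trans (∑-cong λ y → ∑-*ˡ (f x) (λ z → g y * h z)) (∑-*ˡ (f x) (λ y → sum λ z → g y * h z)))
  (trans (∑-*ʳ (sum λ y → sum λ z → g y * h z) f) (cong (sum f *_) (∑∑-* g h)))

module ColourClasses (χ : TripleColouring n k) (avoids : ¬ HasMonoMessyPath χ) where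

  class : Fin k → Hypergraph n
  class c = record
    { E        = λ x y z → (x ≢ y × y ≢ z × x ≢ z) × colour χ x y z ≡ c
    ; E?       = λ x y z → (¬? (x ≟ y) ×-dec ¬? (y ≟ z) ×-dec ¬? (x ≟ z)) ×-dec (colour χ x y z ≟ c)
    ; flip₁₂   = λ {x} {y} {z} ((xy , yz , xz) , e) →
                   ((xy ∘ sym) , xz , yz) , trans (sym (swap₁₂ χ x y z)) e
    ; flip₂₃   = λ {x} {y} {z} ((xy , yz , xz) , e) →
                   (xz , (yz ∘ sym) , xy) , trans (sym (swap₂₃ χ x y z)) e
    ; distinct = λ ((xy , _) , _) → xy
    }

  class-free : ∀ c → Hypergraph.MessyFree (class c)
  class-free c {a} {b} {c′} {d} {e} {f} ((ab , bc , ac) , abc) ((_ , cd , bd) , bcd) ((de , ef , df) , def) ad e∉ f∉ =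
    avoids (c , a , b , c′ , d , e , f ,
      ( ab , ac , ad , (λ p → e∉ (here (sym p))) , (λ p → f∉ (here (sym p)))
      , bc , bd , (λ p → e∉ (there (here (sym p)))) , (λ p → f∉ (there (here (sym p))))
      , cd , (λ p → e∉ (there (there (here (sym p))))) , (λ p → f∉ (there (there (here (sym p)))))
      , de , df , ef) , abc , bcd , def)

  profile : Fin k → Profile n
  profile c = proj₁ (messyFree-bound (class c) (class-free c))

  module _ {M τ : ℤ} {s : Fin n → ℤ} (W : Weights M τ s) where
    open Weights W

    private
      w : Fin n → Fin n → Fin n → ℤ
      w = weight M τ s

      K : ℤ
      K = + 3 * (M * M * M)

      K≥0 : 0ℤ ≤ K
      K≥0 = 0≤+ {3} ⊗ (M≥0 ⊗ M≥0) ⊗ M≥0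

      coincide : Fin n → Fin n → Fin n → ℤ
      coincide x y z = 𝟙 (x ≟ y) + (𝟙 (y ≟ z) + 𝟙 (x ≟ z))

      edges : Fin n → Fin n → Fin n → ℤ
      edges x y z = sum λ c → Hypergraph.edge (class c) x y z

      coloured : ∀ x y z → w x y z ≤ w x y z * edges x y z + K * coincide x y z
      coloured x y z = cases (x ≟ y) (y ≟ z) (x ≟ z)
        where
        edges≥0 : 0ℤ ≤ edges x y z
        edges≥0 = ∑-nonneg λ c → 0≤𝟙 (Hypergraph.E? (class c) x y z)
        coincide≥0 : 0ℤ ≤ coincide x y z
        coincide≥0 = 0≤𝟙 (x ≟ y) ⊕ 0≤𝟙 (y ≟ z) ⊕ 0≤𝟙 (x ≟ z)
        degenerate : 1ℤ ≤ coincide x y z → w x y z ≤ w x y z * edges x y z + K * coincide x y z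
        degenerate 1≤ = ≤-trans (weight≤ x y z) (≤-by _ (weight≥0 x y z ⊗ edges≥0 ⊕ K≥0 ⊗ diff 1≤)
          (eq K (w x y z * edges x y z) (coincide x y z)))
          where
          eq : ∀ K e c → e + K * c ≡ K + (e + K * (c - 1ℤ))
          eq = solve-∀
        cases : Dec (x ≡ y) → Dec (y ≡ z) → Dec (x ≡ z) → w x y z ≤ w x y z * edges x y z + K * coincide x y z
        cases (yes p) _ _ = degenerate (≤-trans (≤-reflexive (sym (𝟙-yes (x ≟ y) p)))
          (≤-by _ (0≤𝟙 (y ≟ z) ⊕ 0≤𝟙 (x ≟ z)) refl))
        cases (no _) (yes p) _ = degenerate (≤-trans (≤-reflexive (sym (𝟙-yes (y ≟ z) p)))
          (≤-by _ (0≤𝟙 (x ≟ y) ⊕ 0≤𝟙 (x ≟ z)) (eq (𝟙 (x ≟ y)) (𝟙 (y ≟ z)) (𝟙 (x ≟ z)))))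
          where
          eq : ∀ a b c → a + (b + c) ≡ b + (a + c)
          eq = solve-∀
        cases (no _) (no _) (yes p) = degenerate (≤-trans (≤-reflexive (sym (𝟙-yes (x ≟ z) p)))
          (≤-by _ (0≤𝟙 (x ≟ y) ⊕ 0≤𝟙 (y ≟ z)) (eq (𝟙 (x ≟ y)) (𝟙 (y ≟ z)) (𝟙 (x ≟ z)))))
          where
          eq : ∀ a b c → a + (b + c) ≡ c + (a + b)
          eq = solve-∀
        cases (no xy) (no yz) (no xz) = ≤-by _ (weight≥0 x y z ⊗ diff one ⊕ K≥0 ⊗ coincide≥0)
          (eq (w x y z) (edges x y z) (K * coincide x y z))
          where
          one : 1ℤ ≤ edges x y z
          one = ≤-trans (≤-reflexive (sym (𝟙-yes (Hypergraph.E? (class (colour χ x y z)) x y z) ((xy , yz , xz) , refl))))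
            (term≤∑ (λ c → 0≤𝟙 (Hypergraph.E? (class c) x y z)) (colour χ x y z))
          eq : ∀ w e c → w * e + c ≡ w + (w * (e - 1ℤ) + c)
          eq = solve-∀

      ∑-coincide : ∑³ coincide ≡ + 3 * (+ n * + n)
      ∑-coincide = trans (∑³-+ {n} (λ x y z → 𝟙 (x ≟ y)) (λ x y z → 𝟙 (y ≟ z) + 𝟙 (x ≟ z)))
        (trans (cong₂ _+_ first (trans (∑³-+ {n} (λ x y z → 𝟙 (y ≟ z)) (λ x y z → 𝟙 (x ≟ z))) (cong₂ _+_ second third)))
          (triple (+ n * + n)))
        where
        triple : ∀ a → a + (a + a) ≡ + 3 * a
        triple = solve-∀
        ones : sum {n} (λ _ → + n * 1ℤ) ≡ + n * + n
        ones = trans (∑-const n (+ n * 1ℤ)) (cong (+ n *_) (*-identityʳ (+ n)))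
        second : ∑³ {n} (λ x y z → 𝟙 (y ≟ z)) ≡ + n * + n
        second = trans (∑-cong {n} λ x → trans (∑-cong {n} λ y → ∑-𝟙 y) (∑-const n 1ℤ)) ones
        third : ∑³ {n} (λ x y z → 𝟙 (x ≟ z)) ≡ + n * + n
        third = trans (∑-cong {n} λ x → trans (∑-cong {n} λ y → ∑-𝟙 x) (∑-const n 1ℤ)) ones
        first : ∑³ {n} (λ x y z → 𝟙 (x ≟ y)) ≡ + n * + n
        first = trans (∑-cong {n} λ x → ∑-comm {n} {n} (λ y z → 𝟙 (x ≟ y))) third

      ∑-weight : ∑³ w ≡ + 3 * M * (sum s * sum s) * + n - τ * (sum s * sum s * sum s)
      ∑-weight = trans (∑³-cong λ x y z → expand M τ (s x) (s y) (s z))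
        (trans (∑³-+ (λ x y z → M * (f x y z + (g x y z + h x y z))) (λ x y z → - τ * t x y z))
          (trans (cong₂ _+_
              (trans (∑³-*ˡ M (λ x y z → f x y z + (g x y z + h x y z)))
                (cong (M *_) (trans (∑³-+ f (λ x y z → g x y z + h x y z))
                  (cong₂ _+_ (∑³-product s s one) (trans (∑³-+ g h) (cong₂ _+_ (∑³-product one s s) (∑³-product s one s)))))))
              (trans (∑³-*ˡ (- τ) t) (cong (- τ *_) (∑³-product s s s))))
            (trans (cong (λ m → M * (sum s * (sum s * m) + (m * (sum s * sum s) + sum s * (m * sum s))) +
                                - τ * (sum s * (sum s * sum s))) (trans (∑-const n 1ℤ) (*-identityʳ (+ n))))
              (collect M τ (sum s) (+ n)))))
        where
        one : Fin n → ℤ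
        one _ = 1ℤ
        f g h t : Fin n → Fin n → Fin n → ℤ
        f x y z = s x * (s y * one z)
        g x y z = one x * (s y * s z)
        h x y z = s x * (one y * s z)
        t x y z = s x * (s y * s z)
        expand : ∀ M τ x y z → M * (x * y + y * z + x * z) - τ * (x * y * z) ≡
          M * (x * (y * 1ℤ) + (1ℤ * (y * z) + x * (1ℤ * z))) + - τ * (x * (y * z))
        expand = solve-∀
        collect : ∀ M τ σ ν → M * (σ * (σ * ν) + (ν * (σ * σ) + σ * (ν * σ))) + - τ * (σ * (σ * σ)) ≡
          + 3 * M * (σ * σ) * ν - τ * (σ * σ * σ)
        collect = solve-∀

    -- A triple of distinct vertices lies in the class of its colour. At most 3n² ordered triples
    -- have a repeated entry, each of weight at most 3M³, and each of the k classes adds the error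
    -- 216nM³.
    weighted-count : + 3 * M * (sum s * sum s) * + n - τ * (sum s * sum s * sum s) ≤
      + 3 * sum (λ c → Profile.value (profile c) M τ s) + (+ 216 * (+ n * + k) + + 9 * (+ n * + n)) * (M * M * M)
    weighted-count = begin
      + 3 * M * (sum s * sum s) * + n - τ * (sum s * sum s * sum s)
        ≡⟨ sym ∑-weight ⟩
      ∑³ w
        ≤⟨ ∑³-mono coloured ⟩
      ∑³ (λ x y z → w x y z * edges x y z + K * coincide x y z)
        ≡⟨ ∑³-+ (λ x y z → w x y z * edges x y z) (λ x y z → K * coincide x y z) ⟩
      ∑³ (λ x y z → w x y z * edges x y z) + ∑³ (λ x y z → K * coincide x y z)
        ≡⟨ cong₂ _+_ (trans (∑³-cong λ x y z → sym (∑-*ˡ (w x y z) (λ c → Hypergraph.edge (class c) x y z)))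
                            (sym (∑-∑³ (λ c x y z → w x y z * Hypergraph.edge (class c) x y z))))
                     (trans (∑³-*ˡ K coincide) (cong (K *_) ∑-coincide)) ⟩
      sum (λ c → ∑³ (λ x y z → w x y z * Hypergraph.edge (class c) x y z)) + K * (+ 3 * (+ n * + n))
        ≤⟨ +-monoˡ-≤ (K * (+ 3 * (+ n * + n))) (∑-mono λ c → proj₂ (messyFree-bound (class c) (class-free c)) W) ⟩
      sum (λ c → + 3 * Profile.value (profile c) M τ s + + 216 * + n * (M * M * M)) + K * (+ 3 * (+ n * + n))
        ≡⟨ cong (_+ K * (+ 3 * (+ n * + n))) (trans
             (∑-+ (λ c → + 3 * Profile.value (profile c) M τ s) (λ _ → + 216 * + n * (M * M * M)))
             (cong₂ _+_ (∑-*ˡ (+ 3) (λ c → Profile.value (profile c) M τ s)) (∑-const k (+ 216 * + n * (M * M * M))))) ⟩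
      + 3 * V + + k * (+ 216 * + n * (M * M * M)) + K * (+ 3 * (+ n * + n))
        ≡⟨ collect V (+ n) (+ k) (M * M * M) ⟩
      + 3 * V + (+ 216 * (+ n * + k) + + 9 * (+ n * + n)) * (M * M * M) ∎
      where
      open ≤-Reasoning
      V : ℤ
      V = sum (λ c → Profile.value (profile c) M τ s)
      collect : ∀ V n k m → + 3 * V + k * (+ 216 * n * m) + + 3 * m * (+ 3 * (n * n)) ≡
        + 3 * V + (+ 216 * (n * k) + + 9 * (n * n)) * m
      collect = solve-∀

-- Combining the two counts

*-cancelˡ-≤ : ∀ {a b} c → 0ℤ < c → c * a ≤ c * b → a ≤ b
*-cancelˡ-≤ {a} {b} c 0<c = *-cancelˡ-≤-pos a b c {{positive 0<c}}

0<* : ∀ {a b} → 0ℤ < a → 0ℤ < b → 0ℤ < a * b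
0<* {a} {b} 0<a 0<b = ≤-<-trans (≤-reflexive (sym (*-zeroʳ a))) (*-monoˡ-<-pos a {{positive 0<a}} 0<b)

-- With u = 25N = n - k and U = uM, removing the k shares MU² three times leaves M³u²(3n - 2u - 3k)
-- = M³u³ on the left. Thus the gains must make up for u³M³; the common factors 25NM² and 67 are
-- cancelled.
triple-arithmetic : ∀ {M N ν κ G V} → 0ℤ < N → ν ≡ + 67 * N → κ ≡ + 42 * N → M ≡ + 34 * ν →
  + 3 * M * (+ 25 * N * M * (+ 25 * N * M)) * ν - + 2 * (+ 25 * N * M * (+ 25 * N * M) * (+ 25 * N * M)) ≤
    + 3 * V + (+ 216 * (ν * κ) + + 9 * (ν * ν)) * (M * M * M) →
  V ≤ κ * (M * (+ 25 * N * M * (+ 25 * N * M))) + + 67 * M * (+ 25 * N * M) * G →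
  + 21250 * N * N * N ≤ + 3 * G + + 881586 * N * N
triple-arithmetic {M} {N} {G = G} {V} 0<N refl refl M≡ count V≤ = *-cancelˡ-≤ (+ 67) (+<+ (ℕ.s≤s ℕ.z≤n))
  (subst (λ X → X ≤ + 67 * (+ 3 * G + + 881586 * N * N)) (left N M M≡)
    (≤-trans per-U (≤-reflexive (right N M G M≡))))
  where
  0<M : 0ℤ < M
  0<M = <-≤-trans (0<* {+ 34} (+<+ (ℕ.s≤s ℕ.z≤n)) (0<* {+ 67} (+<+ (ℕ.s≤s ℕ.z≤n)) 0<N)) (≤-reflexive (sym M≡))
  left : ∀ N M → M ≡ + 34 * (+ 67 * N) → + 625 * N * N * M ≡ + 67 * (+ 21250 * N * N * N)
  left N .(+ 34 * (+ 67 * N)) refl = ring N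
    where
    ring : ∀ N → + 625 * N * N * (+ 34 * (+ 67 * N)) ≡ + 67 * (+ 21250 * N * N * N)
    ring = solve-∀
  right : ∀ N M G → M ≡ + 34 * (+ 67 * N) →
    + 201 * G + + 25929 * N * M ≡ + 67 * (+ 3 * G + + 881586 * N * N)
  right N .(+ 34 * (+ 67 * N)) G refl = ring N G
    where
    ring : ∀ N G → + 201 * G + + 25929 * N * (+ 34 * (+ 67 * N)) ≡ + 67 * (+ 3 * G + + 881586 * N * N)
    ring = solve-∀
  per-U : + 625 * N * N * M ≤ + 201 * G + + 25929 * N * M
  per-U = *-cancelˡ-≤ (+ 25 * (N * (M * M))) (0<* {+ 25} (+<+ (ℕ.s≤s ℕ.z≤n)) (0<* 0<N (0<* 0<M 0<M)))
    (≤-by _ (diff count ⊕ 0≤+ {3} ⊗ diff V≤) (eq N M G V))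
    where
    eq : ∀ N M G V → + 25 * (N * (M * M)) * (+ 201 * G + + 25929 * N * M) ≡
      + 25 * (N * (M * M)) * (+ 625 * N * N * M) +
      (+ 3 * V + (+ 216 * (+ 67 * N * (+ 42 * N)) + + 9 * (+ 67 * N * (+ 67 * N))) * (M * M * M) -
        (+ 3 * M * (+ 25 * N * M * (+ 25 * N * M)) * (+ 67 * N) - + 2 * (+ 25 * N * M * (+ 25 * N * M) * (+ 25 * N * M))) +
       + 3 * (+ 42 * N * (M * (+ 25 * N * M * (+ 25 * N * M))) + + 67 * M * (+ 25 * N * M) * G - V))
    eq = solve-∀

-- Adding 6 times `triples`, 2 times `pairs` and `combined` cancels `G` and `V`. The cubic in `m`
-- that remains is almost tight near m = 29N, whence the square of m - 29N.
final-arithmetic : ∀ {N ν κ G V m} → 0ℤ ≤ N → ν ≡ + 67 * N → κ ≡ + 42 * N → 0ℤ ≤ m → m ≤ κ →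
  + 21250 * N * N * N ≤ + 3 * G + + 881586 * N * N →
  + 3 * ((+ 25 * N + m) * (+ 25 * N + m)) * ν ≤ + 3 * V + (+ 216 * (ν * κ) + + 9 * (ν * ν)) →
  + 6 * V + + 18 * G ≤ κ * (+ 6 * ((+ 25 * N + m) * (+ 25 * N + m))) +
    (m * (+ 18669 * N * N + + 4 * ((ν - (+ 25 * N + m)) * (ν - (+ 25 * N + m)))) + (κ - m) * (+ 150 * N * N)) →
  + 1336 * N * N * N ≤ + 6585966 * N * N
final-arithmetic {N} {G = G} {V} {m} N≥0 refl refl m≥0 m≤κ triples pairs combined = ≤-by _
  (0≤+ {6} ⊗ diff triples ⊕ 0≤+ {2} ⊗ diff pairs ⊕ diff combined
    ⊕ square≥0 (m - + 29 * N) ⊗ (0≤+ {4} ⊗ diff m≤κ ⊕ 0≤+ {86} ⊗ N≥0) ⊕ 0≤+ {21} ⊗ m≥0 ⊗ N≥0 ⊗ N≥0)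
  (eq N G V m)
  where
  eq : ∀ N G V m → + 6585966 * N * N ≡ + 1336 * N * N * N +
    (+ 6 * (+ 3 * G + + 881586 * N * N - + 21250 * N * N * N) +
     (+ 2 * (+ 3 * V + (+ 216 * (+ 67 * N * (+ 42 * N)) + + 9 * (+ 67 * N * (+ 67 * N))) -
       + 3 * ((+ 25 * N + m) * (+ 25 * N + m)) * (+ 67 * N)) +
     (+ 42 * N * (+ 6 * ((+ 25 * N + m) * (+ 25 * N + m))) +
       (m * (+ 18669 * N * N + + 4 * ((+ 67 * N - (+ 25 * N + m)) * (+ 67 * N - (+ 25 * N + m)))) +
        (+ 42 * N - m) * (+ 150 * N * N)) - (+ 6 * V + + 18 * G) +
     ((m - + 29 * N) * (m - + 29 * N) * (+ 4 * (+ 42 * N - m) + + 86 * N) + + 21 * (m * (N * N))))))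
  eq = solve-∀

-- The contradiction for 67N vertices and 42N colours

module _ {n k : ℕ} (N : ℤ) (large : + 110000 ≤ N) (n≡ : + n ≡ + 67 * N) (k≡ : + k ≡ + 42 * N)
         (another : ∀ (y : Fin n) → ∃[ z ] y ≢ z) (χ : TripleColouring n k) (avoids : ¬ HasMonoMessyPath χ) where

  open ColourClasses χ avoids

  impossible : ⊥
  -- The scale is 34n = 2278N = 134 · 17N, a multiple of both n and 17N = (42 - 25)N, so that the
  -- light and heavy caps are integral.
  impossible = contradict (+ 34 * + n) refl
    where
    contradict : ∀ M → M ≡ + 34 * + n → ⊥
    contradict M M≡ = <⇒≱ (+<+ (from-yes (6585966 ℕ.<? 1336 ℕ.* 110000)))
      (≤-trans (*-monoˡ (+ 1336) 0≤+ large)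
        (*-cancelˡ-≤ (N * N) (0<* 0<N 0<N) (≤-trans (≤-reflexive (assoc N (+ 1336))) (≤-trans
          (final-arithmetic {N} {+ n} {+ k} {G} {V} {m} N≥0 n≡ k≡ m≥0 m≤k triples pairs combined) (≤-reflexive (commute N (+ 6585966)))))))
      where
      assoc : ∀ N c → N * N * (c * N) ≡ c * N * N * N
      assoc = solve-∀
      commute : ∀ N c → c * N * N ≡ N * N * c
      commute = solve-∀

      0<N : 0ℤ < N
      0<N = <-≤-trans (+<+ (ℕ.s≤s ℕ.z≤n)) large

      N≥0 : 0ℤ ≤ N
      N≥0 = <⇒≤ 0<N

      M≥0 : 0ℤ ≤ M
      M≥0 = ≤-trans (0≤+ {34} ⊗ 0≤+ {n}) (≤-reflexive (sym M≡))

      kinds : ∀ c → Kind (profile c) N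
      kinds c = kind (profile c) N another

      module B (c : Fin k) =
        KindBounds (profile c) N M (≤-trans (+≤+ (ℕ.s≤s ℕ.z≤n)) large) n≡ M≡

      keep g : Fin k → ℤ
      keep c = B.kept c (kinds c)
      g c = B.gain c (kinds c)

      m G : ℤ
      m = sum keep
      G = sum g

      m≥0 : 0ℤ ≤ m
      m≥0 = ∑-nonneg λ c → B.kept≥0 c (kinds c)

      m≤k : m ≤ + k
      m≤k = ≤-trans (∑-const≤ 1ℤ λ c → B.kept≤1 c (kinds c)) (≤-reflexive (*-identityʳ (+ k)))

      -- Every colour removes at most M, so out of nM at least (n - k)M = 25NM remains.
      tripleWeights = capped-weights {T = + 25 * N * M} (λ c → B.tripleRemoval c (kinds c)) (λ _ → M) M≥0
        ((0≤+ {25} ⊗ N≥0) ⊗ M≥0)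
        (λ c → B.tripleRemoval≥0 c (kinds c)) (λ c → B.tripleRemoval≤ c (kinds c))
        (λ c → B.∑-tripleRemoval≤ c (kinds c))
        (≤-reflexive (trans (cong (λ t → + 25 * N * M + t) (∑-const k M)) (room (+ n) (+ k) N M n≡ k≡)))
        where
        room : ∀ ν κ N M → ν ≡ + 67 * N → κ ≡ + 42 * N → + 25 * N * M + κ * M ≡ ν * M
        room .(+ 67 * N) .(+ 42 * N) N M refl refl = ring N M
          where
          ring : ∀ N M → + 25 * N * M + + 42 * N * M ≡ + 67 * N * M
          ring = solve-∀

      triples : + 21250 * N * N * N ≤ + 3 * G + + 881586 * N * N
      triples = triple-arithmetic {M} {N} {+ n} {+ k} {G} {V} 0<N n≡ k≡ M≡ count V≤
        where
        s : Fin n → ℤ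
        s = proj₁ tripleWeights
        ∑s : sum s ≡ + 25 * N * M
        ∑s = proj₂ (proj₂ (proj₂ (proj₂ tripleWeights)))
        W : Weights M (+ 2) s
        W = record
          { s≥0 = proj₁ (proj₂ tripleWeights) ; s≤M = proj₁ (proj₂ (proj₂ tripleWeights))
          ; M≥0 = M≥0 ; τ≥0 = 0≤+ ; τ≤2 = ≤-refl }
        V : ℤ
        V = sum (λ c → Profile.value (profile c) M (+ 2) s)
        count : + 3 * M * (+ 25 * N * M * (+ 25 * N * M)) * + n - + 2 * (+ 25 * N * M * (+ 25 * N * M) * (+ 25 * N * M)) ≤
                + 3 * V + (+ 216 * (+ n * + k) + + 9 * (+ n * + n)) * (M * M * M)
        count = subst (λ U → + 3 * M * (U * U) * + n - + 2 * (U * U * U) ≤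
                + 3 * V + (+ 216 * (+ n * + k) + + 9 * (+ n * + n)) * (M * M * M)) ∑s (weighted-count W)
        V≤ : V ≤ + k * (M * (+ 25 * N * M * (+ 25 * N * M))) + + 67 * M * (+ 25 * N * M) * G
        V≤ = subst (λ U → V ≤ + k * (M * (U * U)) + + 67 * M * U * G) ∑s (≤-trans
          (∑-mono λ c → B.triple-bound c (kinds c) W (proj₁ (proj₂ (proj₂ (proj₂ tripleWeights))) c) ∑s)
          (≤-reflexive (trans (∑-+ (λ _ → M * (sum s * sum s)) (λ c → + 67 * M * sum s * g c))
            (cong₂ _+_ (∑-const k (M * (sum s * sum s))) (∑-*ˡ (+ 67 * M * sum s) g)))))

      -- This gives 2h ≥ 99N for `removed-pairs`. A colour that is not huge gains at most 289N², and
      -- 2 · 21250 exceeds 867 · 49 by 17; hence 17N³ has to absorb the error 2 · 881586N², which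
      -- determines the order of the bound on `N`.
      49N≤2m : + 49 * N ≤ + 2 * m
      49N≤2m = *-cancelˡ-≤ (+ 867 * N * N) (0<* (0<* {+ 867} (+<+ (ℕ.s≤s ℕ.z≤n)) 0<N) 0<N) (≤-by _
        (0≤+ {2} ⊗ diff triples ⊕ 0≤+ {6} ⊗ diff G≤ ⊕ (0≤+ {17} ⊗ diff large ⊕ 0≤+ {106828}) ⊗ N≥0 ⊗ N≥0)
        (eq N G m))
        where
        G≤ : G ≤ + 289 * N * N * m
        G≤ = ≤-trans (∑-mono λ c → B.gain≤ c (kinds c)) (≤-reflexive (∑-*ˡ (+ 289 * N * N) keep))
        eq : ∀ N G m → + 867 * N * N * (+ 2 * m) ≡ + 867 * N * N * (+ 49 * N) +
          (+ 2 * (+ 3 * G + + 881586 * N * N - + 21250 * N * N * N) +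
           (+ 6 * (+ 289 * N * N * m - G) + (+ 17 * (N - + 110000) + + 106828) * (N * N)))
        eq = solve-∀

      ∑-removed : sum (λ c → 1ℤ - keep c) ≡ + k - m
      ∑-removed = trans (∑-+ (λ _ → 1ℤ) (λ c → - keep c)) (cong₂ _+_ (trans (∑-const k 1ℤ) (*-identityʳ (+ k)))
        (trans (∑-cong λ c → negate (keep c)) (trans (∑-*ˡ -1ℤ keep) (sym (negate m)))))
        where
        negate : ∀ a → - a ≡ -1ℤ * a
        negate = solve-∀

      -- Each of the k - m huge colours excludes one centre, and n - (k - m) = 25N + m vertices
      -- remain.
      h : ℤ
      h = + 25 * N + m

      h≤n : h ≤ + n
      h≤n = ≤-trans (+-monoʳ-≤ (+ 25 * N) (≤-trans m≤k (≤-reflexive k≡))) (≤-reflexive (trans (eq N) (sym n≡)))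
        where
        eq : ∀ N → + 25 * N + + 42 * N ≡ + 67 * N
        eq = solve-∀

      pairWeights = capped-weights {M = 1ℤ} {T = h} (λ c → B.pairRemoval c (kinds c)) (λ c → 1ℤ - keep c) 0≤+
        (0≤+ {25} ⊗ N≥0 ⊕ m≥0)
        (λ c → B.pairRemoval≥0 c (kinds c)) (λ c → B.pairRemoval≤ c (kinds c))
        (λ c → B.∑-pairRemoval≤ c (kinds c))
        (≤-reflexive (trans (cong (λ t → h + t) ∑-removed) (room (+ n) (+ k) N m n≡ k≡)))
        where
        room : ∀ ν κ N m → ν ≡ + 67 * N → κ ≡ + 42 * N → + 25 * N + m + (κ - m) ≡ ν * 1ℤ
        room .(+ 67 * N) .(+ 42 * N) N m refl refl = ring N m
          where
          ring : ∀ N m → + 25 * N + m + (+ 42 * N - m) ≡ + 67 * N * 1ℤ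
          ring = solve-∀

      s : Fin n → ℤ
      s = proj₁ pairWeights

      ∑s : sum s ≡ h
      ∑s = proj₂ (proj₂ (proj₂ (proj₂ pairWeights)))

      W : Weights 1ℤ 0ℤ s
      W = record
        { s≥0 = proj₁ (proj₂ pairWeights) ; s≤M = proj₁ (proj₂ (proj₂ pairWeights))
        ; M≥0 = 0≤+ ; τ≥0 = ≤-refl ; τ≤2 = 0≤+ }

      v : Fin k → ℤ
      v c = Profile.value (profile c) 1ℤ 0ℤ s

      V : ℤ
      V = sum v

      pairs : + 3 * ((+ 25 * N + m) * (+ 25 * N + m)) * + n ≤ + 3 * V + (+ 216 * (+ n * + k) + + 9 * (+ n * + n))
      pairs = subst (λ U → + 3 * (U * U) * + n ≤ + 3 * V + (+ 216 * (+ n * + k) + + 9 * (+ n * + n))) ∑s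
        (≤-trans (≤-reflexive (sym lhs)) (≤-trans (weighted-count W) (≤-reflexive rhs)))
        where
        lhs : + 3 * 1ℤ * (sum s * sum s) * + n - 0ℤ * (sum s * sum s * sum s) ≡ + 3 * (sum s * sum s) * + n
        lhs = trans (cong (λ t → + 3 * 1ℤ * (sum s * sum s) * + n - t) (*-zeroˡ (sum s * sum s * sum s)))
          (+-identityʳ (+ 3 * 1ℤ * (sum s * sum s) * + n))
        rhs : + 3 * V + (+ 216 * (+ n * + k) + + 9 * (+ n * + n)) * (1ℤ * 1ℤ * 1ℤ) ≡
              + 3 * V + (+ 216 * (+ n * + k) + + 9 * (+ n * + n))
        rhs = cong (λ t → + 3 * V + t) (*-identityʳ (+ 216 * (+ n * + k) + + 9 * (+ n * + n)))

      combined : + 6 * V + + 18 * G ≤ + k * (+ 6 * ((+ 25 * N + m) * (+ 25 * N + m))) +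
        (m * (+ 18669 * N * N + + 4 * ((+ n - (+ 25 * N + m)) * (+ n - (+ 25 * N + m)))) + (+ k - m) * (+ 150 * N * N))
      combined = begin
        + 6 * V + + 18 * G
          ≡⟨ sym (trans (∑-+ (λ c → + 6 * v c) (λ c → + 18 * g c)) (cong₂ _+_ (∑-*ˡ (+ 6) v) (∑-*ˡ (+ 18) g))) ⟩
        sum (λ c → + 6 * v c + + 18 * g c)
          ≤⟨ ∑-mono (λ c → B.pair-bound c (kinds c) W (proj₁ (proj₂ (proj₂ (proj₂ pairWeights))) c)
               (≤-trans (≤-reflexive ∑s) h≤n)
               (≤-trans (≤-by _ (diff 49N≤2m) (eq N m)) (≤-reflexive (cong (+ 2 *_) (sym ∑s))))) ⟩
        sum (λ c → X + (keep c * Y + (1ℤ - keep c) * Z))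
          ≡⟨ trans (∑-+ (λ _ → X) (λ c → keep c * Y + (1ℤ - keep c) * Z)) (cong₂ _+_ (∑-const k X)
               (trans (∑-+ (λ c → keep c * Y) (λ c → (1ℤ - keep c) * Z))
                 (cong₂ _+_ (∑-*ʳ Y keep) (trans (∑-*ʳ Z (λ c → 1ℤ - keep c)) (cong (_* Z) ∑-removed))))) ⟩
        + k * X + (m * Y + (+ k - m) * Z)
          ≡⟨ cong (λ U → + k * (+ 6 * (U * U)) +
               (m * (+ 18669 * N * N + + 4 * ((+ n - U) * (+ n - U))) + (+ k - m) * (+ 150 * N * N))) ∑s ⟩
        + k * (+ 6 * (h * h)) + (m * (+ 18669 * N * N + + 4 * ((+ n - h) * (+ n - h))) + (+ k - m) * (+ 150 * N * N)) ∎
        where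
        open ≤-Reasoning
        X Y Z : ℤ
        X = + 6 * (sum s * sum s)
        Y = + 18669 * N * N + + 4 * ((+ n - sum s) * (+ n - sum s))
        Z = + 150 * N * N
        eq : ∀ N m → + 2 * (+ 25 * N + m) ≡ + 99 * N + (+ 2 * m - + 49 * N)
        eq = solve-∀

-- From the counts to the Ramsey number

another : ∀ {n} → 2 ℕ.≤ n → (y : Fin n) → ∃[ z ] y ≢ z
another {suc (suc n)} _ zero    = suc zero , λ ()
another {suc (suc n)} _ (suc y) = zero , λ ()
another {suc zero} (ℕ.s≤s ())

monoMessyPath? : ∀ {n k} (χ : TripleColouring n k) → Dec (HasMonoMessyPath χ)
monoMessyPath? χ =
  Finₚ.any? λ i → Finₚ.any? λ a → Finₚ.any? λ b → Finₚ.any? λ c → Finₚ.any? λ d → Finₚ.any? λ e → Finₚ.any? λ f →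
    ( ¬? (a ≟ b) ×-dec ¬? (a ≟ c) ×-dec ¬? (a ≟ d) ×-dec ¬? (a ≟ e) ×-dec ¬? (a ≟ f) ×-dec
      ¬? (b ≟ c) ×-dec ¬? (b ≟ d) ×-dec ¬? (b ≟ e) ×-dec ¬? (b ≟ f) ×-dec
      ¬? (c ≟ d) ×-dec ¬? (c ≟ e) ×-dec ¬? (c ≟ f) ×-dec
      ¬? (d ≟ e) ×-dec ¬? (d ≟ f) ×-dec ¬? (e ≟ f))
    ×-dec (colour χ a b c ≟ i) ×-dec (colour χ b c d ≟ i) ×-dec (colour χ d e f ≟ i)

module _ {n n′ k k′} (n′≤n : n′ ℕ.≤ n) (k≤k′ : k ℕ.≤ k′) (χ : TripleColouring n k) where

  private
    v : Fin n′ → Fin n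
    v x = inject≤ x n′≤n

    v-≢ : ∀ {x y} → x ≢ y → v x ≢ v y
    v-≢ x≢y = x≢y ∘ Finₚ.inject≤-injective n′≤n n′≤n _ _

  -- Besides restricting the vertices, this embeds the colours into a larger palette, which brings k
  -- ≤ 42N colours to exactly 42N.
  restrict : TripleColouring n′ k′
  restrict = record
    { colour = λ x y z → inject≤ (colour χ (v x) (v y) (v z)) k≤k′
    ; swap₁₂ = λ x y z → cong (λ c → inject≤ c k≤k′) (swap₁₂ χ (v x) (v y) (v z))
    ; swap₂₃ = λ x y z → cong (λ c → inject≤ c k≤k′) (swap₂₃ χ (v x) (v y) (v z))
    }

  extend-path : HasMonoMessyPath restrict → HasMonoMessyPath χ
  extend-path (i , a , b , c , d , e , f ,
    (ab , ac , ad , ae , af , bc , bd , be , bf , cd , ce , cf , de , df , ef) , abc , bcd , def) =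
    colour χ (v a) (v b) (v c) , v a , v b , v c , v d , v e , v f ,
    ( v-≢ ab , v-≢ ac , v-≢ ad , v-≢ ae , v-≢ af , v-≢ bc , v-≢ bd , v-≢ be , v-≢ bf
    , v-≢ cd , v-≢ ce , v-≢ cf , v-≢ de , v-≢ df , v-≢ ef) ,
    refl , Finₚ.inject≤-injective k≤k′ k≤k′ _ _ (trans bcd (sym abc)) ,
    Finₚ.inject≤-injective k≤k′ k≤k′ _ _ (trans def (sym abc))

arrows : ∀ N → 110000 ℕ.≤ N → ∀ {k} → k ℕ.≤ 42 ℕ.* N → Arrows k (67 ℕ.* N)
arrows N large {k} k≤ χ = extend-path ℕₚ.≤-refl k≤ χ
  -- The counting argument only refutes the absence of a path; a path is obtained because its
  -- existence is decided by finite search.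
  (decidable-stable (monoMessyPath? (restrict ℕₚ.≤-refl k≤ χ)) λ avoids →
    impossible (+ N) (ℤ.+≤+ large) (ℤₚ.pos-* 67 N) (ℤₚ.pos-* 42 N)
      (another (ℕₚ.≤-trans (ℕ.s≤s (ℕ.s≤s ℕ.z≤n)) (ℕₚ.*-monoʳ-≤ 67 (ℕₚ.≤-trans (ℕ.s≤s ℕ.z≤n) large))))
      (restrict ℕₚ.≤-refl k≤ χ) avoids)

-- Taking N = ⌊k/42⌋ + 1 gives 42r ≤ 67k + 2814 with 2814 = 67 · 42. As 42 · 761 exceeds 67 · 477 by
-- only 3, the error is absorbed once k ≥ 477 · 2814/3 = 447426. The larger bound on k ensures N ≥
-- 110000. The ratio satisfies 9 · 761/477 - 10 = 231/53.
ramsey-≤ : ∀ {k r} → k ≥ 5000000 → IsRamseyNumberMessyPath k r → 477 ℕ.* r ℕ.≤ 761 ℕ.* k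
ramsey-≤ {k} {r} k≥ (_ , minimal) with r ℕ.≤? 67 ℕ.* suc (k ℕ./ 42)
... | no r≰ = ⊥-elim (minimal (67 ℕ.* suc (k ℕ./ 42)) (ℕₚ.≰⇒> r≰) (arrows (suc (k ℕ./ 42)) N-large k≤42N))
  where
  N-large : 110000 ℕ.≤ suc (k ℕ./ 42)
  N-large = ℕₚ.m≤n⇒m≤1+n (ℕₚ.≤-trans (from-yes (110000 ℕ.≤? 5000000 ℕ./ 42)) (ℕ./-monoˡ-≤ 42 k≥))
  k≤42N : k ℕ.≤ 42 ℕ.* suc (k ℕ./ 42)
  k≤42N = ℕₚ.≤-trans (ℕₚ.≤-reflexive (ℕ.m≡m%n+[m/n]*n k 42))
    (ℕₚ.≤-trans (ℕₚ.+-monoˡ-≤ (k ℕ./ 42 ℕ.* 42) (ℕₚ.<⇒≤ (ℕ.m%n<n k 42)))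
                (ℕₚ.≤-reflexive (ℕₚ.*-comm (suc (k ℕ./ 42)) 42)))
... | yes r≤ = ℤₚ.drop‿+≤+ (subst₂ ℤ._≤_ (sym (ℤₚ.pos-* 477 r)) (sym (ℤₚ.pos-* 761 k))
  (*-cancelˡ-≤ (+ 42) (ℤ.+<+ (ℕ.s≤s ℕ.z≤n))
    (≤-by _ (0≤+ {477} ⊗ diff step ⊕ 0≤+ {3} ⊗ diff (ℤ.+≤+ (ℕₚ.≤-trans (from-yes (447426 ℕ.≤? 5000000)) k≥)))
      (eq₂ (+ r) (+ k)))))
  where
  N : ℤ
  N = + suc (k ℕ./ 42)
  r≤67N : + r ℤ.≤ + 67 ℤ.* N
  r≤67N = ℤₚ.≤-trans (ℤ.+≤+ r≤) (ℤₚ.≤-reflexive (ℤₚ.pos-* 67 (suc (k ℕ./ 42))))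
  42N≤ : + 42 ℤ.* N ℤ.≤ + k ℤ.+ + 42
  42N≤ = ℤₚ.≤-trans (ℤₚ.≤-reflexive (sym (ℤₚ.pos-* 42 (suc (k ℕ./ 42))))) (ℤ.+≤+ (ℕₚ.≤-trans
    (ℕₚ.≤-reflexive (trans (ℕₚ.*-comm 42 (suc (k ℕ./ 42))) (ℕₚ.+-comm 42 (k ℕ./ 42 ℕ.* 42))))
    (ℕₚ.+-monoˡ-≤ 42 (ℕ.m/n*n≤m k 42))))
  eq₁ : ∀ r k N → + 67 ℤ.* k ℤ.+ + 2814 ≡ + 42 ℤ.* r ℤ.+ (+ 42 ℤ.* (+ 67 ℤ.* N ℤ.- r) ℤ.+ + 67 ℤ.* (k ℤ.+ + 42 ℤ.- + 42 ℤ.* N))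
  eq₁ = solve-∀
  step : + 42 ℤ.* + r ℤ.≤ + 67 ℤ.* + k ℤ.+ + 2814
  step = ≤-by _ (0≤+ {42} ⊗ diff r≤67N ⊕ 0≤+ {67} ⊗ diff 42N≤) (eq₁ (+ r) (+ k) N)
  eq₂ : ∀ r k → + 42 ℤ.* (+ 761 ℤ.* k) ≡ + 42 ℤ.* (+ 477 ℤ.* r) ℤ.+
    (+ 477 ℤ.* (+ 67 ℤ.* k ℤ.+ + 2814 ℤ.- + 42 ℤ.* r) ℤ.+ + 3 ℤ.* (k ℤ.- + 447426))
  eq₂ = solve-∀

-- Rational arithmetic and the comparison with √19

toℚᵘ-ι : ∀ m → ℚ.toℚᵘ (ι m) ℚᵘ.≃ ℚᵘ.mkℚᵘ (+ m) 0
toℚᵘ-ι m = ℚₚ.toℚᵘ-fromℚᵘ (ℚᵘ.mkℚᵘ (+ m) 0)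

ι-+ : ∀ a b → ι (a ℕ.+ b) ≡ ι a ℚ.+ ι b
ι-+ a b = ℚₚ.toℚᵘ-injective (ℚᵘₚ.≃-trans (toℚᵘ-ι (a ℕ.+ b)) (ℚᵘₚ.≃-trans
  (ℚᵘ.*≡* (trans (cong (ℤ._* 1ℤ) (ℤₚ.pos-+ a b)) (eq (+ a) (+ b))))
  (ℚᵘₚ.≃-sym (ℚᵘₚ.≃-trans (ℚₚ.toℚᵘ-homo-+ (ι a) (ι b)) (ℚᵘₚ.+-cong (toℚᵘ-ι a) (toℚᵘ-ι b))))))
  where
  eq : ∀ a b → (a ℤ.+ b) ℤ.* 1ℤ ≡ (a ℤ.* 1ℤ ℤ.+ b ℤ.* 1ℤ) ℤ.* 1ℤ
  eq = solve-∀

ι-* : ∀ a b → ι (a ℕ.* b) ≡ ι a ℚ.* ι b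
ι-* a b = ℚₚ.toℚᵘ-injective (ℚᵘₚ.≃-trans (toℚᵘ-ι (a ℕ.* b)) (ℚᵘₚ.≃-trans
  (ℚᵘ.*≡* (cong (ℤ._* 1ℤ) (ℤₚ.pos-* a b)))
  (ℚᵘₚ.≃-sym (ℚᵘₚ.≃-trans (ℚₚ.toℚᵘ-homo-* (ι a) (ι b)) (ℚᵘₚ.*-cong (toℚᵘ-ι a) (toℚᵘ-ι b))))))

ι-≤ : ∀ {a b} → a ℕ.≤ b → ι a ℚ.≤ ι b
ι-≤ {a} {b} a≤b = ℚₚ.toℚᵘ-cancel-≤ (ℚᵘₚ.≤-trans (ℚᵘₚ.≤-reflexive (toℚᵘ-ι a)) (ℚᵘₚ.≤-trans
  (ℚᵘ.*≤* (ℤₚ.*-monoʳ-≤-nonNeg 1ℤ (ℤ.+≤+ a≤b))) (ℚᵘₚ.≤-reflexive (ℚᵘₚ.≃-sym (toℚᵘ-ι b)))))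

ι-< : ∀ {a b} → a ℕ.< b → ι a ℚ.< ι b
ι-< {a} {b} a<b = ℚₚ.toℚᵘ-cancel-< (ℚᵘₚ.≤-<-trans (ℚᵘₚ.≤-reflexive (toℚᵘ-ι a)) (ℚᵘₚ.<-≤-trans
  (ℚᵘ.*<* (ℤₚ.*-monoʳ-<-pos 1ℤ (ℤ.+<+ a<b))) (ℚᵘₚ.≤-reflexive (ℚᵘₚ.≃-sym (toℚᵘ-ι b)))))

ι-nonNeg : ∀ a → ℚ.NonNegative (ι a)
ι-nonNeg a = ℚ.nonNegative (ι-≤ {0} {a} ℕ.z≤n)

-- A negative `x` satisfies the first alternative. Otherwise ax ≤ b may be squared, and a² is
-- cancelled from a²x² ≤ b² < a²S.
<√-scaled : ∀ a b S {x} → ι a ℚ.* x ℚ.≤ ι b → b ℕ.* b ℕ.< a ℕ.* a ℕ.* S → x <√ S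
<√-scaled a b S {x} ax≤b b²< with x ℚₚ.<? 0ℚ
... | yes x<0 = inj₁ x<0
... | no x≮0  = inj₂ (ℚₚ.*-cancelˡ-<-nonNeg (ι (a ℕ.* a)) {{ι-nonNeg (a ℕ.* a)}} (begin-strict
  ι (a ℕ.* a) ℚ.* (x ℚ.* x)    ≡⟨ trans (cong (ℚ._* (x ℚ.* x)) (ι-* a a)) (interchange (ι a) x) ⟩
  (ι a ℚ.* x) ℚ.* (ι a ℚ.* x)  ≤⟨ ℚₚ.*-monoˡ-≤-nonNeg (ι a ℚ.* x) {{ax≥0}} ax≤b ⟩
  (ι a ℚ.* x) ℚ.* ι b          ≤⟨ ℚₚ.*-monoʳ-≤-nonNeg (ι b) {{ι-nonNeg b}} ax≤b ⟩
  ι b ℚ.* ι b                  ≡⟨ sym (ι-* b b) ⟩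
  ι (b ℕ.* b)                  <⟨ ι-< b²< ⟩
  ι (a ℕ.* a ℕ.* S)            ≡⟨ ι-* (a ℕ.* a) S ⟩
  ι (a ℕ.* a) ℚ.* ι S          ∎))
  where
  open ℚₚ.≤-Reasoning
  interchange : ∀ a x → (a ℚ.* a) ℚ.* (x ℚ.* x) ≡ (a ℚ.* x) ℚ.* (a ℚ.* x)
  interchange a x = begin-equality
    (a ℚ.* a) ℚ.* (x ℚ.* x)  ≡⟨ ℚₚ.*-assoc a a (x ℚ.* x) ⟩
    a ℚ.* (a ℚ.* (x ℚ.* x))  ≡⟨ cong (a ℚ.*_) (sym (ℚₚ.*-assoc a x x)) ⟩
    a ℚ.* (a ℚ.* x ℚ.* x)    ≡⟨ cong (a ℚ.*_) (ℚₚ.*-comm (a ℚ.* x) x) ⟩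
    a ℚ.* (x ℚ.* (a ℚ.* x))  ≡⟨ sym (ℚₚ.*-assoc a x (a ℚ.* x)) ⟩
    (a ℚ.* x) ℚ.* (a ℚ.* x)  ∎
  ax≥0 : ℚ.NonNegative (ι a ℚ.* x)
  ax≥0 = ℚₚ.nonNeg*nonNeg⇒nonNeg (ι a) {{ι-nonNeg a}} x {{ℚ.nonNegative (ℚₚ.≮⇒≥ x≮0)}}

squares< : ∀ {a b c k} → b ℕ.* b ℕ.< a ℕ.* a ℕ.* c → 0 ℕ.< k → b ℕ.* k ℕ.* (b ℕ.* k) ℕ.< a ℕ.* a ℕ.* (c ℕ.* k ℕ.* k)
squares< {a} {b} {c} {k} b²< 0<k = subst₂ ℕ._<_ (sym (ℕₚ.[m*n]*[o*p]≡[m*o]*[n*p] b k b k))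
  (trans (ℕₚ.*-assoc (a ℕ.* a) c (k ℕ.* k)) (cong (a ℕ.* a ℕ.*_) (sym (ℕₚ.*-assoc c k k))))
  (ℕₚ.*-monoˡ-< (k ℕ.* k) {{ℕ.>-nonZero (ℕₚ.*-mono-< 0<k 0<k)}} b²<)

-- 231/53 is a rational number between 9 · 67/42 - 10 and √19.
theorem2 : (ε : ℚ) → Positive ε →
    ∃[ k₀ ] ((k : ℕ) → k ≥ k₀ →
    (r : ℕ) → IsRamseyNumberMessyPath k r → BelowBound ε k r)
theorem2 ε ε>0 = 5000000 , λ k k≥ r ramsey → <√-scaled 53 (231 ℕ.* k) (19 ℕ.* k ℕ.* k) (bound k r (ramsey-≤ k≥ ramsey))
    (squares< {53} {231} {19} {k} (from-yes (231 ℕ.* 231 ℕ.<? 53 ℕ.* 53 ℕ.* 19)) (ℕₚ.≤-trans (ℕ.s≤s ℕ.z≤n) k≥))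
  where
  open ℚₚ.≤-Reasoning
  bound : ∀ k r → 477 ℕ.* r ℕ.≤ 761 ℕ.* k →
    ι 53 ℚ.* ((ι (9 ℕ.* r) ℚ.- ι (10 ℕ.* k)) ℚ.- ((ι 9 ℚ.* ε) ℚ.* ι k)) ℚ.≤ ι (231 ℕ.* k)
  bound k r r≤ = begin
    ι 53 ℚ.* ((ι (9 ℕ.* r) ℚ.- ι (10 ℕ.* k)) ℚ.- ((ι 9 ℚ.* ε) ℚ.* ι k))
      ≤⟨ ℚₚ.*-monoˡ-≤-nonNeg (ι 53) (ℚₚ.≤-trans
           (ℚₚ.+-monoʳ-≤ (ι (9 ℕ.* r) ℚ.- ι (10 ℕ.* k)) (ℚₚ.neg-antimono-≤ (ℚₚ.nonNegative⁻¹ _ {{error≥0}})))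
           (ℚₚ.≤-reflexive (ℚₚ.+-identityʳ (ι (9 ℕ.* r) ℚ.- ι (10 ℕ.* k))))) ⟩
    ι 53 ℚ.* (ι (9 ℕ.* r) ℚ.- ι (10 ℕ.* k))
      ≡⟨ trans (ℚₚ.*-distribˡ-+ (ι 53) (ι (9 ℕ.* r)) (ℚ.- ι (10 ℕ.* k)))
           (cong₂ ℚ._+_ (sym (ι-* 53 (9 ℕ.* r))) (trans (sym (ℚₚ.neg-distribʳ-* (ι 53) (ι (10 ℕ.* k))))
             (cong ℚ.-_ (sym (ι-* 53 (10 ℕ.* k)))))) ⟩
    ι (53 ℕ.* (9 ℕ.* r)) ℚ.- ι (53 ℕ.* (10 ℕ.* k))
      ≤⟨ ℚₚ.+-monoˡ-≤ (ℚ.- ι (53 ℕ.* (10 ℕ.* k))) (ℚₚ.≤-trans (ι-≤ scaled)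
           (ℚₚ.≤-reflexive (ι-+ (231 ℕ.* k) (53 ℕ.* (10 ℕ.* k))))) ⟩
    ι (231 ℕ.* k) ℚ.+ ι (53 ℕ.* (10 ℕ.* k)) ℚ.- ι (53 ℕ.* (10 ℕ.* k))
      ≡⟨ trans (ℚₚ.+-assoc (ι (231 ℕ.* k)) (ι (53 ℕ.* (10 ℕ.* k))) (ℚ.- ι (53 ℕ.* (10 ℕ.* k))))
           (trans (cong (ι (231 ℕ.* k) ℚ.+_) (ℚₚ.+-inverseʳ (ι (53 ℕ.* (10 ℕ.* k))))) (ℚₚ.+-identityʳ (ι (231 ℕ.* k)))) ⟩
    ι (231 ℕ.* k) ∎
    where
    error≥0 : ℚ.NonNegative ((ι 9 ℚ.* ε) ℚ.* ι k)
    error≥0 = ℚₚ.nonNeg*nonNeg⇒nonNeg (ι 9 ℚ.* ε)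
      {{ℚₚ.nonNeg*nonNeg⇒nonNeg (ι 9) ε {{ℚₚ.pos⇒nonNeg ε {{ε>0}}}}}} (ι k) {{ι-nonNeg k}}
    scaled : 53 ℕ.* (9 ℕ.* r) ℕ.≤ 231 ℕ.* k ℕ.+ 53 ℕ.* (10 ℕ.* k)
    scaled = subst₂ ℕ._≤_ (ℕₚ.*-assoc 53 9 r)
      (trans (ℕₚ.*-distribʳ-+ k 231 530) (cong (231 ℕ.* k ℕ.+_) (ℕₚ.*-assoc 53 10 k))) r≤
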